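{- Let $\mathcal C$ be a hereditary, topologically closed class of finite graphs which is either somewhere dense or has bounded expansion. Then the following are equivalent: (1) for every integer $p$ there is a non-bipartite finite graph $H_p$ of odd-girth strictly greater than $2p+1$ such that $H_p$-coloring is first-order definable on $\mathcal C$; (2) the class $\mathcal C$ has bounded expansion. Moreover, suppose the following statement (*) holds: "for every monotone nowhere dense class $\mathcal D$ of graphs that does not have bounded expansion there exists an integer $p$ such that $\mathcal D$ contains $p$-subdivisions of graphs with arbitrarily large chromatic number and arbitrarily large girth". Then the equivalence of (1) and (2) holds for every hereditary, addable, topologically closed class $\mathcal C$ of finite graphs.
   Context: Graphs are finite, simple and undirected. A class $\mathcal C$ is hereditary if it is closed under induced subgraphs, monotone if closed under subgraphs, addable if closed under disjoint unions, and topologically closed if every subdivision of a graph in $\mathcal C$ is in $\mathcal C$. The $k$-subdivision of a graph $G$ is obtained by replacing every edge by a path of length $k+1$; a $\le k$-subdivision replaces every edge by a path of length at most $k+1$. For a half-integer $p$, $H$ is a shallow topological minor of $G$ at depth $p$ if some $\le 2p$-subdivision of $H$ is a subgraph of $G$; $\mathcal C\,\widetilde\triangledown\, p$ denotes the class of all such minors of graphs in $\mathcal C$. $\mathcal C$ is somewhere dense if there is an integer $p$ such that the $p$-subdivision of every finite graph is a subgraph of some graph in $\mathcal C$, and nowhere dense otherwise (equivalently, the clique number of $\mathcal C\,\widetilde\triangledown\, p$ is finite for every $p$). $\mathcal C$ has bounded expansion if for every integer $p$ the average degrees of the shallow minors at depth $p$ of graphs in $\mathcal C$ are bounded (equivalently,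 the average degrees of graphs in $\mathcal C\,\widetilde\triangledown\, p$ are bounded). The odd-girth of a graph is the length of its shortest odd cycle. $G\to H$ means there is a homomorphism from $G$ to $H$. $H$-coloring is first-order definable on $\mathcal C$ if there is a first-order sentence $\Phi$ in the language of graphs (one binary adjacency relation) such that for every $G\in\mathcal C$, $G\models\Phi$ if and only if $G\to H$. -}

module Defs where

open import Data.Nat using (ℕ; zero; suc; _+_; _*_; _≤_)
open import Data.Bool using (Bool; true; false; if_then_else_)
open import Data.Fin using (Fin; zero; suc; inject₁; fromℕ; splitAt; _<_)
open import Data.Fin.Properties using ()
open import Data.List using (List; map; allFin)
open import Data.Nat.ListAction using (sum)
open import Data.Sum using (_⊎_; inj₁; inj₂)
open import Data.Product using (Σ; ∃; ∃-syntax; _×_; _,_)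
open import Data.Empty using (⊥)
open import Relation.Nullary using (¬_)
open import Relation.Binary.PropositionalEquality using (_≡_; _≢_)
import Data.Vec.Functional as VF

record Graph : Set where
  field
    n     : ℕ
    adj   : Fin n → Fin n → Bool
    sym   : ∀ x y → adj x y ≡ adj y x
    irrefl : ∀ x → adj x x ≡ false
open Graph public

V : Graph → Set
V G = Fin (n G)

Adj : (G : Graph) → V G → V G → Set
Adj G x y = adj G x y ≡ true

Class : Set₁
Class = Graph → Set

Injective : {A B : Set} → (A → B) → Set
Injective f = ∀ a b → f a ≡ f b → a ≡ b

Subgraph : Graph → Graph → Set
Subgraph H G = Σ (V H → V G) λ f → Injective f × (∀ x y → Adj H x y → Adj G (f x) (f y))

InducedSubgraph : Graph → Graph → Set
InducedSubgraph H G = Σ (V H → V G) λ f → Injective f × (∀ x y → adj H x y ≡ adj G (f x) (f y))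

_⟶_ : Graph → Graph → Set
G ⟶ H = Σ (V G → V H) λ f → ∀ x y → Adj G x y → Adj H (f x) (f y)

private
  adj⊎ : {m k : ℕ} → (Fin m → Fin m → Bool) → (Fin k → Fin k → Bool) → Fin m ⊎ Fin k → Fin m ⊎ Fin k → Bool
  adj⊎ a b (inj₁ x) (inj₁ y) = a x y
  adj⊎ a b (inj₂ x) (inj₂ y) = b x y
  adj⊎ a b (inj₁ x) (inj₂ y) = false
  adj⊎ a b (inj₂ x) (inj₁ y) = false

  sym⊎ : (G H : Graph) → ∀ x y → adj⊎ (adj G) (adj H) x y ≡ adj⊎ (adj G) (adj H) y x
  sym⊎ G H (inj₁ x) (inj₁ y) = sym G x y
  sym⊎ G H (inj₂ x) (inj₂ y) = sym H x y
  sym⊎ G H (inj₁ x) (inj₂ y) = Relation.Binary.PropositionalEquality.refl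
  sym⊎ G H (inj₂ x) (inj₁ y) = Relation.Binary.PropositionalEquality.refl

  irrefl⊎ : (G H : Graph) → ∀ x → adj⊎ (adj G) (adj H) x x ≡ false
  irrefl⊎ G H (inj₁ x) = irrefl G x
  irrefl⊎ G H (inj₂ x) = irrefl H x

_⊎ᴳ_ : Graph → Graph → Graph
G ⊎ᴳ H = record
  { n = n G + n H
  ; adj = λ x y → adj⊎ (adj G) (adj H) (splitAt (n G) x) (splitAt (n G) y)
  ; sym = λ x y → sym⊎ G H (splitAt (n G) x) (splitAt (n G) y)
  ; irrefl = λ x → irrefl⊎ G H (splitAt (n G) x)
  }

-- Subdivisions.
-- An edge of H, oriented by the order of Fin (each undirected edge once).

record Edge (H : Graph) : Set where
  constructor edge
  field
    src : V H
    tgt : V H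
    src<tgt : src < tgt
    isAdj : Adj H src tgt
open Edge public

-- A topological model of H in S: branch vertices plus, for each edge e of H,
-- a path of length suc (len e) in S between the branch vertices of its ends,
-- the paths being internally vertex-disjoint and avoiding branch vertices.
-- The internal vertices of path e are  path e (suc (inject₁ j)),  j : Fin (len e).
record TopModel (H S : Graph) : Set where
  field
    branch       : V H → V S
    branch-inj   : Injective branch
    len          : Edge H → ℕ
    path         : (e : Edge H) → Fin (suc (suc (len e))) → V S
    path-inj     : ∀ e → Injective (path e)
    path-start   : ∀ e → path e zero ≡ branch (src e)
    path-end     : ∀ e → path e (fromℕ (suc (len e))) ≡ branch (tgt e)
    path-adj     : ∀ e (i : Fin (suc (len e))) → Adj S (path e (inject₁ i)) (path e (suc i))
    internal-disjoint : ∀ e e' (j : Fin (len e)) (j' : Fin (len e')) →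
                   path e (suc (inject₁ j)) ≡ path e' (suc (inject₁ j')) →
                   (src e ≡ src e') × (tgt e ≡ tgt e')
    internal-not-branch : ∀ e (j : Fin (len e)) a → path e (suc (inject₁ j)) ≢ branch a
open TopModel public

record IsSubdivision (H S : Graph) : Set where
  field
    model : TopModel H S
    covers-vertices : ∀ (x : V S) →
      (∃[ a ] branch model a ≡ x) ⊎
      (∃[ e ] ∃[ j ] path model e (suc (inject₁ {len model e} j)) ≡ x)
    covers-edges : ∀ (x y : V S) → Adj S x y →
      ∃[ e ] ∃[ i ]
        ((path model e (inject₁ {suc (len model e)} i) ≡ x × path model e (suc i) ≡ y) ⊎
         (path model e (inject₁ {suc (len model e)} i) ≡ y × path model e (suc i) ≡ x))
open IsSubdivision public

IsExactSubdivision : ℕ → Graph → Graph → Set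
IsExactSubdivision k H S = Σ (IsSubdivision H S) λ s → ∀ e → len (model s) e ≡ k

IsLeSubdivision : ℕ → Graph → Graph → Set
IsLeSubdivision k H S = Σ (IsSubdivision H S) λ s → ∀ e → len (model s) e ≤ k

Hereditary : Class → Set
Hereditary C = ∀ G H → C G → InducedSubgraph H G → C H

Monotone : Class → Set
Monotone C = ∀ G H → C G → Subgraph H G → C H

Addable : Class → Set
Addable C = ∀ G H → C G → C H → C (G ⊎ᴳ H)

TopologicallyClosed : Class → Set
TopologicallyClosed C = ∀ G S → C G → IsSubdivision G S → C S

-- Shallow topological minors.  The depth p is a half-integer, so we index by
-- r = 2p : H ∈ C ~▽ p  iff some ≤ r-subdivision of H is a subgraph of some G ∈ C.

ShallowTopMinorAt : ℕ → Graph → Graph → Set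
ShallowTopMinorAt r H G = ∃[ S ] (IsLeSubdivision r H S × Subgraph S G)

_∇̃_ : Class → ℕ → Class
(C ∇̃ r) H = ∃[ G ] (C G × ShallowTopMinorAt r H G)

degreeSum : Graph → ℕ
degreeSum G = sum (map (λ x → sum (map (λ y → if adj G x y then 1 else 0) (allFin (n G)))) (allFin (n G)))

-- Average degree 2|E|/|V| of graphs in C ~▽ p bounded, for every integer p
-- (depth p corresponds to r = 2p).
BoundedExpansion : Class → Set
BoundedExpansion C = ∀ (p : ℕ) → ∃[ d ] ∀ H → (C ∇̃ (2 * p)) H → degreeSum H ≤ d * n H

SomewhereDense : Class → Set
SomewhereDense C = ∃[ p ] ∀ (H : Graph) → ∃[ G ] (C G × ∃[ S ] (IsExactSubdivision p H S × Subgraph S G))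

NowhereDense : Class → Set
NowhereDense C = ¬ SomewhereDense C

Colorable : Graph → ℕ → Set
Colorable G k = Σ (V G → Fin k) λ f → ∀ x y → Adj G x y → f x ≢ f y

Bipartite : Graph → Set
Bipartite G = Colorable G 2

-- a cycle of length m + 3 in G
Cycle : Graph → ℕ → Set
Cycle G m = Σ (Fin (suc (suc (suc m))) → V G) λ c →
  Injective c ×
  (∀ (i : Fin (suc (suc m))) → Adj G (c (inject₁ i)) (c (suc i))) ×
  Adj G (c (fromℕ (suc (suc m)))) (c zero)

GirthGt : Graph → ℕ → Set
GirthGt G g = ∀ m → 3 + m ≤ g → ¬ Cycle G m

OddGirthGt : Graph → ℕ → Set
OddGirthGt G q = ∀ m k → 3 + m ≡ suc (k + k) → 3 + m ≤ q → ¬ Cycle G m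

ChromaticGt : Graph → ℕ → Set
ChromaticGt G k = ¬ Colorable G k

data Formula : ℕ → Set where
  adjF  : ∀ {k} → Fin k → Fin k → Formula k
  eqF   : ∀ {k} → Fin k → Fin k → Formula k
  ⊥F    : ∀ {k} → Formula k
  ¬F    : ∀ {k} → Formula k → Formula k
  _∧F_  : ∀ {k} → Formula k → Formula k → Formula k
  _∨F_  : ∀ {k} → Formula k → Formula k → Formula k
  _⇒F_  : ∀ {k} → Formula k → Formula k → Formula k
  ∀F    : ∀ {k} → Formula (suc k) → Formula k
  ∃F    : ∀ {k} → Formula (suc k) → Formula k

Sentence : Set
Sentence = Formula 0

Sat : ∀ {k} (G : Graph) → (Fin k → V G) → Formula k → Set
Sat G ρ (adjF i j) = Adj G (ρ i) (ρ j)
Sat G ρ (eqF i j)  = ρ i ≡ ρ j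
Sat G ρ ⊥F         = ⊥
Sat G ρ (¬F φ)     = ¬ Sat G ρ φ
Sat G ρ (φ ∧F ψ)   = Sat G ρ φ × Sat G ρ ψ
Sat G ρ (φ ∨F ψ)   = Sat G ρ φ ⊎ Sat G ρ ψ
Sat G ρ (φ ⇒F ψ)   = Sat G ρ φ → Sat G ρ ψ
Sat G ρ (∀F φ)     = ∀ (x : V G) → Sat G (x VF.∷ ρ) φ
Sat G ρ (∃F φ)     = Σ (V G) λ x → Sat G (x VF.∷ ρ) φ

_⊨_ : Graph → Sentence → Set
G ⊨ Φ = Sat G (λ ()) Φ

_↔_ : Set → Set → Set
A ↔ B = (A → B) × (B → A)

FODefinableColoring : Graph → Class → Set
FODefinableColoring H C = ∃[ Φ ] ∀ G → C G → ((G ⊨ Φ) ↔ (G ⟶ H))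

Condition1 : Class → Set
Condition1 C = ∀ (p : ℕ) → ∃[ H ] (¬ Bipartite H × OddGirthGt H (2 * p + 1) × FODefinableColoring H C)

StarHypothesis : Set₁
StarHypothesis = ∀ (D : Class) → Monotone D → NowhereDense D → ¬ BoundedExpansion D →
  ∃[ p ] ∀ (k g : ℕ) → ∃[ G ] (ChromaticGt G k × GirthGt G g × ∃[ S ] (IsExactSubdivision p G S × D S))

{-# OPTIONS --safe #-}
-- Bounded expansion gives (1).  Let q = 2p + 1.  G maps to the target graph Ω built from N colours
-- iff G has an N-colouring in which the ends of any walk of length q differ, and Ω has no odd closed
-- walk of length ≤ q.  A graph of the class without closed walks of length q has such a colouring
-- with boundedly many colours: sparsity of shallow topological minors yields a linear order with few
-- weakly q-reachable vertices; colour these apart, and let u record from which colours, at which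
-- distance, a walk descending to its minimum reaches u.  So Ω-colouring is defined by the absence of
-- closed walks of length q; shift graphs show that Ω is not bipartite.
--
-- (1) excludes the dense case.  The class is monotone, and contains, with many disjoint copies, an
-- odd-length subdivision S of a graph of large chromatic number and large odd girth (shift graphs in
-- the somewhere dense case, the graphs of (*) otherwise), so that S does not map to H.  Disjoint
-- copies of the balls of S are bipartite, hence map to H, but adding S to them is not noticed by a
-- first-order sentence of small quantifier rank.
--
-- In the second part (1) only refutes the negation of bounded expansion; excluded middle is
-- recovered from (*), applied to a class of high-girth graphs depending on the proposition.
module Submission where

open import Defs
open import Axiom.UniquenessOfIdentityProofs using (module Decidable⇒UIP)
open import Data.Bool using (Bool; true; false; if_then_else_; _xor_; not)
open import Data.Bool.Properties using (xor-assoc; xor-same; xor-identityʳ) renaming (_≟_ to _≟ᵇ_)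
open import Data.Empty using (⊥; ⊥-elim)
open import Data.Fin using (Fin; zero; suc; toℕ; fromℕ; fromℕ<; inject₁)
import Data.Fin as Fin
import Data.Fin.Properties as Finₚ
open import Data.List using (List; []; _∷_; _++_; map; filter; length; lookup; allFin; concatMap; reverse;
                             tabulate; cartesianProduct; cartesianProductWith)
import Data.List.Properties as Listₚ
open import Data.List.Membership.Propositional using (_∈_; _∉_; find; lose)
import Data.List.Membership.Propositional.Properties as ∈ₚ
open import Data.List.Relation.Unary.All using (All; []; _∷_)
import Data.List.Relation.Unary.All as All
import Data.List.Relation.Unary.All.Properties as Allₚ
open import Data.List.Relation.Unary.AllPairs using (AllPairs; []; _∷_)
import Data.List.Relation.Unary.AllPairs as AllPairs
import Data.List.Relation.Unary.AllPairs.Properties as AllPairsₚ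
open import Data.List.Relation.Unary.Any using (Any; here; there)
import Data.List.Relation.Unary.Any as Any
import Data.List.Relation.Unary.Any.Properties as Anyₚ
open import Data.List.Relation.Unary.Unique.Propositional using (Unique)
import Data.List.Relation.Unary.Unique.Propositional.Properties as Uniqueₚ
open import Data.Nat using (ℕ; zero; suc; _+_; _*_; _∸_; _^_; _≤_; _<_; z≤n; s≤s)
import Data.Nat as ℕ
open import Data.Nat.ListAction using (sum)
import Data.Nat.Properties as ℕₚ
open import Data.Nat.Solver using (module +-*-Solver)
open import Data.Product using (Σ; ∃; ∃-syntax; _×_; _,_; proj₁; proj₂; uncurry)
open import Data.Sum using (_⊎_; inj₁; inj₂)
import Data.Sum as Sum
import Data.Sum.Properties as Sumₚ
open import Data.Unit using (⊤; tt)
import Data.Vec.Functional as VF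
open import Function using (_∘_; id; case_of_)
open import Relation.Binary using (tri<; tri≈; tri>)
open import Relation.Binary.PropositionalEquality using (_≡_; _≢_; refl; trans; cong; cong₂; subst; subst₂) renaming (sym to ≡-sym)
open import Relation.Nullary using (¬_; Dec; yes; no; does)
open import Relation.Nullary.Decidable using (map′; _×-dec_; _⊎-dec_; ¬?; _→-dec_; decidable-stable)
open +-*-Solver using (solve; con; _:+_; _:*_; _:=_)

-- Graphs and walks

-- The order of the choices is what makes the exclusion of dense classes work. Somewhere density, or
-- (*), fixes the number p of subdividing vertices before the graph to be subdivided. Then (1), used
-- at about p/2, yields an H whose odd girth exceeds the length of the subdivided edges, together
-- with a sentence Φ. Only now is the graph G chosen, with chromatic number above |H| and odd girth
-- beyond the locality radius of Φ. Paths of odd length serve twice: folding them maps S to G, so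
-- that S inherits the absence of short odd closed walks; and a homomorphism from S to H turns each
-- of them into an odd walk too short to be closed, so that it would colour G with the vertices of
-- H.
--
-- In the other direction one target must serve the whole class, so the number of colours may depend
-- on the density bounds only; a single graph enters through Φ alone. Odd girth is handled through
-- closed walks, which homomorphisms preserve and which can be padded to one fixed length that a
-- single formula expresses.

does-true : ∀ {A : Set} (d : Dec A) → does d ≡ true → A
does-true (yes a) _ = a

true-does : ∀ {A : Set} (d : Dec A) → A → does d ≡ true
true-does (yes _) _ = refl
true-does (no ¬a) a = ⊥-elim (¬a a)

false-does : ∀ {A : Set} (d : Dec A) → ¬ A → does d ≡ false
false-does (yes a) ¬a = ⊥-elim (¬a a)
false-does (no _)  _  = refl

does-cong : ∀ {A B : Set} (d : Dec A) (e : Dec B) → (A → B) → (B → A) → does d ≡ does e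
does-cong d (yes b) f g = true-does d (g b)
does-cong d (no ¬b) f g = false-does d (λ a → ¬b (f a))

module MkGraph {m : ℕ} {R : Fin m → Fin m → Set}
  (R? : ∀ x y → Dec (R x y)) (R-sym : ∀ {x y} → R x y → R y x) (R-irrefl : ∀ {x} → ¬ R x x) where

  graph : Graph
  graph = record
    { n = m
    ; adj = λ x y → does (R? x y)
    ; sym = λ x y → does-cong (R? x y) (R? y x) R-sym R-sym
    ; irrefl = λ x → false-does (R? x x) R-irrefl
    }

  toAdj : ∀ {x y} → R x y → Adj graph x y
  toAdj = true-does (R? _ _)

  fromAdj : ∀ {x y} → Adj graph x y → R x y
  fromAdj = does-true (R? _ _)

Adj? : ∀ G x y → Dec (Adj G x y)
Adj? G x y = adj G x y ≟ᵇ true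

Adj-sym : ∀ G {x y} → Adj G x y → Adj G y x
Adj-sym G {x} {y} a = trans (Defs.sym G y x) a

Adj-irrefl : ∀ G {x} → ¬ Adj G x x
Adj-irrefl G {x} a with trans (≡-sym a) (irrefl G x)
... | ()

Adj⇒≢ : ∀ G {x y} → Adj G x y → x ≢ y
Adj⇒≢ G a refl = Adj-irrefl G a

⟶-trans : ∀ {G H K} → G ⟶ H → H ⟶ K → G ⟶ K
⟶-trans (f , p) (g , q) = (λ x → g (f x)) , λ x y a → q _ _ (p x y a)

Subgraph-trans : ∀ {G H K} → Subgraph G H → Subgraph H K → Subgraph G K
Subgraph-trans (f , i , p) (g , j , q) =
  (λ x → g (f x)) , (λ a b e → i a b (j _ _ e)) , λ x y a → q _ _ (p x y a)

Subgraph-refl : ∀ {G} → Subgraph G G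
Subgraph-refl = id , (λ _ _ e → e) , λ _ _ a → a

data Walk {X : Set} (R : X → X → Set) : X → X → ℕ → Set where
  nil  : ∀ {x} → Walk R x x 0
  cons : ∀ {x y z l} → R x y → Walk R y z l → Walk R x z (suc l)

module _ {X : Set} {R : X → X → Set} where

  _⋆_ : ∀ {x y z k l} → Walk R x y k → Walk R y z l → Walk R x z (k + l)
  nil      ⋆ w = w
  cons r v ⋆ w = cons r (v ⋆ w)

  castʷ : ∀ {x y k l} → k ≡ l → Walk R x y k → Walk R x y l
  castʷ refl w = w

  snoc : ∀ {x y z l} → Walk R x y l → R y z → Walk R x z (suc l)
  snoc {l = l} w r = castʷ (ℕₚ.+-comm l 1) (w ⋆ cons r nil)

  module _ (R-sym : ∀ {x y} → R x y → R y x) where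
    reverseʷ : ∀ {x y l} → Walk R x y l → Walk R y x l
    reverseʷ nil        = nil
    reverseʷ (cons r w) = snoc (reverseʷ w) (R-sym r)

    -- Retracing the first step twice lengthens a closed walk without changing its parity.
    padʷ : ∀ {x y} k l → Walk R x y (suc l) → Walk R x y (k + k + suc l)
    padʷ zero    l w = w
    padʷ (suc k) l w with padʷ k l w
    ... | w′ rewrite ℕₚ.+-suc k k | ℕₚ.+-suc (k + k) l with w′
    ... | cons r v = cons r (cons (R-sym r) (cons r v))

  splitʷ : ∀ {x y} k {l} → Walk R x y (k + l) → ∃[ z ] (Walk R x z k × Walk R z y l)
  splitʷ zero    w          = _ , nil , w
  splitʷ (suc k) (cons r w) with splitʷ k w
  ... | z , u , v = z , cons r u , v

mapʷ : ∀ {X Y : Set} {R : X → X → Set} {S : Y → Y → Set} (f : X → Y) →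
       (∀ {x y} → R x y → S (f x) (f y)) → ∀ {x y l} → Walk R x y l → Walk S (f x) (f y) l
mapʷ f g nil        = nil
mapʷ f g (cons r w) = cons (g r) (mapʷ f g w)

walk? : ∀ {m} {R : Fin m → Fin m → Set} → (∀ x y → Dec (R x y)) → ∀ l x y → Dec (Walk R x y l)
walk? R? zero x y = map′ (λ { refl → nil }) (λ { nil → refl }) (x Fin.≟ y)
walk? R? (suc l) x y =
  map′ (λ { (_ , r , w) → cons r w }) (λ { (cons r w) → _ , r , w })
       (Finₚ.any? λ z → R? x z ×-dec walk? R? l z y)

-- Closed walks instead of the cycles of `OddGirthGt`: homomorphisms carry walks to walks but need
-- not keep cycles injective. The two notions agree, since an odd closed walk contains an odd cycle
-- that is no longer.
OddWalkFree : Graph → ℕ → Set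
OddWalkFree G q = ∀ k x → suc (k + k) ≤ q → ¬ Walk (Adj G) x x (suc (k + k))

OddWalkFree-⟶ : ∀ {G H} q → G ⟶ H → OddWalkFree H q → OddWalkFree G q
OddWalkFree-⟶ q (f , p) owf k x le w = owf k (f x) le (mapʷ f (p _ _) w)

odd? : ∀ l → (∃[ k ] l ≡ k + k) ⊎ (∃[ k ] l ≡ suc (k + k))
odd? zero = inj₁ (0 , refl)
odd? (suc l) with odd? l
... | inj₁ (k , refl) = inj₂ (k , refl)
... | inj₂ (k , refl) = inj₁ (suc k , cong suc (≡-sym (ℕₚ.+-suc k k)))

double≢odd : ∀ a b → a + a ≢ suc (b + b)
double≢odd zero b ()
double≢odd (suc a) zero e rewrite ℕₚ.+-suc a a with e
... | ()
double≢odd (suc a) (suc b) e rewrite ℕₚ.+-suc a a | ℕₚ.+-suc b b = double≢odd a b (ℕₚ.suc-injective (ℕₚ.suc-injective e))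

Unique-⊆⇒length≤ : ∀ {A : Set} {xs ys : List A} → Unique xs → (∀ {x} → x ∈ xs → x ∈ ys) → length xs ≤ length ys
Unique-⊆⇒length≤ {xs = []} _ _ = z≤n
Unique-⊆⇒length≤ {A} {x ∷ xs} {ys} (x∉ ∷ u) sub with split (sub (here refl))
  where
  split : ∀ {x : A} {ys} → x ∈ ys → ∃[ zs ] (length ys ≡ suc (length zs) × (∀ {y} → y ∈ ys → y ≢ x → y ∈ zs))
  split {ys = _ ∷ ys} (here refl) = ys , refl , λ { (here e) ne → ⊥-elim (ne e) ; (there p) _ → p }
  split {ys = y ∷ _} (there p) with split p
  ... | zs , e , f = y ∷ zs , cong suc e , λ { (here e′) _ → here e′ ; (there q) ne → there (f q ne) }
... | zs , e , f = subst (suc (length xs) ≤_) (≡-sym e)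
        (s≤s (Unique-⊆⇒length≤ u λ q → f (sub (there q)) λ { refl → All.lookup x∉ q refl }))

-- Paths

Unique-lookup-injective : ∀ {A : Set} {xs : List A} → Unique xs → ∀ i j → lookup xs i ≡ lookup xs j → i ≡ j
Unique-lookup-injective (_ ∷ _)  zero    zero    _ = refl
Unique-lookup-injective (x∉ ∷ _) zero    (suc j) e = ⊥-elim (All.lookup x∉ (∈ₚ.∈-lookup j) e)
Unique-lookup-injective (x∉ ∷ _) (suc i) zero    e = ⊥-elim (All.lookup x∉ (∈ₚ.∈-lookup i) (≡-sym e))
Unique-lookup-injective (_ ∷ u)  (suc i) (suc j) e = cong suc (Unique-lookup-injective u i j e)

∈⇒lookup : ∀ {A : Set} {x : A} {xs} → x ∈ xs → ∃[ i ] lookup xs i ≡ x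
∈⇒lookup p = Any.index p , ≡-sym (Anyₚ.lookup-index p)

∉⇒All≢ : ∀ {A : Set} {x : A} {xs} → x ∉ xs → All (x ≢_) xs
∉⇒All≢ {xs = []}    _ = []
∉⇒All≢ {xs = y ∷ _} f = (λ e → f (here e)) ∷ ∉⇒All≢ (λ p → f (there p))

All≢⇒∉ : ∀ {A : Set} {x : A} {xs} → All (x ≢_) xs → x ∉ xs
All≢⇒∉ a p = All.lookup a p refl

∈-reverse⁻ : ∀ {A : Set} {x : A} {xs} → x ∈ reverse xs → x ∈ xs
∈-reverse⁻ = Anyₚ.reverse⁻

Unique-reverse : ∀ {A : Set} {xs : List A} → Unique xs → Unique (reverse xs)
Unique-reverse {xs = []} _ = []
Unique-reverse {xs = x ∷ xs} (x∉ ∷ u) = subst Unique (≡-sym (Listₚ.unfold-reverse x xs))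
  (Uniqueₚ.++⁺ (Unique-reverse u) ([] ∷ []) λ { (p , here refl) → All≢⇒∉ x∉ (∈-reverse⁻ p) })

module _ {X : Set} (R : X → X → Set) where

  -- the path s – ms – t, given by its list ms of internal vertices
  Chain : X → List X → X → Set
  Chain s []       t = R s t
  Chain s (m ∷ ms) t = R s m × Chain m ms t

chain? : ∀ {X : Set} {R : X → X → Set} → (∀ x y → Dec (R x y)) → ∀ s ms t → Dec (Chain R s ms t)
chain? R? s []       t = R? s t
chain? R? s (m ∷ ms) t = R? s m ×-dec chain? R? m ms t

module _ {X : Set} {R : X → X → Set} where

  chain-++ : ∀ {s m t} ms {ns} → Chain R s ms m → Chain R m ns t → Chain R s (ms ++ m ∷ ns) t
  chain-++ []       c       d = c , d
  chain-++ (_ ∷ ms) (r , c) d = r , chain-++ ms c d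

  chain-split : ∀ {s m t} ms {ns} → Chain R s (ms ++ m ∷ ns) t → Chain R s ms m × Chain R m ns t
  chain-split []       c       = c
  chain-split (_ ∷ ms) (r , c) = let c′ , d = chain-split ms c in (r , c′) , d

  chain-reverse : (∀ {x y} → R x y → R y x) → ∀ {s} ms {t} → Chain R s ms t → Chain R t (reverse ms) s
  chain-reverse R-sym []       r       = R-sym r
  chain-reverse R-sym {s} (m ∷ ms) {t} (r , c) =
    subst (λ l → Chain R t l s) (≡-sym (Listₚ.unfold-reverse m ms))
          (chain-++ (reverse ms) (chain-reverse R-sym ms c) (R-sym r))

  walk⇒chain : ∀ {x y l} → Walk R x y (suc l) → ∃[ ms ] (Chain R x ms y × length ms ≡ l)
  walk⇒chain (cons r nil) = [] , r , refl
  walk⇒chain (cons {y = m} r w@(cons _ _)) =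
    let ms , c , e = walk⇒chain w in m ∷ ms , (r , c) , cong suc e

  -- Loop erasure. The tail is made a path before its head is considered; if `x` reappears there,
  -- everything before the reappearance is dropped. The inclusion of `ns` in `ms` lets avoidance
  -- conditions pass to the path.
  erase : (∀ x y → Dec (x ≡ y)) → ∀ {x} ms {y} → Chain R x ms y → x ≢ y →
    ∃[ ns ] (Chain R x ns y × Unique ns × x ∉ ns × y ∉ ns × (∀ {z} → z ∈ ns → z ∈ ms) × length ns ≤ length ms)
  erase _≟_ [] c x≢y = [] , c , [] , (λ ()) , (λ ()) , (λ ()) , z≤n
  erase _≟_ {x} (m ∷ ms) {y} (r , c) x≢y with m ≟ y
  ... | yes refl = [] , r , [] , (λ ()) , (λ ()) , (λ ()) , z≤n
  ... | no m≢y with erase _≟_ ms c m≢y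
  ... | ns , c′ , u , m∉ , y∉ , sub , le with DecM._∈?_ x (m ∷ ns)
    where import Data.List.Membership.DecPropositional _≟_ as DecM
  ... | no x∉ = m ∷ ns , (r , c′) , (∉⇒All≢ m∉ ∷ u) , x∉ , (λ { (here refl) → m≢y refl ; (there p) → y∉ p }) ,
                (λ { (here refl) → here refl ; (there p) → there (sub p) }) , s≤s le
  ... | yes x∈ with ∈ₚ.∈-∃++ x∈
  ... | pre , post , e = post , proj₂ (chain-split pre (subst (λ l → Chain R x l y) e (r , c′))) ,
        AllPairs.tail uₓ , All≢⇒∉ (AllPairs.head uₓ) , (λ p → y∉all (back p)) ,
        (λ p → suball (back p)) ,
        ℕₚ.≤-trans (ℕₚ.≤-trans (ℕₚ.n≤1+n _) (ℕₚ.≤-trans (ℕₚ.m≤n+m _ (length pre))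
          (ℕₚ.≤-reflexive (trans (≡-sym (Listₚ.length-++ pre)) (cong length (≡-sym e)))))) (s≤s le)
    where
    back : ∀ {z} → z ∈ post → z ∈ m ∷ ns
    back {z} p = subst (z ∈_) (≡-sym e) (∈ₚ.∈-++⁺ʳ pre (there p))
    dropU : ∀ pre {l} → Unique (pre ++ l) → Unique l
    dropU []        u = u
    dropU (_ ∷ pre) (_ ∷ u) = dropU pre u
    uₓ : Unique (x ∷ post)
    uₓ = dropU pre (subst Unique e (∉⇒All≢ m∉ ∷ u))
    y∉all : y ∉ m ∷ ns
    y∉all (here refl) = m≢y refl
    y∉all (there p) = y∉ p
    suball : ∀ {z} → z ∈ m ∷ ns → z ∈ m ∷ ms
    suball (here refl) = here refl
    suball (there p) = there (sub p)

module _ {X : Set} where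

  pathVertex : X → (ms : List X) → X → Fin (suc (suc (length ms))) → X
  pathVertex s ms       t zero       = s
  pathVertex s []       t (suc zero) = t
  pathVertex s (m ∷ ms) t (suc i)    = pathVertex m ms t i

  pathVertex-end : ∀ s ms t → pathVertex s ms t (fromℕ (suc (length ms))) ≡ t
  pathVertex-end s []       t = refl
  pathVertex-end s (m ∷ ms) t = pathVertex-end m ms t

  pathVertex-internal : ∀ s ms t j → pathVertex s ms t (suc (inject₁ j)) ≡ lookup ms j
  pathVertex-internal s (m ∷ ms) t zero    = refl
  pathVertex-internal s (m ∷ ms) t (suc j) = pathVertex-internal m ms t j

  pathVertex-∈ : ∀ s ms t i → pathVertex s ms t i ≡ s ⊎ pathVertex s ms t i ≡ t ⊎ pathVertex s ms t i ∈ ms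
  pathVertex-∈ s ms       t zero       = inj₁ refl
  pathVertex-∈ s []       t (suc zero) = inj₂ (inj₁ refl)
  pathVertex-∈ s (m ∷ ms) t (suc i) with pathVertex-∈ m ms t i
  ... | inj₁ e        = inj₂ (inj₂ (here e))
  ... | inj₂ (inj₁ e) = inj₂ (inj₁ e)
  ... | inj₂ (inj₂ p) = inj₂ (inj₂ (there p))

  pathVertex-suc : ∀ s ms t i → pathVertex s ms t (suc i) ≡ t ⊎ pathVertex s ms t (suc i) ∈ ms
  pathVertex-suc s []       t zero = inj₁ refl
  pathVertex-suc s (m ∷ ms) t i with pathVertex-∈ m ms t i
  ... | inj₁ e        = inj₂ (here e)
  ... | inj₂ (inj₁ e) = inj₁ e
  ... | inj₂ (inj₂ p) = inj₂ (there p)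

  pathVertex-injective : ∀ {s ms t} → Unique ms → s ∉ ms → t ∉ ms → s ≢ t → Injective (pathVertex s ms t)
  pathVertex-injective u s∉ t∉ s≢t zero zero e = refl
  pathVertex-injective {s} {ms} {t} u s∉ t∉ s≢t zero (suc j) e with pathVertex-suc s ms t j
  ... | inj₁ e′ = ⊥-elim (s≢t (trans e e′))
  ... | inj₂ p  = ⊥-elim (s∉ (subst (_∈ ms) (≡-sym e) p))
  pathVertex-injective {s} {ms} {t} u s∉ t∉ s≢t (suc i) zero e with pathVertex-suc s ms t i
  ... | inj₁ e′ = ⊥-elim (s≢t (trans (≡-sym e) e′))
  ... | inj₂ p  = ⊥-elim (s∉ (subst (_∈ ms) e p))
  pathVertex-injective {ms = []} u s∉ t∉ s≢t (suc zero) (suc zero) e = refl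
  pathVertex-injective {ms = m ∷ ms} (m∉ ∷ u) s∉ t∉ s≢t (suc i) (suc j) e =
    cong suc (pathVertex-injective u (All≢⇒∉ m∉) (λ p → t∉ (there p)) (λ { refl → t∉ (here refl) }) i j e)

  module _ {R : X → X → Set} where
    pathVertex-adj : ∀ {s} ms {t} → Chain R s ms t → ∀ i → R (pathVertex s ms t (inject₁ i)) (pathVertex s ms t (suc i))
    pathVertex-adj []       c       zero    = c
    pathVertex-adj (m ∷ ms) (r , c) zero    = r
    pathVertex-adj (m ∷ ms) (r , c) (suc i) = pathVertex-adj ms c i

  Consec : X → List X → X → X → X → Set
  Consec s []       t x y = s ≡ x × t ≡ y
  Consec s (m ∷ ms) t x y = (s ≡ x × m ≡ y) ⊎ Consec m ms t x y

  consec? : (∀ x y → Dec (x ≡ y)) → ∀ s ms t x y → Dec (Consec s ms t x y)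
  consec? _≟_ s []       t x y = (s ≟ x) ×-dec (t ≟ y)
  consec? _≟_ s (m ∷ ms) t x y = ((s ≟ x) ×-dec (m ≟ y)) ⊎-dec consec? _≟_ m ms t x y

  consec-++ʳ : ∀ s ms {m} ns {t x y} → Consec m ns t x y → Consec s (ms ++ m ∷ ns) t x y
  consec-++ʳ s []       ns c = inj₂ c
  consec-++ʳ s (m ∷ ms) ns c = inj₂ (consec-++ʳ m ms ns c)

  consec-++ˡ : ∀ s ms {m} ns {t x y} → Consec s ms m x y → Consec s (ms ++ m ∷ ns) t x y
  consec-++ˡ s []       ns c        = inj₁ c
  consec-++ˡ s (m ∷ ms) ns (inj₁ c) = inj₁ c
  consec-++ˡ s (m ∷ ms) ns (inj₂ c) = inj₂ (consec-++ˡ m ms ns c)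

  consec-reverse : ∀ s ms t {x y} → Consec s ms t x y → Consec t (reverse ms) s y x
  consec-reverse s []       t (e , f) = f , e
  consec-reverse s (m ∷ ms) t {x} {y} c =
    subst (λ l → Consec t l s y x) (≡-sym (Listₚ.unfold-reverse m ms)) (go c)
    where
    go : Consec s (m ∷ ms) t x y → Consec t (reverse ms ++ m ∷ []) s y x
    go (inj₁ (e , f)) = consec-++ʳ t (reverse ms) [] (f , e)
    go (inj₂ c)       = consec-++ˡ t (reverse ms) [] (consec-reverse m ms t c)

  consec⇒pathVertex : ∀ s ms t {x y} → Consec s ms t x y →
    ∃[ i ] (pathVertex s ms t (inject₁ i) ≡ x × pathVertex s ms t (suc i) ≡ y)
  consec⇒pathVertex s []       t c        = zero , c
  consec⇒pathVertex s (m ∷ ms) t (inj₁ c) = zero , c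
  consec⇒pathVertex s (m ∷ ms) t (inj₂ c) = let i , e = consec⇒pathVertex m ms t c in suc i , e

  pathVertex⇒consec : ∀ s ms t i → Consec s ms t (pathVertex s ms t (inject₁ i)) (pathVertex s ms t (suc i))
  pathVertex⇒consec s []       t zero    = refl , refl
  pathVertex⇒consec s (m ∷ ms) t zero    = inj₁ (refl , refl)
  pathVertex⇒consec s (m ∷ ms) t (suc i) = inj₂ (pathVertex⇒consec m ms t i)

  consec⇒R : ∀ {R : X → X → Set} {s} ms {t x y} → Chain R s ms t → Consec s ms t x y → R x y
  consec⇒R []       c       (refl , refl)        = c
  consec⇒R (m ∷ ms) (r , c) (inj₁ (refl , refl)) = r
  consec⇒R (m ∷ ms) (r , c) (inj₂ d)             = consec⇒R ms c d

-- Sparsity of systems of internally disjoint paths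

length-neighbours : ∀ H i js → length (filter (λ j → Adj? H i j) js) ≡ sum (map (λ j → if adj H i j then 1 else 0) js)
length-neighbours H i [] = refl
length-neighbours H i (j ∷ js) with adj H i j
... | true  = cong suc (length-neighbours H i js)
... | false = length-neighbours H i js

-- The degree sum as the length of a list, so that it is bounded below by including a duplicate-free
-- list in it; the labels `f` let its entries be compared with the ends of links.
degreePairs : ∀ {X : Set} (H : Graph) → (V H → X) → List (X × X)
degreePairs H f = concatMap (λ i → map (λ j → f i , f j) (filter (λ j → Adj? H i j) (allFin (n H)))) (allFin (n H))

length-degreePairs : ∀ {X : Set} H (f : V H → X) → length (degreePairs H f) ≡ degreeSum H
length-degreePairs {X} H f = trans (length-concatMap _ (allFin (n H))) (cong sum (Listₚ.map-cong row (allFin (n H))))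
  where
  length-concatMap : ∀ {A B : Set} (g : A → List B) xs → length (concatMap g xs) ≡ sum (map (λ x → length (g x)) xs)
  length-concatMap g []       = refl
  length-concatMap g (x ∷ xs) = trans (Listₚ.length-++ (g x)) (cong (length (g x) +_) (length-concatMap g xs))
  row : ∀ i → length (map (λ j → f i , f j) (filter (λ j → Adj? H i j) (allFin (n H)))) ≡
              sum (map (λ j → if adj H i j then 1 else 0) (allFin (n H)))
  row i = trans (Listₚ.length-map _ (filter (λ j → Adj? H i j) (allFin (n H)))) (length-neighbours H i (allFin (n H)))

∈-concatMap : ∀ {A B : Set} (g : A → List B) {xs x y} → x ∈ xs → y ∈ g x → y ∈ concatMap g xs
∈-concatMap g p q = ∈ₚ.∈-concatMap⁺ g (lose p q)

∈-degreePairs : ∀ {X : Set} H (f : V H → X) {i j} → Adj H i j → (f i , f j) ∈ degreePairs H f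
∈-degreePairs H f {i} {j} a = ∈-concatMap _ (∈ₚ.∈-allFin i)
  (∈ₚ.∈-map⁺ _ (∈ₚ.∈-filter⁺ (λ j → Adj? H i j) (∈ₚ.∈-allFin j) a))

-- A sparsity condition: `d p` bounds the average degrees of the shallow topological minors at each
-- integer depth p. As `d` is kept apart from `G`, bounds computed from it are uniform over a class.
Dense : Graph → (ℕ → ℕ) → Set
Dense G d = ∀ p H → ShallowTopMinorAt (2 * p) H G → degreeSum H ≤ d p * n H

record Link (X : Set) : Set where
  constructor link
  field
    s t : X
    mid : List X

flipLink : ∀ {X} → Link X → Link X
flipLink (link s t mid) = link t s (reverse mid)

module Links (G : Graph) where
  open import Data.List.Membership.DecPropositional (Fin._≟_ {n G}) public using (_∈?_)
  open Link public

  Lk : Set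
  Lk = Link (V G)

  Joins : Lk → V G → V G → Set
  Joins c x y = (s c ≡ x × t c ≡ y) ⊎ (s c ≡ y × t c ≡ x)

  joins? : ∀ c x y → Dec (Joins c x y)
  joins? c x y = ((s c Fin.≟ x) ×-dec (t c Fin.≟ y)) ⊎-dec ((s c Fin.≟ y) ×-dec (t c Fin.≟ x))

  Meet : Lk → Lk → Set
  Meet c d = Any (_∈ mid d) (mid c)

  Apart : Lk → Lk → Set
  Apart c d = ¬ Joins c (s d) (t d) × ¬ Meet c d

  apart? : ∀ c d → Dec (Apart c d)
  apart? c d = ¬? (joins? c (s d) (t d)) ×-dec ¬? (Any.any? (_∈? mid d) (mid c))

  Apart-sym : ∀ {c d} → Apart c d → Apart d c
  Apart-sym (p , q) =
    (λ { (inj₁ (e , f)) → p (inj₁ (≡-sym e , ≡-sym f)) ; (inj₂ (e , f)) → p (inj₂ (≡-sym f , ≡-sym e)) }) ,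
    λ m → let x , x∈d , x∈c = find m in q (lose x∈c x∈d)

  record IsLink (X : List (V G)) (L : ℕ) (c : Lk) : Set where
    field
      s∈    : s c ∈ X
      t∈    : t c ∈ X
      s≢t   : s c ≢ t c
      chain : Chain (Adj G) (s c) (mid c) (t c)
      uniq  : Unique (mid c)
      avoid : ∀ {x} → x ∈ mid c → x ∉ X
      short : length (mid c) ≤ L

  open IsLink public

  flip-IsLink : ∀ {X L c} → IsLink X L c → IsLink X L (flipLink c)
  flip-IsLink {c = c} v = record
    { s∈ = t∈ v ; t∈ = s∈ v ; s≢t = λ e → s≢t v (≡-sym e)
    ; chain = chain-reverse (Adj-sym G) (mid c) (chain v)
    ; uniq = Unique-reverse (uniq v)
    ; avoid = λ p → avoid v (∈-reverse⁻ p)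
    ; short = ℕₚ.≤-trans (ℕₚ.≤-reflexive (Listₚ.length-reverse (mid c))) (short v) }

-- Joining the ends of the links gives a graph `H` on `X`, and the links together form a subdivision
-- of it inside `G`. Since links that are apart have different pairs of ends, `Q` has no more
-- members than `H` has edges, and the sparsity of shallow minors bounds it.
module DenseLinks (G : Graph) (X : List (V G)) (X-uniq : Unique X) (p : ℕ)
  (Q : List (Link (V G))) (Q-apart : AllPairs (Links.Apart G) Q)
  (Q-links : ∀ {c} → c ∈ Q → Links.IsLink G X (2 * p) c) where

  open Links G

  same : ∀ {c c′} → c ∈ Q → c′ ∈ Q → ¬ Apart c c′ → c ≡ c′
  same = go Q-apart
    where
    go : ∀ {Q c c′} → AllPairs Apart Q → c ∈ Q → c′ ∈ Q → ¬ Apart c c′ → c ≡ c′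
    go (a ∷ as) (here refl) (here refl) na = refl
    go (a ∷ as) (here refl) (there q)   na = ⊥-elim (na (All.lookup a q))
    go (a ∷ as) (there q)   (here refl) na = ⊥-elim (na (Apart-sym (All.lookup a q)))
    go (a ∷ as) (there q)   (there q′)  na = go as q q′ na

  data Oriented : Lk → Set where
    fwd : ∀ {c} → c ∈ Q → Oriented c
    bwd : ∀ {c} → c ∈ Q → Oriented (flipLink c)

  oriented-link : ∀ {o} → Oriented o → IsLink X (2 * p) o
  oriented-link (fwd q) = Q-links q
  oriented-link (bwd q) = flip-IsLink (Q-links q)

  oriented-same : ∀ {o o′} → Oriented o → Oriented o′ → s o ≡ s o′ → t o ≡ t o′ → o ≡ o′
  oriented-same (fwd q) (fwd q′) e f = same q q′ (λ a → proj₁ a (inj₁ (e , f)))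
  oriented-same (bwd q) (bwd q′) e f = cong flipLink (same q q′ (λ a → proj₁ a (inj₁ (f , e))))
  oriented-same (fwd q) (bwd q′) e f with same q q′ (λ a → proj₁ a (inj₂ (e , f)))
  ... | refl = ⊥-elim (s≢t (Q-links q) e)
  oriented-same (bwd q) (fwd q′) e f with same q q′ (λ a → proj₁ a (inj₂ (f , e)))
  ... | refl = ⊥-elim (s≢t (Q-links q) f)

  oriented-meet : ∀ {o o′ x} → Oriented o → Oriented o′ → x ∈ mid o → x ∈ mid o′ → o ≡ o′ ⊎ o ≡ flipLink o′ ⊎ flipLink o ≡ o′
  oriented-meet (fwd q) (fwd q′) i j = inj₁ (same q q′ λ a → proj₂ a (lose i j))
  oriented-meet (fwd q) (bwd q′) i j = inj₂ (inj₂ (cong flipLink (same q q′ λ a → proj₂ a (lose i (∈-reverse⁻ j)))))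
  oriented-meet (bwd q) (fwd q′) i j = inj₂ (inj₁ (cong flipLink (same q q′ λ a → proj₂ a (lose (∈-reverse⁻ i) j))))
  oriented-meet (bwd q) (bwd q′) i j = inj₁ (cong flipLink (same q q′ λ a → proj₂ a (lose (∈-reverse⁻ i) (∈-reverse⁻ j))))

  m : ℕ
  m = length X

  at : Fin m → V G
  at = lookup X

  Linked : Fin m → Fin m → Set
  Linked i j = Any (λ c → Joins c (at i) (at j)) Q

  linked? : ∀ i j → Dec (Linked i j)
  linked? i j = Any.any? (λ c → joins? c (at i) (at j)) Q

  linked-sym : ∀ {i j} → Linked i j → Linked j i
  linked-sym = Any.map λ { (inj₁ e) → inj₂ e ; (inj₂ e) → inj₁ e }

  linked-irrefl : ∀ {i} → ¬ Linked i i
  linked-irrefl l with find l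
  ... | c , q , inj₁ (e , f) = s≢t (Q-links q) (trans e (≡-sym f))
  ... | c , q , inj₂ (e , f) = s≢t (Q-links q) (trans e (≡-sym f))

  module H = MkGraph linked? linked-sym linked-irrefl

  OnLink : V G → Set
  OnLink x = x ∈ X ⊎ Any (λ c → x ∈ mid c) Q

  onLink? : ∀ x → Dec (OnLink x)
  onLink? x = (x ∈? X) ⊎-dec Any.any? (λ c → x ∈? mid c) Q

  W : List (V G)
  W = filter onLink? (allFin (n G))

  W-uniq : Unique W
  W-uniq = Uniqueₚ.filter⁺ onLink? (Uniqueₚ.allFin⁺ (n G))

  w : Fin (length W) → V G
  w = lookup W

  pos : ∀ x → OnLink x → Fin (length W)
  pos x o = Any.index (∈ₚ.∈-filter⁺ onLink? (∈ₚ.∈-allFin x) o)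

  w-pos : ∀ {x} o → w (pos x o) ≡ x
  w-pos o = ≡-sym (Anyₚ.lookup-index (∈ₚ.∈-filter⁺ onLink? (∈ₚ.∈-allFin _) o))

  w-injective : ∀ {i j} → w i ≡ w j → i ≡ j
  w-injective = Unique-lookup-injective W-uniq _ _

  pos-unique : ∀ {x} o i → x ≡ w i → pos x o ≡ i
  pos-unique o i e = w-injective (trans (w-pos o) e)

  w-on : ∀ i → OnLink (w i)
  w-on i = proj₂ (∈ₚ.∈-filter⁻ onLink? {xs = allFin (n G)} (∈ₚ.∈-lookup i))

  Con : V G → V G → Lk → Set
  Con x y c = Consec (s c) (mid c) (t c) x y ⊎ Consec (s c) (mid c) (t c) y x

  con-adj : ∀ {x y c} → IsLink X (2 * p) c → Con x y c → Adj G x y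
  con-adj l (inj₁ k) = consec⇒R _ (chain l) k
  con-adj l (inj₂ k) = Adj-sym G (consec⇒R _ (chain l) k)

  Next : Fin (length W) → Fin (length W) → Set
  Next i j = Any (Con (w i) (w j)) Q

  next? : ∀ i j → Dec (Next i j)
  next? i j = Any.any? (λ c → consec? Fin._≟_ (s c) (mid c) (t c) (w i) (w j) ⊎-dec
                              consec? Fin._≟_ (s c) (mid c) (t c) (w j) (w i)) Q

  next-sym : ∀ {i j} → Next i j → Next j i
  next-sym = Any.map λ { (inj₁ k) → inj₂ k ; (inj₂ k) → inj₁ k }

  next-irrefl : ∀ {i} → ¬ Next i i
  next-irrefl l = let c , q , k = find l in Adj-irrefl G (con-adj (Q-links q) k)

  module S = MkGraph next? next-sym next-irrefl

  record Pick (i j : Fin m) : Set where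
    constructor picked
    field
      o     : Lk
      orien : Oriented o
      s≡    : s o ≡ at i
      t≡    : t o ≡ at j

  pick : ∀ {i j} → Adj H.graph i j → Pick i j
  pick a with find (H.fromAdj a)
  ... | c , q , inj₁ (e , f) = picked c (fwd q) e f
  ... | c , q , inj₂ (e , f) = picked (flipLink c) (bwd q) f e

  module E (e : Edge H.graph) = Pick (pick (isAdj e))

  vertex : ∀ (e : Edge H.graph) → Fin (suc (suc (length (mid (E.o e))))) → V G
  vertex e = pathVertex (s (E.o e)) (mid (E.o e)) (t (E.o e))

  linkOf : ∀ e → IsLink X (2 * p) (E.o e)
  linkOf e = oriented-link (E.orien e)

  mid-on : ∀ {o x} → Oriented o → x ∈ mid o → OnLink x
  mid-on (fwd q) i = inj₂ (lose q i)
  mid-on (bwd q) i = inj₂ (lose q (∈-reverse⁻ i))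

  vertex-on : ∀ e i → OnLink (vertex e i)
  vertex-on e i with pathVertex-∈ (s (E.o e)) (mid (E.o e)) (t (E.o e)) i
  ... | inj₁ eq        = inj₁ (subst (_∈ X) (≡-sym eq) (s∈ (linkOf e)))
  ... | inj₂ (inj₁ eq) = inj₁ (subst (_∈ X) (≡-sym eq) (t∈ (linkOf e)))
  ... | inj₂ (inj₂ q)  = mid-on (E.orien e) q

  at-on : ∀ i → OnLink (at i)
  at-on i = inj₁ (∈ₚ.∈-lookup i)

  internal∈mid : ∀ e j → vertex e (suc (inject₁ j)) ∈ mid (E.o e)
  internal∈mid e j = subst (_∈ mid (E.o e)) (≡-sym (pathVertex-internal (s (E.o e)) (mid (E.o e)) (t (E.o e)) j)) (∈ₚ.∈-lookup j)

  vertex-adj : ∀ {o} → Oriented o → ∀ i →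
    Any (Con (pathVertex (s o) (mid o) (t o) (inject₁ i)) (pathVertex (s o) (mid o) (t o) (suc i))) Q
  vertex-adj {o} (fwd q) i = lose q (inj₁ (pathVertex⇒consec (s o) (mid o) (t o) i))
  vertex-adj (bwd {c} q) i = lose q (inj₂ (unflip (pathVertex⇒consec (t c) (reverse (mid c)) (s c) i)))
    where
    unflip : ∀ {x y} → Consec (t c) (reverse (mid c)) (s c) x y → Consec (s c) (mid c) (t c) y x
    unflip {x} {y} k = subst (λ l → Consec (s c) l (t c) y x) (Listₚ.reverse-involutive (mid c))
                             (consec-reverse (t c) (reverse (mid c)) (s c) k)

  at-injective : ∀ {i j} → at i ≡ at j → i ≡ j
  at-injective = Unique-lookup-injective X-uniq _ _

  disjoint : ∀ e e′ {x} → x ∈ mid (E.o e) → x ∈ mid (E.o e′) → (src e ≡ src e′) × (tgt e ≡ tgt e′)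
  disjoint e e′ i j with oriented-meet (E.orien e) (E.orien e′) i j
  ... | inj₁ eq = at-injective (trans (≡-sym (E.s≡ e)) (trans (cong s eq) (E.s≡ e′))) ,
                  at-injective (trans (≡-sym (E.t≡ e)) (trans (cong t eq) (E.t≡ e′)))
  -- One link used in opposite directions would give `src e < tgt e` and `tgt e < src e`.
  ... | inj₂ (inj₁ eq) = ⊥-elim (crossed
        (at-injective (trans (≡-sym (E.s≡ e)) (trans (cong s eq) (E.t≡ e′))))
        (at-injective (trans (≡-sym (E.t≡ e)) (trans (cong t eq) (E.s≡ e′)))))
    where crossed : src e ≡ tgt e′ → tgt e ≡ src e′ → ⊥
          crossed refl refl = ℕₚ.<-asym (src<tgt e) (src<tgt e′)
  ... | inj₂ (inj₂ eq) = ⊥-elim (crossed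
        (at-injective (trans (≡-sym (E.s≡ e)) (trans (cong t eq) (E.t≡ e′))))
        (at-injective (trans (≡-sym (E.t≡ e)) (trans (cong s eq) (E.s≡ e′)))))
    where crossed : src e ≡ tgt e′ → tgt e ≡ src e′ → ⊥
          crossed refl refl = ℕₚ.<-asym (src<tgt e) (src<tgt e′)

  topModel : TopModel H.graph S.graph
  topModel = record
    { branch = λ i → pos (at i) (at-on i)
    ; branch-inj = λ i j e → at-injective (trans (≡-sym (w-pos (at-on i))) (trans (cong w e) (w-pos (at-on j))))
    ; len = λ e → length (mid (E.o e))
    ; path = λ e i → pos (vertex e i) (vertex-on e i)
    ; path-inj = λ e i j eq → let l = linkOf e in
        pathVertex-injective (uniq l) (λ q → avoid l q (s∈ l)) (λ q → avoid l q (t∈ l)) (s≢t l) i j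
          (trans (≡-sym (w-pos (vertex-on e i))) (trans (cong w eq) (w-pos (vertex-on e j))))
    ; path-start = λ e → pos-unique (vertex-on e zero) _ (trans (E.s≡ e) (≡-sym (w-pos (at-on _))))
    ; path-end = λ e → pos-unique (vertex-on e (fromℕ (suc (length (mid (E.o e)))))) _
        (trans (pathVertex-end (s (E.o e)) (mid (E.o e)) (t (E.o e))) (trans (E.t≡ e) (≡-sym (w-pos (at-on _)))))
    ; path-adj = λ e i → S.toAdj (subst₂′ (≡-sym (w-pos (vertex-on e (inject₁ i)))) (≡-sym (w-pos (vertex-on e (suc i))))
        (vertex-adj (E.orien e) i))
    ; internal-disjoint = λ e e′ j j′ eq → disjoint e e′ (internal∈mid e j)
        (subst (_∈ mid (E.o e′)) (trans (≡-sym (w-pos (vertex-on e′ (suc (inject₁ j′))))) (trans (cong w (≡-sym eq)) (w-pos (vertex-on e (suc (inject₁ j))))))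
               (internal∈mid e′ j′))
    ; internal-not-branch = λ e j a eq → avoid (linkOf e) (internal∈mid e j)
        (subst (_∈ X) (trans (≡-sym (w-pos (at-on a))) (trans (cong w (≡-sym eq)) (w-pos (vertex-on e (suc (inject₁ j)))))) (∈ₚ.∈-lookup a))
    }
    where
    subst₂′ : ∀ {x x′ y y′} → x ≡ x′ → y ≡ y′ → Any (Con x y) Q → Any (Con x′ y′) Q
    subst₂′ refl refl a = a

  edgeOf : ∀ {c} → c ∈ Q → ∃[ e ] (E.o e ≡ c ⊎ E.o e ≡ flipLink c)
  edgeOf {c} q with ∈⇒lookup (s∈ (Q-links q)) | ∈⇒lookup (t∈ (Q-links q))
  ... | i , ei | j , ej with Finₚ.<-cmp i j
  ... | tri< i<j _ _ = e , inj₁ (oriented-same (E.orien e) (fwd q) (trans (E.s≡ e) ei) (trans (E.t≡ e) ej))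
    where e = edge i j i<j (H.toAdj (lose q (inj₁ (≡-sym ei , ≡-sym ej))))
  ... | tri≈ _ refl _ = ⊥-elim (s≢t (Q-links q) (trans (≡-sym ei) ej))
  ... | tri> _ _ j<i = e , inj₂ (oriented-same (E.orien e) (bwd q) (trans (E.s≡ e) ej) (trans (E.t≡ e) ei))
    where e = edge j i j<i (H.toAdj (lose q (inj₂ (≡-sym ei , ≡-sym ej))))

  isLeSubdivision : IsLeSubdivision (2 * p) H.graph S.graph
  isLeSubdivision = record { model = topModel ; covers-vertices = λ x → covV x (w-on x) ; covers-edges = covE } ,
                    λ e → short (linkOf e)
    where
    inMid : ∀ {o c x} → o ≡ c ⊎ o ≡ flipLink c → x ∈ mid c → x ∈ mid o
    inMid (inj₁ refl) i = i
    inMid (inj₂ refl) i = Anyₚ.reverse⁺ i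

    covV : ∀ x → OnLink (w x) → (∃[ a ] pos (at a) (at-on a) ≡ x) ⊎
           (∃[ e ] ∃[ j ] pos (vertex e (suc (inject₁ j))) (vertex-on e (suc (inject₁ j))) ≡ x)
    covV x (inj₁ i) = let a , e = ∈⇒lookup i in inj₁ (a , pos-unique (at-on a) x e)
    covV x (inj₂ l) = let c , q , i = find l
                          e , eq = edgeOf q
                          j , ej = ∈⇒lookup (inMid eq i)
                      in inj₂ (e , j , pos-unique (vertex-on e (suc (inject₁ j))) x (trans (pathVertex-internal (s (E.o e)) (mid (E.o e)) (t (E.o e)) j) ej))

    inCon : ∀ {o c x y} → o ≡ c ⊎ o ≡ flipLink c → Con x y c → Con x y o
    inCon (inj₁ refl) k = k
    inCon {c = c} (inj₂ refl) (inj₁ k) = inj₂ (consec-reverse (s c) (mid c) (t c) k)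
    inCon {c = c} (inj₂ refl) (inj₂ k) = inj₁ (consec-reverse (s c) (mid c) (t c) k)

    covE : ∀ x y → Adj S.graph x y → _
    covE x y a with find (S.fromAdj a)
    ... | c , q , k with edgeOf q
    ... | e , eq with inCon eq k
    ... | inj₁ k′ = let i , ex , ey = consec⇒pathVertex (s (E.o e)) (mid (E.o e)) (t (E.o e)) k′
                    in e , i , inj₁ (pos-unique (vertex-on e (inject₁ i)) x ex , pos-unique (vertex-on e (suc i)) y ey)
    ... | inj₂ k′ = let i , ey , ex = consec⇒pathVertex (s (E.o e)) (mid (E.o e)) (t (E.o e)) k′
                    in e , i , inj₂ (pos-unique (vertex-on e (inject₁ i)) y ey , pos-unique (vertex-on e (suc i)) x ex)

  shallow : ShallowTopMinorAt (2 * p) H.graph G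
  shallow = S.graph , isLeSubdivision , w , (λ i j → w-injective) ,
            λ i j a → let c , q , k = find (S.fromAdj a) in con-adj (Q-links q) k

  length-Q≤degreeSum : length Q ≤ degreeSum H.graph
  length-Q≤degreeSum = subst₂ _≤_ (Listₚ.length-map (λ c → s c , t c) Q) (length-degreePairs H.graph at)
    (Unique-⊆⇒length≤ (AllPairsₚ.map⁺ (AllPairs.map (λ a e → proj₁ a (inj₁ (cong proj₁ e , cong proj₂ e))) Q-apart)) sub)
    where
    sub : ∀ {z} → z ∈ map (λ c → s c , t c) Q → z ∈ degreePairs H.graph at
    sub z∈ with ∈ₚ.∈-map⁻ (λ c → s c , t c) z∈
    ... | c , q , refl with ∈⇒lookup (s∈ (Q-links q)) | ∈⇒lookup (t∈ (Q-links q))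
    ... | i , ei | j , ej = subst (_∈ degreePairs H.graph at) (cong₂ _,_ ei ej)
          (∈-degreePairs H.graph at (H.toAdj (lose q (inj₁ (≡-sym ei , ≡-sym ej)))))

  length-Q≤ : ∀ {d} → Dense G d → length Q ≤ d p * length X
  length-Q≤ dense = ℕₚ.≤-trans length-Q≤degreeSum (dense p H.graph shallow)

-- Greedy selection and double counting.

data Built {A : Set} (Ok : A → List A → Set) : List A → Set where
  []  : Built Ok []
  _∷_ : ∀ {c s} → Ok c s → Built Ok s → Built Ok (c ∷ s)

-- Since `Ok` is antitone in the selection, a candidate rejected once stays rejected, and `self`
-- excludes repeating a chosen one; hence one pass through the candidates yields a maximal
-- selection.
greedy : ∀ {A : Set} (Ok : A → List A → Set) → (∀ c s → Dec (Ok c s)) →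
  (∀ {c d s} → Ok c (d ∷ s) → Ok c s) → (∀ {c s} → ¬ Ok c (c ∷ s)) →
  (cs : List A) → ∃[ s ] (Built Ok s × (∀ {c} → c ∈ cs → ¬ Ok c s))
greedy Ok ok? anti self [] = [] , [] , λ ()
greedy Ok ok? anti self (c ∷ cs) with greedy Ok ok? anti self cs
... | s , b , max with ok? c s
... | yes ok = c ∷ s , ok ∷ b , λ { (here refl) → self ; (there p) o → max p (anti o) }
... | no ¬ok = s , b , λ { (here refl) → ¬ok ; (there p) → max p }

firstHit : ∀ {X : Set} {P : X → Set} → (∀ x → Dec (P x)) → ∀ xs →
  (∀ {x} → x ∈ xs → ¬ P x) ⊎
  (∃[ pre ] ∃[ y ] ∃[ post ] (xs ≡ pre ++ y ∷ post × (∀ {x} → x ∈ pre → ¬ P x) × P y))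
firstHit P? [] = inj₁ λ ()
firstHit P? (x ∷ xs) with P? x
... | yes px = inj₂ ([] , x , xs , refl , (λ ()) , px)
... | no ¬px with firstHit P? xs
... | inj₁ f = inj₁ λ { (here refl) → ¬px ; (there p) → f p }
... | inj₂ (pre , y , post , e , f , py) =
  inj₂ (x ∷ pre , y , post , cong (x ∷_) e , (λ { (here refl) → ¬px ; (there p) → f p }) , py)

lists : ∀ {X : Set} → List X → ℕ → List (List X)
lists xs zero    = [] ∷ []
lists xs (suc l) = [] ∷ cartesianProductWith _∷_ xs (lists xs l)

∈-lists : ∀ {X : Set} {xs : List X} → (∀ x → x ∈ xs) → ∀ l ms → length ms ≤ l → ms ∈ lists xs l
∈-lists all zero    []       _        = here refl
∈-lists all (suc l) []       _        = here refl
∈-lists all (suc l) (m ∷ ms) (s≤s le) = there (∈ₚ.∈-cartesianProductWith⁺ _∷_ (all m) (∈-lists all l ms le))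

module _ {A : Set} where

  sum-mono : ∀ (g : A → ℕ) b xs → (∀ {x} → x ∈ xs → b ≤ g x) → length xs * b ≤ sum (map g xs)
  sum-mono g b []       f = z≤n
  sum-mono g b (x ∷ xs) f = ℕₚ.+-mono-≤ (f (here refl)) (sum-mono g b xs (λ p → f (there p)))

  sum-+ : ∀ (f g : A → ℕ) xs → sum (map (λ x → f x + g x) xs) ≡ sum (map f xs) + sum (map g xs)
  sum-+ f g []       = refl
  sum-+ f g (x ∷ xs) rewrite sum-+ f g xs =
    solve 4 (λ a b c d → (a :+ b) :+ (c :+ d) := (a :+ c) :+ (b :+ d)) refl (f x) (g x) (sum (map f xs)) (sum (map g xs))

  sum-* : ∀ a (f : A → ℕ) xs → sum (map (λ x → a * f x) xs) ≡ a * sum (map f xs)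
  sum-* a f []       = ≡-sym (ℕₚ.*-zeroʳ a)
  sum-* a f (x ∷ xs) rewrite sum-* a f xs = ≡-sym (ℕₚ.*-distribˡ-+ a (f x) _)

  length-concatMap≤ : ∀ {B : Set} (g : A → List B) b xs → (∀ {x} → x ∈ xs → length (g x) ≤ b) →
                      length (concatMap g xs) ≤ length xs * b
  length-concatMap≤ g b []       f = z≤n
  length-concatMap≤ g b (x ∷ xs) f = subst (_≤ b + length xs * b) (≡-sym (Listₚ.length-++ (g x)))
    (ℕₚ.+-mono-≤ (f (here refl)) (length-concatMap≤ g b xs (λ p → f (there p))))

module _ {A : Set} {m : ℕ} (f : A → Fin m) where

  fibre : Fin m → List A → List A
  fibre v = filter (λ c → f c Fin.≟ v)

  indicator : A → Fin m → ℕ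
  indicator c v = if does (f c Fin.≟ v) then 1 else 0

  length-fibre : ∀ c Q v → length (fibre v (c ∷ Q)) ≡ indicator c v + length (fibre v Q)
  length-fibre c Q v with does (f c Fin.≟ v)
  ... | true  = refl
  ... | false = refl

  sum-indicator : ∀ c {S} → Unique S → sum (map (indicator c) S) ≤ 1
  sum-indicator c [] = z≤n
  sum-indicator c {v ∷ S} (v∉ ∷ u) with f c Fin.≟ v
  ... | no _     = sum-indicator c u
  ... | yes refl = s≤s (ℕₚ.≤-reflexive (none S v∉))
    where
    none : ∀ S → All (f c ≢_) S → sum (map (indicator c) S) ≡ 0
    none []      _ = refl
    none (x ∷ S) (ne ∷ a) rewrite false-does (f c Fin.≟ x) ne = none S a

  sum-fibre : ∀ {S} → Unique S → ∀ Q → sum (map (λ v → length (fibre v Q)) S) ≤ length Q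
  sum-fibre {S} u [] = ℕₚ.≤-reflexive (zeros S)
    where
    zeros : ∀ S → sum (map (λ v → length (fibre v [])) S) ≡ 0
    zeros []      = refl
    zeros (x ∷ S) = zeros S
  sum-fibre {S} u (c ∷ Q) = subst (_≤ suc (length Q))
    (≡-sym (trans (cong sum (Listₚ.map-cong (length-fibre c Q) S)) (sum-+ (indicator c) _ S)))
    (ℕₚ.+-mono-≤ (sum-indicator c u) (sum-fibre u Q))

-- Only the vertex entered is tested, so a walk may start inside `T`.
AvoidStep : (G : Graph) → List (V G) → V G → V G → Set
AvoidStep G T x y = Adj G x y × y ∉ T

-- Every vertex set S contains a vertex v that few vertices separate, within distance r, from S ∖ v
-- (Dvořák's admissibility argument): join S greedily by short disjoint paths, then join S greedily
-- to the interiors of these paths.  Both systems are shallow topological minors, hence sparse, so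
-- some v ∈ S meets few paths of either kind.
module Separation (G : Graph) (d : ℕ → ℕ) (dense : Dense G d) (r : ℕ)
  (S : List (V G)) (S-uniq : Unique S) where

  open Links G

  -- |Q₁| ≤ c₁ |S| and |Q₂| ≤ c₂ |S|; the other two satisfy degree * c₂ + 2 * capacity * c₁ < capacity * degree.
  c₁ c₂ capacity degree : ℕ
  c₁ = d r
  c₂ = c₁ * (1 + 2 * r * c₁)
  capacity = suc (2 * c₂)
  degree = suc (4 * c₁)

  isLink? : ∀ X L c → Dec (IsLink X L c)
  isLink? X L c = map′ {A = s c ∈ X × t c ∈ X × s c ≢ t c × Chain (Adj G) (s c) (mid c) (t c) ×
                            Unique (mid c) × All (_∉ X) (mid c) × length (mid c) ≤ L}
    (λ (a , b , e , f , g , h , i) → record { s∈ = a ; t∈ = b ; s≢t = e ; chain = f ; uniq = g ; avoid = All.lookup h ; short = i })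
    (λ l → s∈ l , t∈ l , s≢t l , chain l , uniq l , All.tabulate (avoid l) , short l)
    ((s c ∈? X) ×-dec (t c ∈? X) ×-dec ¬? (s c Fin.≟ t c) ×-dec chain? (Adj? G) (s c) (mid c) (t c) ×-dec
     AllPairs.allPairs? (λ x y → ¬? (x Fin.≟ y)) (mid c) ×-dec All.all? (λ x → ¬? (x ∈? X)) (mid c) ×-dec (length (mid c) ℕ.≤? L))

  links : ℕ → List Lk
  links l = cartesianProductWith (λ x (y , ms) → link x y ms) (allFin (n G))
              (cartesianProductWith _,_ (allFin (n G)) (lists (allFin (n G)) l))

  ∈-links : ∀ l c → length (mid c) ≤ l → c ∈ links l
  ∈-links l (link x y ms) le = ∈ₚ.∈-cartesianProductWith⁺ (λ x (y , ms) → link x y ms) (∈ₚ.∈-allFin x)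
    (∈ₚ.∈-cartesianProductWith⁺ _,_ (∈ₚ.∈-allFin y) (∈-lists ∈ₚ.∈-allFin l ms le))

  Ok₁ : Lk → List Lk → Set
  Ok₁ c Q = IsLink S (2 * r) c × All (Apart c) Q

  self-apart : ∀ {c Q} → ¬ All (Apart c) (c ∷ Q)
  self-apart (a ∷ _) = proj₁ a (inj₁ (refl , refl))

  abstract
    system₁ : ∃[ Q ] (Built Ok₁ Q × (∀ {c} → c ∈ links (2 * r) → ¬ Ok₁ c Q))
    system₁ = greedy Ok₁ (λ c Q → isLink? S (2 * r) c ×-dec All.all? (apart? c) Q)
      (λ { (v , _ ∷ a) → v , a }) (λ (_ , a) → self-apart a) (links (2 * r))

  Q₁ : List Lk
  Q₁ = proj₁ system₁

  X : List (V G)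
  X = filter (λ x → (x ∈? (S ++ concatMap mid Q₁))) (allFin (n G))

  S⊆X : ∀ {x} → x ∈ S → x ∈ X
  S⊆X p = ∈ₚ.∈-filter⁺ (λ x → x ∈? (S ++ concatMap mid Q₁)) (∈ₚ.∈-allFin _) (∈ₚ.∈-++⁺ˡ p)

  mid⊆X : ∀ {c x} → c ∈ Q₁ → x ∈ mid c → x ∈ X
  mid⊆X q p = ∈ₚ.∈-filter⁺ (λ x → x ∈? (S ++ concatMap mid Q₁)) (∈ₚ.∈-allFin _) (∈ₚ.∈-++⁺ʳ S (∈-concatMap mid q p))

  -- The cap on links with a common start keeps every separator bounded. Maximality speaks only of
  -- vertices whose fan is not yet full, which is why such a vertex has to be found.
  Ok₂ : Lk → List Lk → Set
  Ok₂ c Q = IsLink X r c × s c ∈ S × t c ∉ S × All (Apart c) Q × length (fibre s (s c) Q) < capacity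

  abstract
    system₂ : ∃[ Q ] (Built Ok₂ Q × (∀ {c} → c ∈ links r → ¬ Ok₂ c Q))
    system₂ = greedy Ok₂
      (λ c Q → isLink? X r c ×-dec (s c ∈? S) ×-dec ¬? (t c ∈? S) ×-dec All.all? (apart? c) Q ×-dec (length (fibre s (s c) Q) ℕ.<? capacity))
      (λ { {c} {e} {Q} (v , i , j , _ ∷ a , le) → v , i , j , a ,
           ℕₚ.≤-<-trans (ℕₚ.≤-trans (ℕₚ.m≤n+m _ (indicator s e (s c))) (ℕₚ.≤-reflexive (≡-sym (length-fibre s e Q (s c))))) le })
      (λ (_ , _ , _ , a , _) → self-apart a) (links r)

  Q₂ : List Lk
  Q₂ = proj₁ system₂

  built-apart : ∀ {Ok : Lk → List Lk → Set} → (∀ {c Q} → Ok c Q → All (Apart c) Q) → ∀ {Q} → Built Ok Q → AllPairs Apart Q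
  built-apart f []       = []
  built-apart f (o ∷ b) = f o ∷ built-apart f b

  built-all : ∀ {Ok : Lk → List Lk → Set} {P : Lk → Set} → (∀ {c Q} → Ok c Q → P c) → ∀ {Q} → Built Ok Q → ∀ {c} → c ∈ Q → P c
  built-all f (o ∷ b) (here refl) = f o
  built-all f (o ∷ b) (there p)   = built-all f b p

  Q₁-links : ∀ {c} → c ∈ Q₁ → IsLink S (2 * r) c
  Q₁-links = built-all proj₁ (proj₁ (proj₂ system₁))

  Q₂-ok : ∀ {c} → c ∈ Q₂ → IsLink X r c × s c ∈ S × t c ∉ S
  Q₂-ok = built-all (λ (l , i , j , _) → l , i , j) (proj₁ (proj₂ system₂))

  length-Q₁ : length Q₁ ≤ c₁ * length S
  length-Q₁ = DenseLinks.length-Q≤ G S S-uniq r Q₁ (built-apart proj₂ (proj₁ (proj₂ system₁))) Q₁-links {d} dense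

  length-X : length X ≤ (1 + 2 * r * c₁) * length S
  length-X = begin
    length X                                   ≤⟨ Unique-⊆⇒length≤ (Uniqueₚ.filter⁺ _ (Uniqueₚ.allFin⁺ (n G)))
                                                    (λ p → proj₂ (∈ₚ.∈-filter⁻ (λ x → x ∈? (S ++ concatMap mid Q₁)) {xs = allFin (n G)} p)) ⟩
    length (S ++ concatMap mid Q₁)             ≡⟨ Listₚ.length-++ S ⟩
    length S + length (concatMap mid Q₁)       ≤⟨ ℕₚ.+-monoʳ-≤ (length S) (length-concatMap≤ mid (2 * r) Q₁ (λ q → short (Q₁-links q))) ⟩
    length S + length Q₁ * (2 * r)             ≤⟨ ℕₚ.+-monoʳ-≤ (length S) (ℕₚ.*-monoˡ-≤ (2 * r) length-Q₁) ⟩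
    length S + c₁ * length S * (2 * r)         ≡⟨ solve 3 (λ l c r → l :+ c :* l :* (con 2 :* r) := (con 1 :+ con 2 :* r :* c) :* l) refl (length S) c₁ r ⟩
    (1 + 2 * r * c₁) * length S                ∎
    where
    open ℕₚ.≤-Reasoning

  length-Q₂ : length Q₂ ≤ c₂ * length S
  length-Q₂ = ℕₚ.≤-trans
    (DenseLinks.length-Q≤ G X (Uniqueₚ.filter⁺ _ (Uniqueₚ.allFin⁺ (n G))) r Q₂
      (built-apart (λ (_ , _ , _ , a , _) → a) (proj₁ (proj₂ system₂)))
      (λ q → let l = proj₁ (Q₂-ok q) in record
        { s∈ = s∈ l ; t∈ = t∈ l ; s≢t = s≢t l ; chain = chain l ; uniq = uniq l ; avoid = avoid l
        ; short = ℕₚ.≤-trans (short l) (ℕₚ.m≤m+n r _) })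
      {d} dense)
    (ℕₚ.≤-trans (ℕₚ.*-monoʳ-≤ c₁ length-X) (ℕₚ.≤-reflexive (≡-sym (ℕₚ.*-assoc c₁ _ (length S)))))

  fan : V G → List Lk
  fan v = fibre s v Q₂

  length-fan : ∀ v → length (fan v) ≤ capacity
  length-fan v = go (proj₁ (proj₂ system₂))
    where
    go : ∀ {Q} → Built Ok₂ Q → length (fibre s v Q) ≤ capacity
    go [] = z≤n
    go (_∷_ {c} (_ , _ , _ , _ , lt) b) with s c Fin.≟ v
    ... | yes refl = lt
    ... | no _     = go b

  nbrs : V G → List (V G)
  nbrs v = map t (fibre s v Q₁) ++ map s (fibre t v Q₁)

  length-nbrs : ∀ v → length (nbrs v) ≡ length (fibre s v Q₁) + length (fibre t v Q₁)
  length-nbrs v = trans (Listₚ.length-++ (map t (fibre s v Q₁)))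
                        (cong₂ _+_ (Listₚ.length-map t (fibre s v Q₁)) (Listₚ.length-map s (fibre t v Q₁)))

  fanVertices : V G → List (V G)
  fanVertices u = concatMap (λ c → t c ∷ mid c) (fan u)

  separator : V G → List (V G)
  separator v = nbrs v ++ concatMap fanVertices (v ∷ nbrs v)

  bound : ℕ
  bound = degree + suc degree * (capacity * suc r)

  length-separator : ∀ v → length (nbrs v) < degree → length (separator v) ≤ bound
  length-separator v lt = subst (_≤ bound) (≡-sym (Listₚ.length-++ (nbrs v)))
    (ℕₚ.+-mono-≤ (ℕₚ.<⇒≤ lt) (ℕₚ.≤-trans
      (length-concatMap≤ fanVertices (capacity * suc r) (v ∷ nbrs v) λ {u} _ → ℕₚ.≤-trans
        (length-concatMap≤ (λ c → t c ∷ mid c) (suc r) (fan u) λ q → s≤s (short (proj₁ (Q₂-ok (proj₁ (∈ₚ.∈-filter⁻ (λ c → s c Fin.≟ u) q))))))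
        (ℕₚ.*-monoˡ-≤ (suc r) (length-fan u)))
      (ℕₚ.*-monoˡ-≤ (capacity * suc r) (s≤s (ℕₚ.<⇒≤ lt)))))

  sparse? : ∀ v → Dec (length (fan v) < capacity × length (nbrs v) < degree)
  sparse? v = (length (fan v) ℕ.<? capacity) ×-dec (length (nbrs v) ℕ.<? degree)

  -- Averaging: `weight` scales the two counts so that either failure alone costs
  -- `capacity * degree`, while the total weight over `S` is smaller than `length S` times that
  -- amount.
  sparse-vertex : 0 < length S → ∃[ v ] (v ∈ S × length (fan v) < capacity × length (nbrs v) < degree)
  sparse-vertex 0<l with Any.any? sparse? S
  ... | yes a = find a
  ... | no ¬a = ⊥-elim (absurd (length S) c₁ c₂ 0<l total)
    where
    weight : V G → ℕ
    weight v = degree * length (fan v) + capacity * length (nbrs v)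
    heavy : ∀ {v} → v ∈ S → capacity * degree ≤ weight v
    heavy {v} p with length (fan v) ℕ.<? capacity
    ... | no ¬lt = ℕₚ.≤-trans (ℕₚ.≤-reflexive (ℕₚ.*-comm capacity degree))
                     (ℕₚ.≤-trans (ℕₚ.*-monoʳ-≤ degree (ℕₚ.≮⇒≥ ¬lt)) (ℕₚ.m≤m+n _ _))
    ... | yes lt = ℕₚ.≤-trans (ℕₚ.*-monoʳ-≤ capacity (ℕₚ.≮⇒≥ λ lt′ → ¬a (lose p (lt , lt′)))) (ℕₚ.m≤n+m _ (degree * length (fan v)))
    sum-fan : sum (map (λ v → length (fan v)) S) ≤ c₂ * length S
    sum-fan = ℕₚ.≤-trans (sum-fibre s S-uniq Q₂) length-Q₂
    sum-nbrs : sum (map (λ v → length (nbrs v)) S) ≤ c₁ * length S + c₁ * length S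
    sum-nbrs = subst (_≤ c₁ * length S + c₁ * length S)
      (≡-sym (trans (cong sum (Listₚ.map-cong length-nbrs S)) (sum-+ _ _ S)))
      (ℕₚ.+-mono-≤ (ℕₚ.≤-trans (sum-fibre s S-uniq Q₁) length-Q₁) (ℕₚ.≤-trans (sum-fibre t S-uniq Q₁) length-Q₁))
    total : length S * (capacity * degree) ≤ degree * (c₂ * length S) + capacity * (c₁ * length S + c₁ * length S)
    total = ℕₚ.≤-trans (sum-mono weight (capacity * degree) S heavy)
      (subst (_≤ degree * (c₂ * length S) + capacity * (c₁ * length S + c₁ * length S))
        (≡-sym (trans (sum-+ _ _ S) (cong₂ _+_ (sum-* degree _ S) (sum-* capacity _ S))))
        (ℕₚ.+-mono-≤ (ℕₚ.*-monoʳ-≤ degree sum-fan) (ℕₚ.*-monoʳ-≤ capacity sum-nbrs)))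
    absurd : ∀ l a b → 0 < l → ¬ l * (suc (2 * b) * suc (4 * a)) ≤ suc (4 * a) * (b * l) + suc (2 * b) * (a * l + a * l)
    -- With A = 1 + 4a and B = 1 + 2b one has 2AB = 2(Ab + 2Ba) + A + B. Doubling the inequality
    -- thus exposes the strictly positive surplus (A + B) times l, which is the reason for the
    -- coefficients 2 and 4 in `capacity` and `degree`.
    absurd (suc l) a b _ le = ℕₚ.<⇒≱ (ℕₚ.m<m+n (rhs + rhs) {suc (l + (4 * a + suc (2 * b)) * suc l)} (s≤s z≤n))
      (ℕₚ.≤-trans (ℕₚ.≤-reflexive identity) (ℕₚ.+-mono-≤ le le))
      where
      rhs = suc (4 * a) * (b * suc l) + suc (2 * b) * (a * suc l + a * suc l)
      identity : rhs + rhs + suc (l + (4 * a + suc (2 * b)) * suc l) ≡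
                 suc l * (suc (2 * b) * suc (4 * a)) + suc l * (suc (2 * b) * suc (4 * a))
      identity = solve 3 (λ l a b →
        let L = con 1 :+ l ; A = con 1 :+ con 4 :* a ; B = con 1 :+ con 2 :* b
            R = A :* (b :* L) :+ B :* (a :* L :+ a :* L)
        in R :+ R :+ (con 1 :+ (l :+ (con 4 :* a :+ B) :* L)) := L :* (B :* A) :+ L :* (B :* A)) refl l a b

  -- `X` contains the interiors of all paths of `Q₁`, so a path outside `X` meets none of them. By
  -- maximality it can be refused only because its ends are already joined.
  adjacent₁ : ∀ {v y ms} → v ∈ S → y ∈ S → v ≢ y → Chain (Adj G) v ms y → Unique ms →
    (∀ {x} → x ∈ ms → x ∉ X) → length ms ≤ 2 * r → y ∈ nbrs v
  adjacent₁ {v} {y} {ms} v∈ y∈ v≢y ch u av le with y ∈? nbrs v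
  ... | yes p = p
  ... | no y∉ = ⊥-elim (proj₂ (proj₂ system₁) (∈-links (2 * r) c le)
      (record { s∈ = v∈ ; t∈ = y∈ ; s≢t = v≢y ; chain = ch ; uniq = u ; avoid = λ p q → av p (S⊆X q) ; short = le }
      , All.tabulate apart))
    where
    c = link v y ms
    apart : ∀ {e} → e ∈ Q₁ → Apart c e
    apart q =
      (λ { (inj₁ (refl , refl)) → y∉ (∈ₚ.∈-++⁺ˡ (∈ₚ.∈-map⁺ t (∈ₚ.∈-filter⁺ (λ c → s c Fin.≟ v) q refl)))
         ; (inj₂ (refl , refl)) → y∉ (∈ₚ.∈-++⁺ʳ (map t (fibre s v Q₁)) (∈ₚ.∈-map⁺ s (∈ₚ.∈-filter⁺ (λ c → t c Fin.≟ v) q refl))) }) ,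
      (λ m → let x , p , p′ = find m in av p (mid⊆X q p′))

  fan⊆separator : ∀ {v u c x} → u ∈ v ∷ nbrs v → c ∈ Q₂ → s c ≡ u → x ∈ t c ∷ mid c → x ∈ separator v
  fan⊆separator {v} {u} p q e x∈ = ∈ₚ.∈-++⁺ʳ (nbrs v) (∈-concatMap fanVertices p (∈-concatMap (λ c → t c ∷ mid c)
    (∈ₚ.∈-filter⁺ (λ c → s c Fin.≟ u) q e) x∈))

  -- If `y` lies in `S`, maximality of `Q₁` puts it into `nbrs v`. Otherwise the path is a candidate
  -- for `Q₂` and conflicts with some link `e`. If both have the same ends, `y` is a fan vertex of
  -- `v`. If they meet in `x`, following the path to `x` and then `e` back to its start gives a path
  -- from `v` to `s e` outside `X` with at most `2 * r` internal vertices, so `s e` is `v` or in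
  -- `nbrs v` and `x` is in the separator. This detour is why `Q₁` allows paths twice as long as
  -- `Q₂`.
  first-vertex-on-X : ∀ {v pre y} → v ∈ S → length (fan v) < capacity → v ≢ y → y ∈ X →
    Chain (Adj G) v pre y → Unique pre → (∀ {x} → x ∈ pre → x ∉ X) → length pre ≤ r →
    (∀ {x} → x ∈ pre → x ∉ separator v) → y ∉ separator v → ⊥
  first-vertex-on-X {v} {pre} {y} v∈ few v≢y y∈X ch u av le pre∉ y∉ with y ∈? S
  ... | yes y∈S = y∉ (∈ₚ.∈-++⁺ˡ (adjacent₁ v∈ y∈S v≢y ch u av (ℕₚ.≤-trans le (ℕₚ.m≤m+n r _))))
  ... | no y∉S = proj₂ (proj₂ system₂) (∈-links r c le)
      ( record { s∈ = S⊆X v∈ ; t∈ = y∈X ; s≢t = v≢y ; chain = ch ; uniq = u ; avoid = av ; short = le }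
      , v∈ , y∉S , All.tabulate apart , few)
    where
    c = link v y pre
    apart : ∀ {e} → e ∈ Q₂ → Apart c e
    apart {e} q with Q₂-ok q
    ... | l , se∈S , te∉S =
      (λ { (inj₁ (refl , refl)) → y∉ (fan⊆separator (here refl) q refl (here refl))
         ; (inj₂ (refl , refl)) → te∉S v∈ }) ,
      λ m → let x , p , p′ = find m in meet x p p′
      where
      meet : ∀ x → x ∈ pre → x ∈ mid e → ⊥
      meet x p p′ with s e ∈? (v ∷ nbrs v)
      ... | yes i = pre∉ p (fan⊆separator i q refl (there p′))
      ... | no ¬i with ∈ₚ.∈-∃++ p | ∈ₚ.∈-∃++ p′
      ... | p₁ , p₂ , ep | m₁ , m₂ , em with
        erase Fin._≟_ (p₁ ++ x ∷ reverse m₁)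
          (chain-++ p₁ (proj₁ (chain-split p₁ (subst (λ l → Chain (Adj G) v l y) ep ch)))
            (chain-reverse (Adj-sym G) m₁ (proj₁ (chain-split m₁ (subst (λ l → Chain (Adj G) (s e) l (t e)) em (chain l))))))
          (λ eq → ¬i (here (≡-sym eq)))
      ... | ns , ch′ , u′ , _ , _ , sub , le′ = ¬i (there (adjacent₁ v∈ se∈S (λ eq → ¬i (here (≡-sym eq))) ch′ u′
              (λ z∈ → outside (sub z∈)) (ℕₚ.≤-trans le′ short-merged)))
        where
        outside : ∀ {z} → z ∈ p₁ ++ x ∷ reverse m₁ → z ∉ X
        outside z∈ with ∈ₚ.∈-++⁻ p₁ z∈
        ... | inj₁ i           = av (subst (_ ∈_) (≡-sym ep) (∈ₚ.∈-++⁺ˡ i))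
        ... | inj₂ (here refl) = av p
        ... | inj₂ (there i)   = avoid l (subst (_ ∈_) (≡-sym em) (∈ₚ.∈-++⁺ˡ (∈-reverse⁻ {xs = m₁} i)))
        short-merged : length (p₁ ++ x ∷ reverse m₁) ≤ 2 * r
        short-merged = begin
          length (p₁ ++ x ∷ reverse m₁)      ≡⟨ Listₚ.length-++ p₁ ⟩
          length p₁ + suc (length (reverse m₁)) ≡⟨ cong (λ k → length p₁ + suc k) (Listₚ.length-reverse m₁) ⟩
          length p₁ + suc (length m₁)        ≤⟨ ℕₚ.+-mono-≤ (ℕₚ.≤-trans (ℕₚ.m≤m+n _ _) (ℕₚ.≤-reflexive (trans (≡-sym (Listₚ.length-++ p₁)) (cong length (≡-sym ep)))))
                                                 (ℕₚ.≤-trans (ℕₚ.≤-trans (s≤s (ℕₚ.m≤m+n _ (length m₂))) (ℕₚ.≤-reflexive (≡-sym (ℕₚ.+-suc (length m₁) (length m₂)))))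
                                                   (ℕₚ.≤-reflexive (trans (≡-sym (Listₚ.length-++ m₁)) (cong length (≡-sym em))))) ⟩
          length pre + length (mid e)        ≤⟨ ℕₚ.+-mono-≤ le (short l) ⟩
          r + r                              ≡⟨ cong (r +_) (≡-sym (ℕₚ.+-identityʳ r)) ⟩
          2 * r                              ∎
          where open ℕₚ.≤-Reasoning

  avoid-chain : ∀ {T x} ms {y} → Chain (AvoidStep G T) x ms y → Chain (Adj G) x ms y × (∀ {z} → z ∈ ms → z ∉ T) × y ∉ T
  avoid-chain []       (a , f)       = a , (λ ()) , f
  avoid-chain (m ∷ ms) ((a , f) , c) = let c′ , g , h = avoid-chain ms c in
    (a , c′) , (λ { (here refl) → f ; (there p) → g p }) , h

  -- The walk is reduced to a path and cut at its first vertex on `X`, which is `y` itself if no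
  -- internal vertex lies on `X`.
  separates : ∀ {v} → v ∈ S → length (fan v) < capacity →
    ∀ {y l} → y ∈ S → y ≢ v → l ≤ r → ¬ Walk (AvoidStep G (separator v)) v y l
  separates v∈ few y∈ y≢v le nil = y≢v refl
  separates {v} v∈ few {y} y∈ y≢v le w@(cons _ _) with walk⇒chain w
  ... | ms , ch , refl with erase Fin._≟_ ms ch (λ e → y≢v (≡-sym e))
  ... | ns , ch′ , u , v∉ , y∉ , sub , le′ with firstHit (_∈? X) ns
  ... | inj₁ out = let c , f , g = avoid-chain ns ch′ in
        first-vertex-on-X v∈ few (λ e → y≢v (≡-sym e)) (S⊆X y∈) c u out
          (ℕₚ.≤-trans le′ (ℕₚ.≤-trans (ℕₚ.n≤1+n _) le)) f g
  ... | inj₂ (pre , z , post , refl , out , z∈X) = let c , f , g = avoid-chain pre (proj₁ (chain-split pre ch′)) in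
        first-vertex-on-X v∈ few (λ { refl → v∉ (∈ₚ.∈-++⁺ʳ pre (here refl)) }) z∈X c (takeU pre u) out
          (ℕₚ.≤-trans (ℕₚ.≤-trans (ℕₚ.m≤m+n _ _) (ℕₚ.≤-reflexive (≡-sym (Listₚ.length-++ pre))))
            (ℕₚ.≤-trans le′ (ℕₚ.≤-trans (ℕₚ.n≤1+n _) le))) f g
    where
    takeU : ∀ {A : Set} (xs : List A) {ys} → Unique (xs ++ ys) → Unique xs
    takeU []       _       = []
    takeU (x ∷ xs) (a ∷ u) = Allₚ.++⁻ˡ xs a ∷ takeU xs u

-- Weak reachability and colourings of odd powers

fresh : ∀ {A : Set} → (∀ (x y : A) → Dec (x ≡ y)) → ∀ {N} (f : Fin N → A) → Injective f →
        (xs : List A) → length xs < N → ∃[ i ] f i ∉ xs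
fresh _≟_ {N} f f-inj xs lt with Finₚ.any? (λ i → ¬? (Any.any? (f i ≟_) xs))
... | yes (i , f∉) = i , f∉
... | no ¬a = ⊥-elim (ℕₚ.<⇒≱ lt (subst (_≤ length xs) (Listₚ.length-tabulate f)
      (Unique-⊆⇒length≤ (Uniqueₚ.tabulate⁺ (λ {i} {j} → f-inj i j)) λ p → let i , e = ∈ₚ.∈-tabulate⁻ p in subst (_∈ xs) (≡-sym e) (all i))))
  where
  all : ∀ i → f i ∈ xs
  all i with Any.any? (f i ≟_) xs
  ... | yes p = p
  ... | no ¬p = ⊥-elim (¬a (i , ¬p))

encode : ∀ {m} → (Fin m → Bool) → Fin (2 ^ m)
encode f = Fin.funToFin (λ i → if f i then suc zero else zero)

decode : ∀ {m} → Fin (2 ^ m) → Fin m → Bool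
decode {m} k i = does (Fin.finToFun {2} {m} k i Fin.≟ suc zero)

decode-encode : ∀ {m} (f : Fin m → Bool) i → decode {m} (encode f) i ≡ f i
decode-encode f i rewrite Finₚ.finToFun-funToFin (λ i → if f i then suc {1} zero else zero) i with f i
... | true  = refl
... | false = refl

encode-injective : ∀ {m} (f g : Fin m → Bool) → encode f ≡ encode g → ∀ i → f i ≡ g i
encode-injective {m} f g e i =
  trans (≡-sym (decode-encode f i)) (trans (cong (λ k → decode {m} k i) e) (decode-encode g i))

-- The constant `Separation.bound` with its definition unfolded, visibly independent of the graph
-- and of `S`.
separatorBound : (ℕ → ℕ) → ℕ → ℕ
separatorBound d r = suc (4 * d r) + suc (suc (4 * d r)) * (suc (2 * (d r * (1 + 2 * r * d r))) * suc r)

-- In `blocks` the walks range over all of `G`, so they may also pass through vertices outside `S`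
-- and through vertices of higher rank.
record Ranking (G : Graph) (r K : ℕ) (S : List (V G)) (m : ℕ) : Set where
  field
    rank   : V G → ℕ
    rank<  : ∀ {x} → x ∈ S → rank x < m
    inj    : ∀ {x y} → x ∈ S → y ∈ S → rank x ≡ rank y → x ≡ y
    sep    : V G → List (V G)
    small  : ∀ {x} → x ∈ S → length (sep x) ≤ K
    blocks : ∀ {x y l} → x ∈ S → y ∈ S → rank y < rank x → l ≤ r → ¬ Walk (AvoidStep G (sep x)) x y l

-- A vertex separated from the rest of `S` receives the highest rank, so that the rest is exactly
-- what lies below it; then the rest is ranked.
ranking : ∀ {G d} → Dense G d → ∀ r m S → Unique S → length S ≤ m → Ranking G r (separatorBound d r) S m
ranking dense r m [] u le = record
  { rank = λ _ → 0 ; rank< = λ () ; inj = λ () ; sep = λ _ → [] ; small = λ () ; blocks = λ () }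
ranking {G} {d} dense r (suc m) S@(_ ∷ _) u le with Separation.sparse-vertex G d dense r S u (s≤s z≤n)
... | v , v∈ , few , few′ = record
  { rank = rank ; rank< = rank< ; inj = inj ; sep = sep ; small = small ; blocks = blocks }
  where
  open Separation G d dense r S u
  other? : ∀ x → Dec (x ≢ v)
  other? x = ¬? (x Fin.≟ v)
  S′ : List (V G)
  S′ = filter other? S
  S′⊆S : ∀ {x} → x ∈ S′ → x ∈ S
  S′⊆S p = proj₁ (∈ₚ.∈-filter⁻ other? p)
  v∉S′ : v ∉ S′
  v∉S′ p = proj₂ (∈ₚ.∈-filter⁻ other? {xs = S} p) refl
  le′ : length S′ ≤ m
  le′ = ℕₚ.≤-pred (ℕₚ.≤-trans (Unique-⊆⇒length≤ (∉⇒All≢ v∉S′ ∷ Uniqueₚ.filter⁺ other? u)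
          (λ { (here refl) → v∈ ; (there p) → S′⊆S p })) le)
  module R = Ranking (ranking {G} {d} dense r m S′ (Uniqueₚ.filter⁺ other? u) le′)
  in′ : ∀ {x} → x ∈ S → x ≢ v → x ∈ S′
  in′ p ne = ∈ₚ.∈-filter⁺ other? p ne
  rank : V G → ℕ
  rank x = if does (x Fin.≟ v) then m else R.rank x
  sep : V G → List (V G)
  sep x = if does (x Fin.≟ v) then separator v else R.sep x
  rank< : ∀ {x} → x ∈ S → rank x < suc m
  rank< {x} p with x Fin.≟ v
  ... | yes _ = ℕₚ.n<1+n m
  ... | no ne = ℕₚ.m<n⇒m<1+n (R.rank< (in′ p ne))
  inj : ∀ {x y} → x ∈ S → y ∈ S → rank x ≡ rank y → x ≡ y
  inj {x} {y} p q e with x Fin.≟ v | y Fin.≟ v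
  ... | yes refl | yes refl = refl
  ... | yes _    | no ne    = ⊥-elim (ℕₚ.<⇒≢ (R.rank< (in′ q ne)) (≡-sym e))
  ... | no ne    | yes _    = ⊥-elim (ℕₚ.<⇒≢ (R.rank< (in′ p ne)) e)
  ... | no ne    | no ne′   = R.inj (in′ p ne) (in′ q ne′) e
  small : ∀ {x} → x ∈ S → length (sep x) ≤ separatorBound d r
  small {x} p with x Fin.≟ v
  ... | yes _ = length-separator v few′
  ... | no ne = R.small (in′ p ne)
  blocks : ∀ {x y l} → x ∈ S → y ∈ S → rank y < rank x → l ≤ r → ¬ Walk (AvoidStep G (sep x)) x y l
  blocks {x} {y} p q lt le with x Fin.≟ v | y Fin.≟ v
  ... | yes refl | yes _  = ⊥-elim (ℕₚ.<-irrefl refl lt)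
  ... | yes refl | no ne  = separates v∈ few q ne le
  ... | no ne    | yes _  = ⊥-elim (ℕₚ.<-asym lt (R.rank< (in′ p ne)))
  ... | no ne    | no ne′ = R.blocks (in′ p ne) (in′ q ne′) lt le

reachBound : ℕ → ℕ → ℕ
reachBound K zero    = 0
reachBound K (suc l) = K * suc (reachBound K l)

module Reach (G : Graph) (r K : ℕ) (ρ : Ranking G r K (allFin (n G)) (n G)) where

  open Ranking ρ using (rank; sep)

  rank-injective : ∀ {x y} → rank x ≡ rank y → x ≡ y
  rank-injective = Ranking.inj ρ (∈ₚ.∈-allFin _) (∈ₚ.∈-allFin _)

  -- A walk of such steps ending in `z` has `z` as its lowest vertex, so it witnesses that `z` is
  -- weakly reachable from the other end.
  Above : V G → V G → V G → Set
  Above z x y = Adj G x y × rank z ≤ rank x × rank z ≤ rank y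

  above? : ∀ z x y → Dec (Above z x y)
  above? z x y = Adj? G x y ×-dec (rank z ℕ.≤? rank x) ×-dec (rank z ℕ.≤? rank y)

  Above-sym : ∀ {z x y} → Above z x y → Above z y x
  Above-sym (a , p , q) = Adj-sym G a , q , p

  Above-mono : ∀ {z z′ x y} → rank z ≤ rank z′ → Above z′ x y → Above z x y
  Above-mono le (a , p , q) = a , ℕₚ.≤-trans le p , ℕₚ.≤-trans le q

  reach : ℕ → V G → List (V G)
  reach zero    w = []
  reach (suc l) w = concatMap (λ t → t ∷ reach l t) (sep w)

  length-reach : ∀ l w → length (reach l w) ≤ reachBound K l
  length-reach zero    w = z≤n
  length-reach (suc l) w = ℕₚ.≤-trans
    (length-concatMap≤ (λ t → t ∷ reach l t) (suc (reachBound K l)) (sep w) (λ {t} _ → s≤s (length-reach l t)))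
    (ℕₚ.*-monoˡ-≤ (suc (reachBound K l)) (Ranking.small ρ (∈ₚ.∈-allFin w)))

  hit-or-avoid : ∀ T {z w l} → Walk (Above z) w z l →
    (∃[ t ] ∃[ k ] (t ∈ T × k < l × Walk (Above z) t z k)) ⊎ Walk (AvoidStep G T) w z l
  hit-or-avoid T nil = inj₂ nil
  hit-or-avoid T (cons {y = y} a w) with Any.any? (y Fin.≟_) T
  ... | yes y∈ = inj₁ (y , _ , y∈ , ℕₚ.≤-refl , w)
  ... | no y∉ with hit-or-avoid T w
  ... | inj₁ (t , k , t∈ , lt , v) = inj₁ (t , k , t∈ , ℕₚ.m<n⇒m<1+n lt , v)
  ... | inj₂ v = inj₂ (cons (proj₁ a , y∉) v)

  -- A walk from `w` down to `z` must meet `sep w`, say in `t`. As `z` is lowest on the walk, either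
  -- `t` is `z` or `z` lies below `t` and is reached from it by a shorter walk.
  ∈-reach : ∀ l {w z k} → k ≤ l → l ≤ r → rank z < rank w → Walk (Above z) w z k → z ∈ reach l w
  ∈-reach zero    z≤n le lt nil = ⊥-elim (ℕₚ.<-irrefl refl lt)
  ∈-reach (suc l) {w} {z} k≤ le lt walk with hit-or-avoid (sep w) walk
  ... | inj₂ v = ⊥-elim (Ranking.blocks ρ (∈ₚ.∈-allFin w) (∈ₚ.∈-allFin z) lt (ℕₚ.≤-trans k≤ le) v)
  ... | inj₁ (t , _ , t∈ , _ , nil) = ∈-concatMap _ t∈ (here refl)
  ... | inj₁ (t , k , t∈ , k< , v@(cons (_ , z≤t , _) _)) with t Fin.≟ z
  ... | yes refl = ∈-concatMap _ t∈ (here refl)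
  ... | no ne = ∈-concatMap _ t∈ (there (∈-reach l (ℕₚ.≤-pred (ℕₚ.≤-trans k< k≤)) (ℕₚ.≤-trans (ℕₚ.n≤1+n l) le)
                  (ℕₚ.≤∧≢⇒< z≤t (λ e → ne (≡-sym (rank-injective e)))) v))

  N : ℕ
  N = reachBound K r

  colouring : ∀ m → Σ (V G → Fin (suc N)) λ a → ∀ {w z} → rank w < m → rank z < rank w → z ∈ reach r w → a z ≢ a w
  colouring zero = (λ _ → zero) , λ ()
  colouring (suc m) with colouring m | Finₚ.any? (λ v → rank v ℕ.≟ m)
  ... | a , ok | no none = a , λ {w} w< → ok (ℕₚ.≤∧≢⇒< (ℕₚ.≤-pred w<) (λ e → none (w , e)))
  ... | a , ok | yes (v , refl) with fresh Fin._≟_ {suc N} id (λ _ _ e → e) (map a (reach r v)) (s≤s (subst (_≤ N) (≡-sym (Listₚ.length-map a (reach r v))) (length-reach r v)))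
  ... | i , i∉ = a′ , ok′
    where
    a′ : V G → Fin (suc N)
    a′ x = if does (x Fin.≟ v) then i else a x
    ok′ : ∀ {w z} → rank w < suc m → rank z < rank w → z ∈ reach r w → a′ z ≢ a′ w
    ok′ {w} {z} w< z< z∈ e with w Fin.≟ v | z Fin.≟ v
    ... | yes refl | yes refl = ℕₚ.<-irrefl refl z<
    ... | yes refl | no _ = i∉ (subst (_∈ map a (reach r v)) e (∈ₚ.∈-map⁺ a z∈))
    ... | no ne | yes refl = ℕₚ.<⇒≱ z< (ℕₚ.≤-pred w<)
    ... | no ne | no _ = ok (ℕₚ.≤∧≢⇒< (ℕₚ.≤-pred w<) (λ e → ne (rank-injective e))) z< z∈ e

  abstract
    colour : V G → Fin (suc N)
    colour = proj₁ (colouring (n G))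

    colour-reach : ∀ {w z} → rank z < rank w → z ∈ reach r w → colour z ≢ colour w
    colour-reach = proj₂ (colouring (n G)) (Ranking.rank< ρ (∈ₚ.∈-allFin _))

  lowest : ∀ {u v l} → Walk (Adj G) u v l →
    ∃[ z ] ∃[ i ] ∃[ j ] (i + j ≡ l × Walk (Above z) u z i × Walk (Above z) z v j × rank z ≤ rank u)
  lowest nil = _ , 0 , 0 , refl , nil , nil , ℕₚ.≤-refl
  lowest (cons {x = u} a w) with lowest w
  ... | z , i , j , e , p , q , le with rank z ℕ.≤? rank u
  ... | yes z≤u = z , suc i , j , cong suc e , cons (a , z≤u , le) p , q , z≤u
  ... | no z≰u = u , 0 , _ , refl , nil , cons (a , ℕₚ.≤-refl , ℕₚ.≤-trans u≤z le)
                   (castʷ e (mapʷ id (Above-mono u≤z) p ⋆ mapʷ id (Above-mono u≤z) q)) , ℕₚ.≤-refl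
    where u≤z = ℕₚ.<⇒≤ (ℕₚ.≰⇒> z≰u)

  Sees : V G → Fin (suc N) → ℕ → Set
  Sees u i l = ∃[ z ] (colour z ≡ i × Walk (Above z) u z l)

  sees? : ∀ u i l → Dec (Sees u i l)
  sees? u i l = Finₚ.any? λ z → (colour z Fin.≟ i) ×-dec walk? (above? z) l u z

  seen : V G → Fin (suc N) × Fin (suc r) → Bool
  seen u (i , l) = does (sees? u i (toℕ l))

  profile : V G → Fin (suc N * suc r) → Bool
  profile u k = seen u (Fin.remQuot (suc r) k)

  same-profile : ∀ {u v} → (∀ k → profile u k ≡ profile v k) → ∀ {i l} → l ≤ r → Sees u i l → Sees v i l
  same-profile {u} {v} e {i} {l} le see = subst (Sees v i) (Finₚ.toℕ-fromℕ< (s≤s le))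
    (does-true (sees? v i _) (trans (≡-sym lem) (true-does (sees? u i _) (subst (Sees u i) (≡-sym (Finₚ.toℕ-fromℕ< (s≤s le))) see))))
    where
    l′ : Fin (suc r)
    l′ = fromℕ< (s≤s le)
    lem : does (sees? u i (toℕ l′)) ≡ does (sees? v i (toℕ l′))
    lem = trans (cong (seen u) (≡-sym (Finₚ.remQuot-combine i l′)))
                (trans (e (Fin.combine i l′)) (cong (seen v) (Finₚ.remQuot-combine i l′)))

  -- If u and v have the same profile, the lowest vertex z of an odd u–v walk of length r is seen by v
  -- along both halves of the walk, which closes up to an odd walk.
  profile-separates : ∀ k → r ≡ suc (k + k) → OddWalkFree G r →
    ∀ {u v} → Walk (Adj G) u v r → ¬ (∀ i → profile u i ≡ profile v i)
  profile-separates k odd owf {u} {v} w e with lowest w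
  ... | z , i , j , i+j , p , q , _ with same-profile e (subst (i ≤_) i+j (ℕₚ.m≤m+n i j)) (z , refl , p)
  ... | z′ , same , p′ with ℕₚ.<-cmp (rank z) (rank z′)
  -- If `z` and `z′` differ, the lower one is weakly reachable from the higher one through `v` in
  -- `i + j = r` steps, so their colours differ.
  ... | tri< lt _ _ = colour-reach lt (∈-reach r (ℕₚ.≤-reflexive i+j) ℕₚ.≤-refl lt
          (mapʷ id (Above-mono (ℕₚ.<⇒≤ lt)) (reverseʷ Above-sym p′) ⋆ reverseʷ Above-sym q)) (≡-sym same)
  ... | tri> _ _ gt = colour-reach gt (∈-reach r (ℕₚ.≤-reflexive (trans (ℕₚ.+-comm j i) i+j)) ℕₚ.≤-refl gt
          (mapʷ id (Above-mono (ℕₚ.<⇒≤ gt)) q ⋆ p′)) same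
  ... | tri≈ _ eq _ with rank-injective eq
  ... | refl = owf k v (ℕₚ.≤-reflexive (≡-sym odd))
          (castʷ (trans i+j odd) (mapʷ id proj₁ p′ ⋆ mapʷ id proj₁ q))

powerColours : (ℕ → ℕ) → ℕ → ℕ
powerColours d r = 2 ^ (suc (reachBound (separatorBound d r) r) * suc r)

OddPowerColouring : Graph → ℕ → ℕ → Set
OddPowerColouring G r c = Σ (V G → Fin c) λ κ → ∀ {u v} → Walk (Adj G) u v r → κ u ≢ κ v

powerColouring : ∀ {G d} → Dense G d → ∀ k → OddWalkFree G (suc (k + k)) →
                 OddPowerColouring G (suc (k + k)) (powerColours d (suc (k + k)))
powerColouring {G} {d} dense k owf =
  (λ u → encode (profile u)) ,
  λ {u} {v} w e → profile-separates k refl owf w (encode-injective (profile u) (profile v) e)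
  where
  r = suc (k + k)
  open Reach G r (separatorBound d r)
    (ranking {G} {d} dense r (n G) (allFin (n G)) (Uniqueₚ.allFin⁺ (n G)) (ℕₚ.≤-reflexive (Listₚ.length-tabulate id)))

-- Graphs of large odd girth and chromatic number

-- The heights certify acyclicity: a closed walk cannot use all its arcs in the same direction.
record Digraph : Set₁ where
  field
    size     : ℕ
    Arc      : Fin size → Fin size → Set
    arc?     : ∀ x y → Dec (Arc x y)
    height   : Fin size → ℕ
    ascends  : ∀ {x y} → Arc x y → height x < height y

  Edge± : Fin size → Fin size → Set
  Edge± x y = Arc x y ⊎ Arc y x

  edge±? : ∀ x y → Dec (Edge± x y)
  edge±? x y = arc? x y ⊎-dec arc? y x

  edge±-irrefl : ∀ {x} → ¬ Edge± x x
  edge±-irrefl (inj₁ a) = ℕₚ.<-irrefl refl (ascends a)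
  edge±-irrefl (inj₂ a) = ℕₚ.<-irrefl refl (ascends a)

  private
    module U = MkGraph {size} {Edge±} edge±? Sum.swap edge±-irrefl
  open U public using (toAdj; fromAdj) renaming (graph to underlying)

open Digraph using (underlying)

tail head : ∀ {m} → Fin (m * m) → Fin m
tail {m} a = proj₁ (Fin.remQuot {m} m a)
head {m} a = proj₂ (Fin.remQuot {m} m a)

-- All ordered pairs are vertices; a pair that is not an arc is isolated.
arcGraph : Digraph → Digraph
arcGraph D = record
  { size = size * size
  ; Arc = λ a b → Arc (tail a) (head a) × head a ≡ tail b × Arc (tail b) (head b)
  ; arc? = λ a b → arc? (tail a) (head a) ×-dec (head a Fin.≟ tail b) ×-dec arc? (tail b) (head b)
  ; height = λ a → height (tail a)
  ; ascends = λ { {a} {b} (p , e , _) → subst (λ x → height (tail a) < height x) e (ascends p) }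
  }
  where
  open Digraph D hiding (underlying)

module ArcGraph (D : Digraph) where
  open Digraph D hiding (underlying)
  private module δ = Digraph (arcGraph D)

  tail-step : ∀ {a b} → δ.Edge± a b → Edge± (tail a) (tail b)
  tail-step {a} {b} (inj₁ (p , e , q)) = inj₁ (subst (Arc (tail a)) e p)
  tail-step {a} {b} (inj₂ (p , e , q)) = inj₂ (subst (Arc (tail b)) e p)

  head-step : ∀ {a b} → δ.Edge± a b → Edge± (head a) (head b)
  head-step {a} {b} (inj₁ (p , e , q)) = inj₁ (subst (λ x → Arc x (head b)) (≡-sym e) q)
  head-step {a} {b} (inj₂ (p , e , q)) = inj₂ (subst (λ x → Arc x (head a)) (≡-sym e) q)

  -- What a change of direction yields: one backtracking cancels in `D`, leaving a walk two steps
  -- shorter between the tails or between the heads.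
  Turn : Fin (size * size) → Fin (size * size) → ℕ → Set
  Turn a b l = ∃[ k ] (l ≡ 2 + k × (Walk Edge± (tail a) (tail b) k ⊎ Walk Edge± (head a) (head b) k))

  data Up : ∀ {a b l} → Walk δ.Edge± a b l → Set where
    nil  : ∀ {a} → Up (nil {x = a})
    cons : ∀ {a b c l} (p : δ.Arc a b) {w : Walk δ.Edge± b c l} → Up w → Up (cons (inj₁ p) w)

  data Down : ∀ {a b l} → Walk δ.Edge± a b l → Set where
    nil  : ∀ {a} → Down (nil {x = a})
    cons : ∀ {a b c l} (p : δ.Arc b a) {w : Walk δ.Edge± b c l} → Down w → Down (cons (inj₂ p) w)

  -- A walk turning from backward to forward backtracks on tails, one turning from forward to
  -- backward backtracks on heads.
  turns : ∀ {a b l} (w : Walk δ.Edge± a b l) → Up w ⊎ Down w ⊎ Turn a b l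
  turns nil = inj₁ nil
  turns (cons (inj₁ p) nil) = inj₁ (cons p nil)
  turns (cons (inj₂ p) nil) = inj₂ (inj₁ (cons p nil))
  turns (cons r w@(cons _ _)) with turns w
  ... | inj₂ (inj₂ (k , e , inj₁ v)) = inj₂ (inj₂ (suc k , cong suc e , inj₁ (cons (tail-step r) v)))
  ... | inj₂ (inj₂ (k , e , inj₂ v)) = inj₂ (inj₂ (suc k , cong suc e , inj₂ (cons (head-step r) v)))
  turns (cons (inj₁ p) w@(cons _ _)) | inj₁ u = inj₁ (cons p u)
  turns (cons (inj₂ p) w@(cons _ _)) | inj₂ (inj₁ u) = inj₂ (inj₁ (cons p u))
  turns {b = b} (cons (inj₂ p) (cons _ w)) | inj₁ (cons q _) = inj₂ (inj₂ (_ , refl , inj₁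
    (subst (λ x → Walk Edge± x (tail b) _) (trans (≡-sym (proj₁ (proj₂ q))) (proj₁ (proj₂ p))) (mapʷ tail tail-step w))))
  turns {b = b} (cons (inj₁ p) (cons _ w)) | inj₂ (inj₁ (cons q _)) = inj₂ (inj₂ (_ , refl , inj₂
    (subst (λ x → Walk Edge± x (head b) _) (trans (proj₁ (proj₂ q)) (≡-sym (proj₁ (proj₂ p)))) (mapʷ head head-step w))))

  rises : ∀ {a b l} {w : Walk δ.Edge± a b (suc l)} → Up w → δ.height a < δ.height b
  rises (cons p nil)          = δ.ascends p
  rises (cons p u@(cons _ _)) = ℕₚ.<-trans (δ.ascends p) (rises u)

  falls : ∀ {a b l} {w : Walk δ.Edge± a b (suc l)} → Down w → δ.height b < δ.height a
  falls (cons p nil)          = δ.ascends p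
  falls (cons p u@(cons _ _)) = ℕₚ.<-trans (falls u) (δ.ascends p)

  -- Heights force a closed walk to change direction, and cancelling there gives a closed walk of
  -- `D` of the same parity and two steps shorter.
  oddWalkFree : ∀ q → OddWalkFree (underlying D) q → OddWalkFree (underlying (arcGraph D)) (2 + q)
  oddWalkFree q owf k a le w with turns (mapʷ id δ.fromAdj w)
  ... | inj₁ u        = ℕₚ.<-irrefl refl (rises u)
  ... | inj₂ (inj₁ u) = ℕₚ.<-irrefl refl (falls u)
  oddWalkFree q owf zero    a le w | inj₂ (inj₂ (l , () , _))
  oddWalkFree q owf (suc k) a le w | inj₂ (inj₂ (l , e , v)) rewrite ℕₚ.+-suc k k with e | v
  ... | refl | inj₁ v = owf k (tail a) (ℕₚ.≤-pred (ℕₚ.≤-pred le)) (mapʷ id toAdj v)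
  ... | refl | inj₂ v = owf k (head a) (ℕₚ.≤-pred (ℕₚ.≤-pred le)) (mapʷ id toAdj v)

  -- A vertex is coloured by the set of colours of its outgoing arcs. If both ends of an arc had the
  -- same set, its colour would recur on an arc leaving its head, and these two arcs are adjacent.
  colourable : ∀ {k} → Colorable (underlying (arcGraph D)) k → Colorable (underlying D) (2 ^ k)
  colourable {k} (κ , proper) = f , λ x y a → case fromAdj a of
    λ { (inj₁ p) → distinct p ; (inj₂ p) e → distinct p (≡-sym e) }
    where
    Out : Fin size → Fin k → Set
    Out x c = ∃[ y ] (Arc x y × κ (Fin.combine x y) ≡ c)
    out? : ∀ x c → Dec (Out x c)
    out? x c = Finₚ.any? λ y → arc? x y ×-dec (κ (Fin.combine x y) Fin.≟ c)
    f : Fin size → Fin (2 ^ k)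
    f x = encode (λ c → does (out? x c))
    consecutive : ∀ {x y z} → Arc x y → Arc y z → δ.Arc (Fin.combine x y) (Fin.combine y z)
    consecutive {x} {y} {z} p q =
      subst₂ Arc (≡-sym (tail-combine x y)) (≡-sym (head-combine x y)) p ,
      trans (head-combine x y) (≡-sym (tail-combine y z)) ,
      subst₂ Arc (≡-sym (tail-combine y z)) (≡-sym (head-combine y z)) q
      where
      tail-combine : ∀ x y → tail (Fin.combine x y) ≡ x
      tail-combine x y = cong proj₁ (Finₚ.remQuot-combine x y)
      head-combine : ∀ x y → head (Fin.combine x y) ≡ y
      head-combine x y = cong proj₂ (Finₚ.remQuot-combine x y)
    distinct : ∀ {x y} → Arc x y → f x ≢ f y
    distinct {x} {y} p e with does-true (out? y _) (trans (≡-sym (encode-injective _ _ e (κ (Fin.combine x y)))) (true-does (out? x _) (y , p , refl)))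
    ... | z , q , same = proper _ _ (δ.toAdj (inj₁ (consecutive p q))) (≡-sym same)

tournament : ℕ → Digraph
tournament m = record { size = m ; Arc = Fin._<_ ; arc? = Fin._<?_ ; height = toℕ ; ascends = id }

-- Shift graphs, as iterated arc graphs of transitive tournaments.
oddGirth-chromatic : ∀ r k → Σ Digraph λ D → OddWalkFree (underlying D) (suc (r + r)) × ChromaticGt (underlying D) k
oddGirth-chromatic zero k = D , short , λ (f , proper) →
    let i , j , i<j , e = Finₚ.pigeonhole (ℕₚ.n<1+n k) f in proper i j (Digraph.toAdj D (inj₁ i<j)) e
  where
  D = tournament (suc k)
  short : OddWalkFree (underlying D) 1
  short zero    x _ (cons a nil) = Adj-irrefl (underlying D) {x} a
  short (suc k) x (s≤s ()) w
oddGirth-chromatic (suc r) k with oddGirth-chromatic r (2 ^ k)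
... | D , owf , χ = arcGraph D ,
      subst (λ q → OddWalkFree (underlying (arcGraph D)) (2 + q)) (≡-sym (ℕₚ.+-suc r r)) (ArcGraph.oddWalkFree D _ owf) ,
      λ c → χ (ArcGraph.colourable D c)

-- The right adjoint of the odd power functor: a vertex records, for every colour i, the l ≤ p for
-- which it is joined to the colour class i by a walk of length l.
module PowerTarget (N p : ℕ) where

  Code : Set
  Code = Fin (2 ^ (N * suc p))

  Records : Code → Fin N → Fin (suc p) → Set
  Records x i l = decode {N * suc p} x (Fin.combine i l) ≡ true

  records? : ∀ x i l → Dec (Records x i l)
  records? x i l = decode {N * suc p} x (Fin.combine i l) ≟ᵇ true

  Own : Code → Set
  Own x = ∃[ i ] Records x i zero

  Shift : Code → Code → Set
  Shift x y = ∀ i (l : Fin p) → Records x i (inject₁ l) → Records y i (suc l)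

  shift? : ∀ x y → Dec (Shift x y)
  shift? x y = Finₚ.all? λ i → Finₚ.all? λ l → records? x i (inject₁ l) →-dec records? y i (suc l)

  -- The last clause reflects that two adjacent vertices at the same distance l from one colour
  -- class would give a walk of length 2l + 1 with equally coloured ends. The first makes every
  -- non-isolated vertex carry a colour at distance zero.
  Compatible : Code → Code → Set
  Compatible x y = (Own x × Own y) × (Shift x y × Shift y x) × (∀ i l → ¬ (Records x i l × Records y i l))

  compatible? : ∀ x y → Dec (Compatible x y)
  compatible? x y =
    (Finₚ.any? (λ i → records? x i zero) ×-dec Finₚ.any? (λ i → records? y i zero)) ×-dec
    (shift? x y ×-dec shift? y x) ×-dec
    Finₚ.all? λ i → Finₚ.all? λ l → ¬? (records? x i l ×-dec records? y i l)

  compatible-sym : ∀ {x y} → Compatible x y → Compatible y x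
  compatible-sym ((a , b) , (c , d) , e) = (b , a) , (d , c) , λ i l (u , v) → e i l (v , u)

  compatible-irrefl : ∀ {x} → ¬ Compatible x x
  compatible-irrefl (((i , a) , _) , _ , e) = e i zero (a , a)

  private
    module Ω = MkGraph compatible? compatible-sym compatible-irrefl
  open Ω public using () renaming (graph to target)

  spread : ∀ {x y} k {i} (l₀ l : Fin (suc p)) → toℕ l ≡ toℕ l₀ + k → Walk (Adj target) x y k → Records x i l₀ → Records y i l
  spread zero {i} l₀ l e nil m = subst (Records _ i) (≡-sym (Finₚ.toℕ-injective (trans e (ℕₚ.+-identityʳ _)))) m
  spread {x} (suc k) {i} l₀ l e (cons {y = x′} a w) m = spread k (suc l₁) l
      (trans e (trans (ℕₚ.+-suc _ k) (cong (λ t → suc (t + k)) (≡-sym (Finₚ.toℕ-fromℕ< lt))))) w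
      (proj₁ (proj₁ (proj₂ (Ω.fromAdj a))) i l₁ (subst (Records x i) (Finₚ.toℕ-injective
        (≡-sym (trans (Finₚ.toℕ-inject₁ l₁) (Finₚ.toℕ-fromℕ< lt)))) m))
    where
    lt : toℕ l₀ < p
    lt = ℕₚ.≤-pred (ℕₚ.≤-trans (s≤s (ℕₚ.≤-trans (s≤s (ℕₚ.m≤m+n (toℕ l₀) k)) (ℕₚ.≤-reflexive (≡-sym (trans e (ℕₚ.+-suc _ k)))))) (Finₚ.toℕ<n l))
    l₁ = fromℕ< lt

  halve : ∀ {a b} → suc (a + a) ≤ suc (b + b) → a ≤ b
  halve {zero} _ = z≤n
  halve {suc a} {zero} (s≤s ())
  halve {suc a} {suc b} (s≤s le) rewrite ℕₚ.+-suc a a | ℕₚ.+-suc b b = s≤s (halve {a} {b} (ℕₚ.≤-pred le))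

  -- The own colour of `x` spreads k steps along both halves of the closed walk and so is recorded
  -- at distance k by both ends of its middle edge, which adjacency forbids.
  target-oddWalkFree : OddWalkFree target (suc (p + p))
  target-oddWalkFree k x le w with splitʷ k (castʷ (≡-sym (ℕₚ.+-suc k k)) w)
  ... | u , w₁ , cons {y = v} a w₂ with Ω.fromAdj a
  ... | _ , _ , disjoint = let (i , m) = own x k w in
        disjoint i l (spread k zero l (Finₚ.toℕ-fromℕ< lt) w₁ m , spread k zero l (Finₚ.toℕ-fromℕ< lt) (reverseʷ (Adj-sym target) w₂) m)
    where
    lt : k < suc p
    lt = s≤s (halve {k} {p} le)
    l = fromℕ< lt
    own : ∀ x k → Walk (Adj target) x x (suc (k + k)) → Own x
    own x k (cons a _) = proj₁ (proj₁ (Ω.fromAdj a))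

  toTarget : ∀ {G} → OddPowerColouring G (suc (p + p)) N → G ⟶ target
  toTarget {G} (κ , separated) = f , λ x y a → Ω.toAdj
      ( (own x , own y) , (shift a , shift (Adj-sym G a))
      , λ i l (m , m′) → let z , e , w = out m ; z′ , e′ , w′ = out m′ in
          -- The walk from `z` over the edge `x` `y` to `z′` has length 2l + 1; it is padded to 2p +
          -- 1, the only length that `κ` controls.
          separated (castʷ (cong suc (length-pad (toℕ l) (ℕₚ.≤-pred (Finₚ.toℕ<n l))))
            (castʷ (ℕₚ.+-suc _ _) (padʷ (Adj-sym G) (p ∸ toℕ l) (toℕ l + toℕ l)
              (castʷ (ℕₚ.+-suc (toℕ l) (toℕ l)) (reverseʷ (Adj-sym G) w ⋆ cons a w′)))))
          (trans e (≡-sym e′)) )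
    where
    Near : V G → Fin N × Fin (suc p) → Set
    Near x (i , l) = ∃[ z ] (κ z ≡ i × Walk (Adj G) x z (toℕ l))
    near? : ∀ x il → Dec (Near x il)
    near? x (i , l) = Finₚ.any? λ z → (κ z Fin.≟ i) ×-dec walk? (Adj? G) (toℕ l) x z
    nearᵇ : V G → Fin (N * suc p) → Bool
    nearᵇ x k = does (near? x (Fin.remQuot (suc p) k))
    f : V G → Code
    f x = encode (nearᵇ x)
    value : ∀ x i l → decode {N * suc p} (f x) (Fin.combine i l) ≡ does (near? x (i , l))
    value x i l = trans (decode-encode (nearᵇ x) _) (cong (λ il → does (near? x il)) (Finₚ.remQuot-combine i l))
    into : ∀ {x i l} → Near x (i , l) → Records (f x) i l
    into {x} {i} {l} m = trans (value x i l) (true-does (near? x (i , l)) m)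
    out : ∀ {x i l} → Records (f x) i l → Near x (i , l)
    out {x} {i} {l} m = does-true (near? x (i , l)) (trans (≡-sym (value x i l)) m)
    own : ∀ x → Own (f x)
    own x = κ x , into (x , refl , nil)
    shift : ∀ {x y} → Adj G x y → Shift (f x) (f y)
    shift a i l m with out m
    ... | z , e , w = into (z , e , cons (Adj-sym G a) (castʷ (Finₚ.toℕ-inject₁ l) w))
    length-pad : ∀ l → l ≤ p → p ∸ l + (p ∸ l) + (l + l) ≡ p + p
    length-pad l le = trans
      (solve 2 (λ a b → (a :+ a) :+ (b :+ b) := (a :+ b) :+ (a :+ b)) refl (p ∸ l) l)
      (cong (λ t → t + t) (ℕₚ.m∸n+n≡m le))

-- Bounded expansion makes the colouring first-order definable.

walkF : ∀ {k} → ℕ → Fin k → Fin k → Formula k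
walkF zero    i j = eqF i j
walkF (suc l) i j = ∃F (adjF (suc i) zero ∧F walkF l zero (suc j))

walkF-sound : ∀ {k G} {ρ : Fin k → V G} l {i j} → Sat G ρ (walkF l i j) → Walk (Adj G) (ρ i) (ρ j) l
walkF-sound {G = G} {ρ} zero {i} e = subst (λ x → Walk (Adj G) (ρ i) x 0) e nil
walkF-sound (suc l)      (z , a , s) = cons a (walkF-sound l s)

walkF-complete : ∀ {k G} {ρ : Fin k → V G} l {i j} → Walk (Adj G) (ρ i) (ρ j) l → Sat G ρ (walkF l i j)
walkF-complete = λ l w → go l w refl refl
  where
  go : ∀ {k G} {ρ : Fin k → V G} l {i j x y} → Walk (Adj G) x y l → x ≡ ρ i → y ≡ ρ j → Sat G ρ (walkF l i j)
  go zero    nil                refl e    = e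
  go (suc l) (cons {y = z} a w) refl refl = z , a , go l w refl refl

fromSteps : ∀ {X : Set} {R : X → X → Set} k (f : Fin (suc k) → X) →
            (∀ i → R (f (inject₁ i)) (f (suc i))) → Walk R (f zero) (f (fromℕ k)) k
fromSteps zero    f r = nil
fromSteps (suc k) f r = cons (r zero) (fromSteps k (f ∘ suc) (λ i → r (suc i)))

cycle⇒walk : ∀ {G m} → Cycle G m → ∃[ x ] Walk (Adj G) x x (3 + m)
cycle⇒walk (c , _ , step , close) = c zero , snoc (fromSteps _ c step) close

OddWalkFree⇒OddGirthGt : ∀ {G q} → OddWalkFree G q → OddGirthGt G q
OddWalkFree⇒OddGirthGt {G} {q} owf m k e le cyc with cycle⇒walk {G} cyc
... | x , w = owf k x (subst (_≤ q) e le) (castʷ e w)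

-- The target is fixed before any graph of the class, because `powerColours` depends only on the
-- density bounds. Beyond the `B` colours for the class there is one for every vertex of a shift
-- graph; this graph therefore maps to the target and keeps it from being bipartite.
BoundedExpansion⇒Condition1 : ∀ C → BoundedExpansion C → Condition1 C
BoundedExpansion⇒Condition1 C be p with oddGirth-chromatic p 2
... | D , shift-odd , shift-χ =
  target , (λ (c , proper) → shift-χ (let f , h = shift in (λ x → c (f x)) , λ x y a → proper _ _ (h x y a))) ,
  OddWalkFree⇒OddGirthGt {target} (subst (OddWalkFree target) 2p+1 target-oddWalkFree) ,
  Φ , λ G G∈C → (colour G G∈C) ,
    λ h s → let x , w = s in OddWalkFree-⟶ {G} {target} q h target-oddWalkFree p x ℕₚ.≤-refl (walkF-sound q {zero} {zero} w)
  where
  q = suc (p + p)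
  d : ℕ → ℕ
  d r = proj₁ (be r)
  B = powerColours d q
  open PowerTarget (B + n (underlying D)) p
  2p+1 : suc (p + p) ≡ 2 * p + 1
  2p+1 = trans (cong suc (cong (p +_) (≡-sym (ℕₚ.+-identityʳ p)))) (ℕₚ.+-comm 1 (2 * p))
  shift : underlying D ⟶ target
  -- All vertices of the shift graph get different colours, so equal colours at the ends of a walk
  -- of length `q` would make it closed.
  shift = toTarget {underlying D} ((B Fin.↑ʳ_) , λ {u} {v} w e → shift-odd p u ℕₚ.≤-refl
            (subst (λ x → Walk _ u x q) (≡-sym (Finₚ.↑ʳ-injective B u v e)) w))
  Φ : Sentence
  Φ = ¬F (∃F (walkF q zero zero))
  colour : ∀ G → C G → G ⊨ Φ → G ⟶ target
  colour G G∈C none = toTarget {G} ((λ x → κ x Fin.↑ˡ n (underlying D)) , λ {u} {v} w e → separated w (Finₚ.↑ˡ-injective (n (underlying D)) (κ u) (κ v) e))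
    where
    owf : OddWalkFree G q
    owf k x le w = none (x , walkF-complete q {zero} {zero} (castʷ lengths (padʷ (Adj-sym G) (p ∸ k) (k + k) w)))
      where
      lengths : p ∸ k + (p ∸ k) + suc (k + k) ≡ q
      lengths = trans (solve 2 (λ a b → (a :+ a) :+ (con 1 :+ (b :+ b)) := con 1 :+ ((a :+ b) :+ (a :+ b))) refl (p ∸ k) k)
        (cong (λ t → suc (t + t)) (ℕₚ.m∸n+n≡m (halve {k} {p} le)))
    power : OddPowerColouring G q B
    power = powerColouring {G} {d} (λ r H shallow → proj₂ (be r) H (G , G∈C , shallow)) p owf
    κ = proj₁ power
    separated = proj₂ power

-- Cycles in closed walks

module _ {X : Set} {R : X → X → Set} where

  at : ∀ {x y l} → Walk R x y l → ℕ → X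
  at (nil {x})        _       = x
  at (cons {x} r w)   zero    = x
  at (cons r w)       (suc t) = at w t

  at-start : ∀ {x y l} (w : Walk R x y l) → at w 0 ≡ x
  at-start nil        = refl
  at-start (cons r w) = refl

  at-end : ∀ {x y l} (w : Walk R x y l) → at w l ≡ y
  at-end nil        = refl
  at-end (cons r w) = at-end w

  at-step : ∀ {x y l} (w : Walk R x y l) {t} → t < l → R (at w t) (at w (suc t))
  at-step (cons {x} r w) {zero} lt = subst (R x) (≡-sym (at-start w)) r
  at-step (cons r w) {suc t} (s≤s lt) = at-step w lt

  segment : (u : ℕ → X) → ∀ i d → (∀ {t} → t < i + d → R (u t) (u (suc t))) → Walk R (u i) (u (i + d)) d
  segment u i zero    step = subst (λ t → Walk R (u i) (u t) 0) (≡-sym (ℕₚ.+-identityʳ i)) nil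
  segment u i (suc d) step = cons (step (ℕₚ.m<m+n i (s≤s z≤n)))
    (subst (λ t → Walk R (u (suc i)) (u t) d) (≡-sym (ℕₚ.+-suc i d))
      (segment u (suc i) d (λ {t} lt → step (subst (t <_) (≡-sym (ℕₚ.+-suc i d)) lt))))

SimpleLoop : {X : Set} → (ℕ → X) → ℕ → ℕ → Set
SimpleLoop u j e = u j ≡ u (j + suc e) × (∀ {s t} → s < t → t ≤ e → u (j + s) ≢ u (j + t))

-- A repetition strictly inside a closed stretch bounds a shorter closed stretch, and the descent
-- stops at one without inner repetitions; `N` is fuel. The parameter `e` of a loop stands for
-- `suc e` steps.
simpleLoop : ∀ {m} (u : ℕ → Fin m) N d → d ≤ N → ∀ i → u i ≡ u (i + suc d) →
             ∃[ j ] ∃[ e ] (i ≤ j × j + suc e ≤ i + suc d × SimpleLoop u j e)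
simpleLoop u N d d≤N i eq with Finₚ.any? {n = suc d} (λ s → Finₚ.any? {n = suc d} (λ t → (s Fin.<? t) ×-dec (u (i + toℕ s) Fin.≟ u (i + toℕ t))))
... | no none = i , d , ℕₚ.≤-refl , ℕₚ.≤-refl , eq , λ {s} {t} s<t t≤d e →
      let s<  = ℕₚ.<-≤-trans s<t (ℕₚ.≤-trans t≤d (ℕₚ.n≤1+n d)) ; t< = s≤s t≤d in
      none (fromℕ< s< , fromℕ< t< ,
            subst₂ _<_ (≡-sym (Finₚ.toℕ-fromℕ< s<)) (≡-sym (Finₚ.toℕ-fromℕ< t<)) s<t ,
            subst₂ (λ a b → u (i + a) ≡ u (i + b)) (≡-sym (Finₚ.toℕ-fromℕ< s<)) (≡-sym (Finₚ.toℕ-fromℕ< t<)) e)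
... | yes (s , t , s<t , e) with ℕₚ.m≤n⇒∃[o]m+o≡n s<t
simpleLoop u zero    zero    z≤n i eq | yes (zero , zero , () , e) | _
simpleLoop u (suc N) d d≤N i eq | yes (s , t , s<t , e) | k , s+k with
  simpleLoop u N k (ℕₚ.≤-pred (ℕₚ.≤-trans (ℕₚ.≤-trans (s≤s (ℕₚ.m≤n+m k (toℕ s))) (ℕₚ.≤-trans (ℕₚ.≤-reflexive s+k) (ℕₚ.≤-pred (Finₚ.toℕ<n t)))) d≤N))
    (i + toℕ s) (trans e (cong u (trans (cong (i +_) (≡-sym (trans (ℕₚ.+-suc (toℕ s) k) s+k))) (≡-sym (ℕₚ.+-assoc i (toℕ s) (suc k))))))
... | j , e′ , i≤j , j≤ , loop = j , e′ , ℕₚ.≤-trans (ℕₚ.m≤m+n i _) i≤j ,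
      ℕₚ.≤-trans j≤ (ℕₚ.≤-trans (ℕₚ.≤-reflexive (trans (ℕₚ.+-assoc i (toℕ s) (suc k)) (cong (i +_) (trans (ℕₚ.+-suc (toℕ s) k) s+k))))
                     (ℕₚ.+-monoʳ-≤ i (ℕₚ.<⇒≤ (Finₚ.toℕ<n t)))) , loop

simpleLoop⇒cycle : ∀ {G} (u : ℕ → V G) j m → SimpleLoop u j (2 + m) →
  (∀ {t} → t < j + (3 + m) → Adj G (u t) (u (suc t))) → Cycle G m
simpleLoop⇒cycle {G} u j m (eq , distinct) step = c , inj , steps ,
  subst (Adj G (c (fromℕ (2 + m)))) (≡-sym (trans (cong u (ℕₚ.+-identityʳ j)) eq)) last
  where
  c : Fin (3 + m) → V G
  c i = u (j + toℕ i)
  inj : Injective c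
  inj a b e with Finₚ.<-cmp a b
  ... | tri≈ _ p _ = p
  ... | tri< lt _ _ = ⊥-elim (distinct lt (ℕₚ.≤-pred (Finₚ.toℕ<n b)) e)
  ... | tri> _ _ gt = ⊥-elim (distinct gt (ℕₚ.≤-pred (Finₚ.toℕ<n a)) (≡-sym e))
  steps : ∀ i → Adj G (c (inject₁ i)) (c (suc i))
  steps i rewrite Finₚ.toℕ-inject₁ i | ℕₚ.+-suc j (toℕ i) = step (ℕₚ.+-monoʳ-< j (ℕₚ.m<n⇒m<1+n (Finₚ.toℕ<n i)))
  last : Adj G (c (fromℕ (2 + m))) (u (j + (3 + m)))
  last rewrite Finₚ.toℕ-fromℕ m | ℕₚ.+-suc j (2 + m) = step ℕₚ.≤-refl

-- A simple loop with an odd number of steps is the cycle; one with an even number is cut out, which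
-- leaves a shorter odd closed walk. As a loop has `suc e` steps, even `e` is the odd case, and
-- `e = 0` would be an edge from a vertex to itself.
oddWalk⇒oddCycle : ∀ {G} N k {x} → k ≤ N → Walk (Adj G) x x (suc (k + k)) →
  ∃[ m ] ∃[ j ] (3 + m ≡ suc (j + j) × 3 + m ≤ suc (k + k) × Cycle G m)
oddWalk⇒oddCycle {G} N k {x} k≤N w with simpleLoop (at w) (k + k) (k + k) ℕₚ.≤-refl 0 (trans (at-start w) (≡-sym (at-end w)))
... | j , e , _ , j≤ , loop@(eq , _) with odd? e
... | inj₁ (zero , refl) = ⊥-elim (Adj⇒≢ G (at-step w (subst (_≤ suc (k + k)) (ℕₚ.+-comm j 1) j≤)) (trans eq (cong (at w) (ℕₚ.+-comm j 1))))
... | inj₁ (suc i , refl) = i + i , suc i , cong suc (cong suc (≡-sym (ℕₚ.+-suc i i))) ,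
      ℕₚ.≤-trans (ℕₚ.m≤n+m _ j) (subst (λ t → j + t ≤ suc (k + k)) (cong suc (cong suc (ℕₚ.+-suc i i))) j≤) ,
      simpleLoop⇒cycle {G} (at w) j (i + i) (subst (SimpleLoop (at w) j) (cong suc (ℕₚ.+-suc i i)) loop)
        (λ lt → at-step w (ℕₚ.<-≤-trans lt (subst (λ t → j + t ≤ suc (k + k)) (cong suc (cong suc (ℕₚ.+-suc i i))) j≤)))
... | inj₂ (i , refl) with ℕₚ.m≤n⇒∃[o]m+o≡n j≤
... | o , j+o = recurse N k k≤N o-eq shorter
  where
  shorter : Walk (Adj G) x x (j + o)
  shorter = subst₂ (λ a b → Walk (Adj G) a b (j + o)) (at-start w) (trans (cong (at w) j+o) (at-end w))
    (segment (at w) 0 j (λ lt → at-step w (ℕₚ.<-≤-trans lt (ℕₚ.≤-trans (ℕₚ.m≤m+n j _) j≤)))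
     ⋆ subst (λ a → Walk (Adj G) a (at w (j + suc (suc (i + i)) + o)) o) (≡-sym eq)
         (segment (at w) (j + suc (suc (i + i))) o (λ {t} lt → at-step w (subst (t <_) j+o lt))))
  o-eq : j + o + suc (i + suc i) ≡ suc (k + k)
  o-eq = trans (solve 3 (λ j i o → j :+ o :+ (con 1 :+ (i :+ (con 1 :+ i))) := j :+ (con 2 :+ (i :+ i)) :+ o) refl j i o) j+o
  recurse : ∀ N k → k ≤ N → ∀ {l i} → l + suc (i + suc i) ≡ suc (k + k) → Walk (Adj G) x x l →
    ∃[ m ] ∃[ j ] (3 + m ≡ suc (j + j) × 3 + m ≤ suc (k + k) × Cycle G m)
  recurse N k k≤N {l} {i} e v with odd? l
  ... | inj₁ (a , refl) = ⊥-elim (double≢odd (a + suc i) k (trans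
        (solve 2 (λ a i → (a :+ (con 1 :+ i)) :+ (a :+ (con 1 :+ i)) := a :+ a :+ (con 1 :+ (i :+ (con 1 :+ i)))) refl a i) e))
  recurse zero zero k≤N {i = i} e v | inj₂ (a , refl) rewrite ℕₚ.+-suc (a + a) (i + suc i) with e
  ... | ()
  recurse (suc N) k k≤N {i = i} e v | inj₂ (a , refl) =
    let m , j , odd , le , cyc = oddWalk⇒oddCycle {G} N a (ℕₚ.≤-pred (ℕₚ.≤-trans a<k k≤N)) v
    in m , j , odd , ℕₚ.≤-trans le (ℕₚ.≤-trans (ℕₚ.m≤m+n _ _) (ℕₚ.≤-reflexive e)) , cyc
    where
    a<k : a < k
    a<k = ℕₚ.≰⇒> λ k≤a → ℕₚ.<⇒≱ (ℕₚ.m<m+n (suc (a + a)) {suc (i + suc i)} (s≤s z≤n))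
      (ℕₚ.≤-trans (ℕₚ.≤-reflexive e) (s≤s (ℕₚ.+-mono-≤ k≤a k≤a)))

OddGirthGt⇒OddWalkFree : ∀ {G q} → OddGirthGt G q → OddWalkFree G q
OddGirthGt⇒OddWalkFree {G} og k x le w with oddWalk⇒oddCycle {G} k k ℕₚ.≤-refl w
... | m , j , odd , le′ , cyc = og m j odd (ℕₚ.≤-trans le′ le) cyc

GirthGt⇒OddWalkFree : ∀ {G q} → GirthGt G q → OddWalkFree G q
GirthGt⇒OddWalkFree {G} g = OddGirthGt⇒OddWalkFree {G} (λ m _ _ → g m)

-- Graphs of large girth and minimum degree

Branching : Graph → ℕ → Set
Branching G d = ∀ x → Σ (Fin d → V G) λ nbr → Injective nbr × (∀ i → Adj G x (nbr i))

branching⇒degreeSum : ∀ {G d} → Branching G d → n G * d ≤ degreeSum G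
branching⇒degreeSum {G} {d} br = subst (λ k → k * d ≤ degreeSum G) (Listₚ.length-tabulate {n = n G} id)
  (sum-mono (λ x → sum (map (λ y → if adj G x y then 1 else 0) (allFin (n G)))) d (allFin (n G)) (λ {x} _ → row x))
  where
  row : ∀ x → d ≤ sum (map (λ y → if adj G x y then 1 else 0) (allFin (n G)))
  row x with br x
  ... | nbr , inj , a = subst₂ _≤_ (Listₚ.length-tabulate nbr) (length-neighbours G x (allFin (n G)))
    (Unique-⊆⇒length≤ (Uniqueₚ.tabulate⁺ (λ {i} {j} → inj i j))
      λ p → let i , e = ∈ₚ.∈-tabulate⁻ p in subst (_∈ filter (Adj? G x) (allFin (n G))) (≡-sym e)
        (∈ₚ.∈-filter⁺ (Adj? G x) (∈ₚ.∈-allFin (nbr i)) (a i)))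

complete : ℕ → Graph
complete m = MkGraph.graph {m} {_≢_} (λ x y → ¬? (x Fin.≟ y)) (λ ne e → ne (≡-sym e)) (λ ne → ne refl)

complete-adj : ∀ {m} {x y : Fin m} → x ≢ y → Adj (complete m) x y
complete-adj {m} = MkGraph.toAdj {m} {_≢_} (λ x y → ¬? (x Fin.≟ y)) (λ ne e → ne (≡-sym e)) (λ ne → ne refl)

-- Traversing an edge of the lift flips the coordinate of that edge, so a closed walk of the lift
-- projects to a closed walk using every edge an even number of times.
module EdgeLift (G : Graph) where

  Coord : Set
  Coord = Fin (n G * n G)

  sheets : ℕ
  sheets = 2 ^ (n G * n G)

  -- Every edge owns the coordinates of both of its ordered pairs, flipped together, so no
  -- orientation has to be chosen.
  On : V G → V G → Coord → Set
  On u v k = Fin.combine u v ≡ k ⊎ Fin.combine v u ≡ k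

  on? : ∀ u v k → Dec (On u v k)
  on? u v k = (Fin.combine u v Fin.≟ k) ⊎-dec (Fin.combine v u Fin.≟ k)

  L : ℕ
  L = n G * sheets

  split : Fin L → V G × Fin sheets
  split = Fin.remQuot sheets

  base : Fin L → V G
  base a = proj₁ (split a)

  sheet : Fin L → Coord → Bool
  sheet a = decode {n G * n G} (proj₂ (split a))

  place : V G → (Coord → Bool) → Fin L
  place u σ = Fin.combine u (encode σ)

  base-place : ∀ u σ → base (place u σ) ≡ u
  base-place u σ = cong proj₁ (Finₚ.remQuot-combine u (encode σ))

  sheet-place : ∀ u σ k → sheet (place u σ) k ≡ σ k
  sheet-place u σ k = trans (cong (λ p → decode {n G * n G} (proj₂ p) k) (Finₚ.remQuot-combine u (encode σ))) (decode-encode σ k)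

  decode-injective : ∀ {m} (a b : Fin (2 ^ m)) → (∀ i → decode {m} a i ≡ decode {m} b i) → a ≡ b
  decode-injective {zero} zero zero e = refl
  decode-injective {suc m} a b e = trans (≡-sym (Finₚ.combine-remQuot {2} (2 ^ m) a))
    (trans (cong₂ Fin.combine (bit {Fin.quotient {2} (2 ^ m) a} {Fin.quotient {2} (2 ^ m) b} (e zero)) (decode-injective {m} (Fin.remainder {2} (2 ^ m) a) (Fin.remainder {2} (2 ^ m) b) (λ i → e (suc i)))) (Finₚ.combine-remQuot {2} (2 ^ m) b))
    where
    bit : ∀ {x y : Fin 2} → does (x Fin.≟ suc zero) ≡ does (y Fin.≟ suc zero) → x ≡ y
    bit {zero}     {zero}     _ = refl
    bit {suc zero} {suc zero} _ = refl
    bit {zero}     {suc zero} ()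
    bit {suc zero} {zero}     ()

  lift-ext : ∀ {a b} → base a ≡ base b → (∀ k → sheet a k ≡ sheet b k) → a ≡ b
  lift-ext {a} {b} e f = trans (≡-sym (Finₚ.combine-remQuot {n G} sheets a))
    (trans (cong₂ Fin.combine e (decode-injective {n G * n G} _ _ f)) (Finₚ.combine-remQuot {n G} sheets b))

  LiftAdj : Fin L → Fin L → Set
  LiftAdj a b = Adj G (base a) (base b) × (∀ k → sheet b k ≡ sheet a k xor does (on? (base a) (base b) k))

  xor-cancel : ∀ x y → x ≡ (x xor y) xor y
  xor-cancel x y = ≡-sym (trans (xor-assoc x y y) (trans (cong (x xor_) (xor-same y)) (xor-identityʳ x)))

  on-sym : ∀ u v k → does (on? u v k) ≡ does (on? v u k)
  on-sym u v k = does-cong (on? u v k) (on? v u k) (λ { (inj₁ e) → inj₂ e ; (inj₂ e) → inj₁ e }) (λ { (inj₁ e) → inj₂ e ; (inj₂ e) → inj₁ e })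

  liftAdj? : ∀ a b → Dec (LiftAdj a b)
  liftAdj? a b = Adj? G (base a) (base b) ×-dec Finₚ.all? λ k → sheet b k ≟ᵇ sheet a k xor does (on? (base a) (base b) k)

  liftAdj-sym : ∀ {a b} → LiftAdj a b → LiftAdj b a
  liftAdj-sym {a} {b} (e , f) = Adj-sym G e , λ k → trans (xor-cancel (sheet a k) (does (on? (base a) (base b) k)))
    (cong₂ _xor_ (≡-sym (f k)) (on-sym (base a) (base b) k))

  liftAdj-irrefl : ∀ {a} → ¬ LiftAdj a a
  liftAdj-irrefl (e , _) = Adj-irrefl G e

  module Lift = MkGraph liftAdj? (λ {a} → liftAdj-sym {a}) (λ {a} → liftAdj-irrefl {a})

  lift : Graph
  lift = Lift.graph

  lift-branching : ∀ {d} → Branching G d → Branching lift d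
  lift-branching br a with br (base a)
  ... | nbr , inj , e = nbr′ ,
      (λ i j eq → inj i j (trans (≡-sym (base-place (nbr i) (σ i))) (trans (cong base eq) (base-place (nbr j) (σ j))))) ,
      λ i → Lift.toAdj (subst (Adj G (base a)) (≡-sym (base-place (nbr i) (σ i))) (e i) ,
        λ k → trans (sheet-place (nbr i) (σ i) k) (cong (λ v → sheet a k xor does (on? (base a) v k)) (≡-sym (base-place (nbr i) (σ i)))))
    where
    σ : ∀ i → Coord → Bool
    σ i k = sheet a k xor does (on? (base a) (nbr i) k)
    nbr′ : _ → Fin L
    nbr′ i = place (nbr i) (σ i)

  -- A simple loop of the projected cycle cannot have one step. With two steps the lift would return
  -- to the same vertex, both steps flipping the same coordinates. A longer loop is a cycle of `G`,
  -- hence longer than `g`, so it is the whole projection, and that case is refuted by the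
  -- coordinate of its first edge.
  lift-girth : ∀ {g} → GirthGt G g → GirthGt lift (suc g)
  lift-girth {g} girth m le (c , c-inj , c-step , c-close) = contradiction
    where
    l : ℕ
    l = 3 + m
    u : ℕ → Fin L
    u t with t ℕ.<? l
    ... | yes lt = c (fromℕ< lt)
    ... | no _   = c zero
    u-c : ∀ {t} (lt : t < l) → u t ≡ c (fromℕ< lt)
    u-c {t} lt with t ℕ.<? l
    ... | yes lt′ = cong c (Finₚ.fromℕ<-cong t t refl lt′ lt)
    ... | no ¬lt = ⊥-elim (¬lt lt)
    u-end : u l ≡ c zero
    u-end with l ℕ.<? l
    ... | yes lt = ⊥-elim (ℕₚ.<-irrefl refl lt)
    ... | no _ = refl
    u-injective : ∀ {s t} → s < l → t < l → u s ≡ u t → s ≡ t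
    u-injective s< t< e = Finₚ.fromℕ<-injective _ _ s< t< (c-inj _ _ (trans (≡-sym (u-c s<)) (trans e (u-c t<))))
    u-step : ∀ {t} → t < l → LiftAdj (u t) (u (suc t))
    u-step {t} lt with t ℕ.<? 2 + m
    ... | yes lt′ = Lift.fromAdj (subst₂ (Adj lift)
            (trans (cong c (Finₚ.toℕ-injective (trans (Finₚ.toℕ-inject₁ _) (trans (Finₚ.toℕ-fromℕ< lt′) (≡-sym (Finₚ.toℕ-fromℕ< lt)))))) (≡-sym (u-c lt)))
            (≡-sym (u-c (s≤s lt′))) (c-step (fromℕ< lt′)))
    ... | no ¬lt with ℕₚ.≤-antisym (ℕₚ.≤-pred lt) (ℕₚ.≮⇒≥ ¬lt)
    ... | refl = Lift.fromAdj (subst₂ (Adj lift)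
            (trans (cong c (Finₚ.toℕ-injective (trans (Finₚ.toℕ-fromℕ (2 + m)) (≡-sym (Finₚ.toℕ-fromℕ< lt))))) (≡-sym (u-c lt)))
            (≡-sym u-end) c-close)
    closed : u 0 ≡ u l
    closed = trans (u-c (s≤s z≤n)) (≡-sym u-end)
    f : ℕ → V G
    f t = base (u t)
    f-step : ∀ {t} → t < l → Adj G (f t) (f (suc t))
    f-step lt = proj₁ (u-step lt)

    two-steps : ∀ {j} → suc j < l → f j ≡ f (2 + j) → u j ≡ u (2 + j)
    two-steps {j} lt eq = lift-ext eq λ k → trans
      (xor-cancel (sheet (u j) k) (does (on? (f j) (f (suc j)) k)))
      (trans (cong₂ _xor_ (≡-sym (proj₂ (u-step (ℕₚ.<⇒≤ lt)) k))
                (trans (on-sym (f j) (f (suc j)) k) (cong (λ v → does (on? (f (suc j)) v k)) eq)))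
             (≡-sym (proj₂ (u-step lt) k)))

    no-backtrack : ∀ {j} → suc j < l → f j ≢ f (2 + j)
    no-backtrack {j} lt eq with two-steps lt eq | ℕₚ.m≤n⇒m<n∨m≡n lt
    ... | same | inj₁ lt′ = ℕₚ.m≢1+m+n j {1} (trans (u-injective (ℕₚ.<⇒≤ lt) lt′ same) (cong suc (ℕₚ.+-comm 1 j)))
    -- The backtracking ends at index l, where `u` closes up to index 0; this would force the cycle
    -- to have length 2.
    ... | same | inj₂ refl with u-injective (ℕₚ.<⇒≤ lt) (s≤s z≤n) (trans same (≡-sym closed))
    ... | ()

    -- If the projection is itself a cycle, the coordinate of its first edge is flipped exactly once.
    module Simple (distinct : ∀ {s t} → s < t → t ≤ 2 + m → f s ≢ f t) where
      k : Coord
      k = Fin.combine (f 0) (f 1)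
      off : ∀ t → suc t < l → does (on? (f (suc t)) (f (2 + t)) k) ≡ false
      off t lt = false-does (on? (f (suc t)) (f (2 + t)) k) λ
        { (inj₁ e) → distinct (s≤s z≤n) (ℕₚ.≤-pred lt) (≡-sym (proj₁ (Finₚ.combine-injective (f (suc t)) (f (2 + t)) (f 0) (f 1) e)))
        ; (inj₂ e) → let e₀ , e₁ = Finₚ.combine-injective (f (2 + t)) (f (suc t)) (f 0) (f 1) e in second t lt e₀ e₁ }
        where
        second : ∀ t → suc t < l → f (2 + t) ≡ f 0 → f (suc t) ≡ f 1 → ⊥
        second zero    lt e _ = distinct (s≤s z≤n) (s≤s (s≤s z≤n)) (≡-sym e)
        second (suc t) lt _ e = distinct (s≤s (s≤s z≤n)) (ℕₚ.≤-pred lt) (≡-sym e)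
      flipped : ∀ t → t < l → sheet (u (suc t)) k ≡ sheet (u 0) k xor true
      flipped zero    lt = trans (proj₂ (u-step lt) k) (cong (sheet (u 0) k xor_) (true-does (on? (f 0) (f 1) k) (inj₁ refl)))
      flipped (suc t) lt = trans (proj₂ (u-step lt) k)
        (trans (cong₂ _xor_ (flipped t (ℕₚ.<⇒≤ lt)) (off t lt)) (xor-identityʳ _))
      no-fixpoint : ∀ b → b ≢ b xor true
      no-fixpoint true  ()
      no-fixpoint false ()
      absurd : ⊥
      absurd = no-fixpoint (sheet (u 0) k) (trans (cong (λ v → sheet v k) closed) (flipped (2 + m) ℕₚ.≤-refl))

    contradiction : ⊥
    contradiction with simpleLoop f (2 + m) (2 + m) ℕₚ.≤-refl 0 (cong base closed)
    ... | j , zero , _ , j≤ , eq , _ =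
          Adj⇒≢ G (f-step (subst (_≤ l) (ℕₚ.+-comm j 1) j≤)) (trans eq (cong f (ℕₚ.+-comm j 1)))
    ... | j , suc zero , _ , j≤ , eq , _ =
          no-backtrack (subst (_≤ l) (ℕₚ.+-comm j 2) j≤) (trans eq (cong f (ℕₚ.+-comm j 2)))
    ... | j , suc (suc m′) , _ , j≤ , loop@(_ , distinct) with 3 + m′ ℕ.≤? g
    ... | yes le′ = girth m′ le′ (simpleLoop⇒cycle {G} f j m′ loop (λ lt → f-step (ℕₚ.<-≤-trans lt j≤)))
    ... | no ¬le with ℕₚ.≤-antisym (ℕₚ.≤-trans (ℕₚ.m≤n+m (3 + m′) j) j≤) (ℕₚ.≤-trans le (ℕₚ.≰⇒> ¬le))
    contradiction | zero , suc (suc m′) , _ , j≤ , loop@(_ , distinct) | no ¬le | refl = Simple.absurd distinct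
    contradiction | suc j , suc (suc m′) , _ , j≤ , loop@(_ , distinct) | no ¬le | refl = ℕₚ.<⇒≱ (ℕₚ.m<n+m (3 + m′) (s≤s z≤n)) j≤

-- Start from the complete graph on `suc d` vertices: each lift raises the girth bound by one and
-- keeps the minimum degree.
highGirth : ∀ d g → Σ Graph λ G → GirthGt G g × Branching G d × V G
highGirth d zero = complete (suc d) , (λ _ ()) ,
  (λ x → Fin.punchIn x , (λ i j → Finₚ.punchIn-injective x i j) , λ i → complete-adj λ e → Finₚ.punchInᵢ≢i x i (≡-sym e)) , zero
highGirth d (suc g) with highGirth d g
... | G , girth , br , x = EdgeLift.lift G , EdgeLift.lift-girth G girth , EdgeLift.lift-branching G br , EdgeLift.place G x (λ _ → false)

-- Excluded middle from the hypothesis (*)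

pathVertex-inject₁ : ∀ {X : Set} (s : X) ms t i → pathVertex s ms t (inject₁ i) ≡ lookup (s ∷ ms) i
pathVertex-inject₁ s ms t zero    = refl
pathVertex-inject₁ s ms t (suc j) = pathVertex-internal s ms t j

chain⇒cycle : ∀ {G s} ms → Chain (Adj G) s ms s → Unique (s ∷ ms) → ∀ {m} → length ms ≡ 2 + m → Cycle G m
chain⇒cycle {G} {s} (a ∷ b ∷ ms) ch u refl = lookup (s ∷ a ∷ b ∷ ms) , Unique-lookup-injective u ,
  (λ i → subst₂ (Adj G) (pathVertex-inject₁ s (a ∷ b ∷ ms) s (inject₁ i)) (pathVertex-internal s (a ∷ b ∷ ms) s i)
           (pathVertex-adj (a ∷ b ∷ ms) ch (inject₁ i))) ,
  subst₂ (Adj G) (pathVertex-inject₁ s (a ∷ b ∷ ms) s (fromℕ _)) (pathVertex-end s (a ∷ b ∷ ms) s)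
    (pathVertex-adj (a ∷ b ∷ ms) ch (fromℕ _))

internals : ∀ {X : Set} l → (Fin (suc (suc l)) → X) → List X
internals l f = tabulate {n = l} (λ j → f (suc (inject₁ j)))

steps⇒chain : ∀ {X : Set} {R : X → X → Set} l (f : Fin (suc (suc l)) → X) →
  (∀ i → R (f (inject₁ i)) (f (suc i))) → Chain R (f zero) (internals l f) (f (fromℕ (suc l)))
steps⇒chain zero    f r = r zero
steps⇒chain (suc l) f r = r zero , steps⇒chain l (f ∘ suc) (λ i → r (suc i))

Cycle-⊆ : ∀ {G H m} → Subgraph G H → Cycle G m → Cycle H m
Cycle-⊆ (f , inj , p) (c , c-inj , step , close) =
  (λ i → f (c i)) , (λ i j e → c-inj i j (inj _ _ e)) , (λ i → p _ _ (step i)) , p _ _ close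

-- A triangle becomes a cycle of length 3 + 3p, which bounds the girth of any graph containing an
-- exact p-subdivision of a large complete graph.
module TriangleSubdivision {x : ℕ} {S : Graph} (M : TopModel (complete (3 + x)) S) (p : ℕ) (exact : ∀ e → len M e ≡ p) where

  e₀₁ e₁₂ e₀₂ : Edge (complete (3 + x))
  e₀₁ = edge zero (suc zero) (s≤s z≤n) refl
  e₁₂ = edge (suc zero) (suc (suc zero)) (s≤s (s≤s z≤n)) refl
  e₀₂ = edge zero (suc (suc zero)) (s≤s z≤n) refl

  mid : Edge (complete (3 + x)) → List (V S)
  mid e = internals (len M e) (path M e)

  ∈-mid : ∀ {e v} → v ∈ mid e → ∃[ j ] v ≡ path M e (suc (inject₁ j))
  ∈-mid = ∈ₚ.∈-tabulate⁻

  mid-chain : ∀ e → Chain (Adj S) (branch M (src e)) (mid e) (branch M (tgt e))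
  mid-chain e = subst₂ (λ a b → Chain (Adj S) a (mid e) b) (path-start M e) (path-end M e)
    (steps⇒chain (len M e) (path M e) (path-adj M e))

  mid-unique : ∀ e → Unique (mid e)
  mid-unique e = Uniqueₚ.tabulate⁺ (λ {i} {j} eq → Finₚ.inject₁-injective (Finₚ.suc-injective (path-inj M e _ _ eq)))

  branch∉mid : ∀ e a → branch M a ∉ mid e
  branch∉mid e a q = let j , eq = ∈-mid {e} q in internal-not-branch M e j a (≡-sym eq)

  mid-disjoint : ∀ e e′ {v} → v ∈ mid e → v ∈ mid e′ → src e ≡ src e′ × tgt e ≡ tgt e′
  mid-disjoint e e′ q q′ = let j , eq = ∈-mid {e} q ; j′ , eq′ = ∈-mid {e′} q′ in
    internal-disjoint M e e′ j j′ (trans (≡-sym eq) eq′)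

  length-mid : ∀ e → length (mid e) ≡ p
  length-mid e = trans (Listₚ.length-tabulate {n = len M e} _) (exact e)

  b : Fin (3 + x) → V S
  b = branch M

  b₀ b₁ b₂ : V S
  b₀ = b zero
  b₁ = b (suc zero)
  b₂ = b (suc (suc zero))

  back round : List (V S)
  back = reverse (mid e₀₂)
  round = mid e₀₁ ++ b₁ ∷ mid e₁₂ ++ b₂ ∷ back

  closed : Chain (Adj S) b₀ round b₀
  closed = chain-++ (mid e₀₁) (mid-chain e₀₁) (chain-++ (mid e₁₂) (mid-chain e₁₂)
             (chain-reverse (Adj-sym S) (mid e₀₂) (mid-chain e₀₂)))

  ∈-++∷ : ∀ {A : Set} (xs : List A) {y ys v} → v ∈ xs ++ y ∷ ys → v ∈ xs ⊎ v ≡ y ⊎ v ∈ ys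
  ∈-++∷ xs q with ∈ₚ.∈-++⁻ xs q
  ... | inj₁ i           = inj₁ i
  ... | inj₂ (here e)    = inj₂ (inj₁ e)
  ... | inj₂ (there i)   = inj₂ (inj₂ i)

  unique-++∷ : ∀ {A : Set} {xs : List A} {y ys} → Unique xs → y ∉ xs → Unique (y ∷ ys) →
               (∀ {v} → v ∈ xs → v ∉ ys) → Unique (xs ++ y ∷ ys)
  unique-++∷ u y∉ u′ dis = Uniqueₚ.++⁺ u u′ λ { (i , here refl) → y∉ i ; (i , there j) → dis i j }

  round-unique : Unique (b₀ ∷ round)
  round-unique = ∉⇒All≢ b₀∉ ∷ unique-++∷ (mid-unique e₀₁) (branch∉mid e₀₁ (suc zero))
      (∉⇒All≢ b₁∉ ∷ unique-++∷ (mid-unique e₁₂) (branch∉mid e₁₂ _)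
        (∉⇒All≢ (λ q → branch∉mid e₀₂ _ (∈-reverse⁻ q)) ∷ Unique-reverse (mid-unique e₀₂))
        λ i j → case proj₁ (mid-disjoint e₁₂ e₀₂ i (∈-reverse⁻ j)) of λ ())
      λ {v} i j → case ∈-++∷ (mid e₁₂) j of λ
        { (inj₁ k) → case proj₁ (mid-disjoint e₀₁ e₁₂ i k) of λ ()
        ; (inj₂ (inj₁ refl)) → branch∉mid e₀₁ _ i
        ; (inj₂ (inj₂ k)) → case proj₂ (mid-disjoint e₀₁ e₀₂ i (∈-reverse⁻ k)) of λ () }
    where
    b₁∉ : b₁ ∉ mid e₁₂ ++ b₂ ∷ back
    b₁∉ q with ∈-++∷ (mid e₁₂) q
    ... | inj₁ i        = branch∉mid e₁₂ _ i
    ... | inj₂ (inj₁ e) = case branch-inj M _ _ e of λ ()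
    ... | inj₂ (inj₂ i) = branch∉mid e₀₂ _ (∈-reverse⁻ i)
    b₀∉ : b₀ ∉ round
    b₀∉ q with ∈-++∷ (mid e₀₁) q
    ... | inj₁ i        = branch∉mid e₀₁ _ i
    ... | inj₂ (inj₁ e) = case branch-inj M _ _ e of λ ()
    ... | inj₂ (inj₂ r) with ∈-++∷ (mid e₁₂) r
    ... | inj₁ i        = branch∉mid e₁₂ _ i
    ... | inj₂ (inj₁ e) = case branch-inj M _ _ e of λ ()
    ... | inj₂ (inj₂ i) = branch∉mid e₀₂ _ (∈-reverse⁻ i)

  length-round : length round ≡ 2 + 3 * p
  length-round
    rewrite Listₚ.length-++ (mid e₀₁) {b₁ ∷ mid e₁₂ ++ b₂ ∷ back} | Listₚ.length-++ (mid e₁₂) {b₂ ∷ back}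
          | Listₚ.length-reverse (mid e₀₂) | length-mid e₀₁ | length-mid e₁₂ | length-mid e₀₂
    = solve 1 (λ p → p :+ (con 1 :+ (p :+ (con 1 :+ p))) := con 2 :+ con 3 :* p) refl p

  cycle : Cycle S (3 * p)
  cycle = chain⇒cycle {S} round closed round-unique length-round

src≢tgt : ∀ {G} (e : Edge G) → src e ≢ tgt e
src≢tgt e q = Finₚ.<⇒≢ (src<tgt e) q

selfSubdivision : ∀ G → IsLeSubdivision 0 G G
selfSubdivision G = record { model = model′ ; covers-vertices = λ x → inj₁ (x , refl) ; covers-edges = covers } , λ _ → z≤n
  where
  ends : Edge G → Fin 2 → V G
  ends e zero       = src e
  ends e (suc zero) = tgt e
  model′ : TopModel G G
  model′ = record
    { branch = id ; branch-inj = λ _ _ e → e ; len = λ _ → 0 ; path = ends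
    ; path-inj = λ { e zero zero _ → refl ; e zero (suc zero) q → ⊥-elim (src≢tgt e q)
                   ; e (suc zero) zero q → ⊥-elim (src≢tgt e (≡-sym q)) ; e (suc zero) (suc zero) _ → refl }
    ; path-start = λ _ → refl ; path-end = λ _ → refl ; path-adj = λ { e zero → isAdj e }
    ; internal-disjoint = λ _ _ () ; internal-not-branch = λ _ () }
  covers : ∀ x y → Adj G x y → _
  covers x y a with Finₚ.<-cmp x y
  ... | tri< lt _ _   = edge x y lt a , zero , inj₁ (refl , refl)
  ... | tri≈ _ refl _ = ⊥-elim (Adj-irrefl G a)
  ... | tri> _ _ gt   = edge y x gt (Adj-sym G a) , zero , inj₂ (refl , refl)

Cage : ℕ → Graph
Cage k = proj₁ (highGirth k k)

SubCage : Class
SubCage G = ∃[ k ] Subgraph G (Cage k)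

cageVertices : ℕ → ℕ
cageVertices zero    = 0
cageVertices (suc k) = n (Cage k) + cageVertices k

cage≤ : ∀ {k l} → k < l → n (Cage k) ≤ cageVertices l
cage≤ {k} {suc l} (s≤s k≤l) with ℕₚ.m≤n⇒m<n∨m≡n k≤l
... | inj₁ lt   = ℕₚ.≤-trans (cage≤ lt) (ℕₚ.m≤n+m _ (n (Cage l)))
... | inj₂ refl = ℕₚ.m≤m+n _ _

-- The cycle from a triangle excludes all cages of index at least 3 + 3p, and the complete graph is
-- chosen with more vertices than any of the finitely many earlier cages.
SubCage-nowhereDense : NowhereDense SubCage
SubCage-nowhereDense (p , dense) with dense (complete (3 + cageVertices (3 + 3 * p)))
... | G , (k , G⊆) , S , (sub , exact) , S⊆ with 3 + 3 * p ℕ.≤? k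
... | yes le = proj₁ (proj₂ (highGirth k k)) (3 * p) le
      (Cycle-⊆ {S} {Cage k} (Subgraph-trans {S} {G} {Cage k} S⊆ G⊆) (TriangleSubdivision.cycle (model sub) p exact))
... | no ¬le = ℕₚ.<⇒≱ (ℕₚ.≤-<-trans (cage≤ (ℕₚ.≰⇒> ¬le)) (ℕₚ.m<n+m _ {3} (s≤s z≤n))) (Finₚ.injective⇒≤ {f = f} inj)
  where
  f : Fin (3 + cageVertices (3 + 3 * p)) → V (Cage k)
  f x = proj₁ G⊆ (proj₁ S⊆ (branch (model sub) x))
  inj : ∀ {x y} → f x ≡ f y → x ≡ y
  inj e = branch-inj (model sub) _ _ (proj₁ (proj₂ S⊆) _ _ (proj₁ (proj₂ G⊆) _ _ e))

SubCage-unbounded : ¬ BoundedExpansion SubCage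
SubCage-unbounded be with be 0
... | d , bounded with highGirth (suc d) (suc d) in eq
... | G , girth , br , x = ℕₚ.<⇒≱ (ℕₚ.m<n+m (n G * d) (ℕₚ.≤-<-trans z≤n (Finₚ.toℕ<n x)))
      (ℕₚ.≤-trans (ℕₚ.≤-reflexive (≡-sym (ℕₚ.*-suc (n G) d)))
        (ℕₚ.≤-trans (branching⇒degreeSum {G} br)
          (ℕₚ.≤-trans (bounded G (G , (suc d , subst (Subgraph G) (≡-sym (cong proj₁ eq)) (Subgraph-refl {G})) , G , selfSubdivision G , Subgraph-refl {G}))
            (ℕₚ.≤-reflexive (ℕₚ.*-comm d (n G))))))

-- The hypothesis applied to SubCage × (A ⊎ ¬ A), which is not of bounded expansion since
-- A ⊎ ¬ A is irrefutable, outputs a member of this class.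
star⇒lem : StarHypothesis → (A : Set) → A ⊎ ¬ A
star⇒lem star A with star D (λ { G H ((k , G⊆) , a) H⊆ → (k , Subgraph-trans {H} {G} {Cage k} H⊆ G⊆) , a }) nowhere unbounded
  where
  D : Class
  D G = SubCage G × (A ⊎ ¬ A)
  nowhere : NowhereDense D
  nowhere (p , dense) = SubCage-nowhereDense (p , λ H → let G , (c , _) , r = dense H in G , c , r)
  unbounded : ¬ BoundedExpansion D
  unbounded be = refuted (inj₂ λ a → refuted (inj₁ a))
    where
    refuted : ¬ (A ⊎ ¬ A)
    refuted lem = SubCage-unbounded λ p → proj₁ (be p) , λ H (G , c , m) → proj₂ (be p) H (G , (c , lem) , m)
... | p , f = let _ , _ , _ , _ , _ , _ , lem = f 0 0 in lem

-- Subdivisions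

module MkGraphOn {X : Set} {m : ℕ} (to : X → Fin m) (from : Fin m → X)
  (from-to : ∀ x → from (to x) ≡ x) {R : X → X → Set}
  (R? : ∀ x y → Dec (R x y)) (R-sym : ∀ {x y} → R x y → R y x) (R-irrefl : ∀ {x} → ¬ R x x) where

  private module M = MkGraph {m} {λ a b → R (from a) (from b)} (λ a b → R? (from a) (from b)) R-sym R-irrefl
  open M public using (graph; fromAdj)

  toAdj : ∀ {x y} → R x y → Adj graph (to x) (to y)
  toAdj {x} {y} r = M.toAdj (subst₂ R (≡-sym (from-to x)) (≡-sym (from-to y)) r)

  fromAdj-to : ∀ {x y} → Adj graph (to x) (to y) → R x y
  fromAdj-to {x} {y} a = subst₂ R (from-to x) (from-to y) (fromAdj a)

  to-injective : ∀ {x y} → to x ≡ to y → x ≡ y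
  to-injective {x} {y} e = trans (≡-sym (from-to x)) (trans (cong from e) (from-to y))

bool-ext : ∀ {a b : Bool} → (a ≡ true → b ≡ true) → (b ≡ true → a ≡ true) → a ≡ b
bool-ext {true}  {_}     f g = ≡-sym (f refl)
bool-ext {false} {true}  f g = g refl
bool-ext {false} {false} f g = refl

edge-≡ : ∀ {H} {e e′ : Edge H} → src e ≡ src e′ → tgt e ≡ tgt e′ → e ≡ e′
edge-≡ {e = edge s t lt a} {edge _ _ lt′ a′} refl refl =
  cong₂ (edge s t) (ℕₚ.≤-irrelevant lt lt′) (Decidable⇒UIP.≡-irrelevant _≟ᵇ_ a a′)

anyEdge? : ∀ {H} {P : Edge H → Set} → (∀ e → Dec (P e)) → Dec (∃ P)
anyEdge? {H} {P} P? = map′ (λ (s , t , lt , a , p) → edge s t lt a , p) (λ (edge s t lt a , p) → s , t , lt , a , p)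
  (Finₚ.any? λ s → Finₚ.any? λ t → find-edge s t)
  where
  find-edge : ∀ s t → Dec (Σ (s Fin.< t) λ lt → Σ (Adj H s t) λ a → P (edge s t lt a))
  find-edge s t with s Fin.<? t | Adj? H s t
  ... | no ¬lt | _ = no λ (lt , _) → ¬lt lt
  ... | yes _ | no ¬a = no λ (_ , a , _) → ¬a a
  ... | yes lt | yes a = map′ (λ p → lt , a , p) (λ (lt′ , a′ , p) → subst P (edge-≡ refl refl) p) (P? (edge s t lt a))

data Last {l : ℕ} : Fin (suc l) → Set where
  last : Last (fromℕ l)
  inj  : ∀ j → Last (inject₁ j)

last? : ∀ {l} (i : Fin (suc l)) → Last i
last? {zero}  zero    = last
last? {suc l} zero    = inj zero
last? {suc l} (suc i) with last? i
... | last  = last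
... | inj j = inj (suc j)

-- Subdivides once exactly the edges satisfying `F`. It serves both to destroy the edges outside a
-- given subgraph and to lengthen the paths of a subdivision by one.
module EdgeSubdivision (G : Graph) (F : V G → V G → Set) (F? : ∀ x y → Dec (F x y))
  (F-sym : ∀ {x y} → F x y → F y x) where

  Cut : V G × V G → Set
  Cut (u , v) = (u Fin.< v) × Adj G u v × F u v

  cut? : ∀ e → Dec (Cut e)
  cut? (u , v) = (u Fin.<? v) ×-dec Adj? G u v ×-dec F? u v

  pairs cuts : List (V G × V G)
  pairs = cartesianProduct (allFin (n G)) (allFin (n G))
  cuts = filter cut? pairs

  ∈-pairs : ∀ {u v} → (u , v) ∈ pairs
  ∈-pairs = ∈ₚ.∈-cartesianProduct⁺ (∈ₚ.∈-allFin _) (∈ₚ.∈-allFin _)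

  cuts-unique : Unique cuts
  cuts-unique = Uniqueₚ.filter⁺ cut? (Uniqueₚ.cartesianProduct⁺ (Uniqueₚ.allFin⁺ (n G)) (Uniqueₚ.allFin⁺ (n G)))

  New X : Set
  New = Fin (length cuts)
  X = V G ⊎ New

  low high : New → V G
  low k = proj₁ (lookup cuts k)
  high k = proj₂ (lookup cuts k)

  cut : ∀ k → Cut (low k , high k)
  cut k = proj₂ (∈ₚ.∈-filter⁻ cut? {xs = pairs} (∈ₚ.∈-lookup k))

  Ends : New → V G → V G → Set
  Ends k x y = (low k ≡ x × high k ≡ y) ⊎ (low k ≡ y × high k ≡ x)

  ends-unique : ∀ {k k′ x y} → Ends k x y → Ends k′ x y → k ≡ k′
  ends-unique {k} {k′} p q = Unique-lookup-injective cuts-unique k k′ (go p q)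
    where
    go : ∀ {x y} → Ends k x y → Ends k′ x y → lookup cuts k ≡ lookup cuts k′
    go (inj₁ (a , b)) (inj₁ (c , d)) = cong₂ _,_ (trans a (≡-sym c)) (trans b (≡-sym d))
    go (inj₂ (a , b)) (inj₂ (c , d)) = cong₂ _,_ (trans a (≡-sym c)) (trans b (≡-sym d))
    go (inj₁ (refl , refl)) (inj₂ (c , d)) = ⊥-elim (ℕₚ.<-asym (proj₁ (cut k)) (subst₂ Fin._<_ c d (proj₁ (cut k′))))
    go (inj₂ (refl , refl)) (inj₁ (c , d)) = ⊥-elim (ℕₚ.<-asym (proj₁ (cut k)) (subst₂ Fin._<_ c d (proj₁ (cut k′))))

  middle : ∀ {x y} → Adj G x y → F x y → ∃[ k ] Ends k x y
  middle {x} {y} a f with Finₚ.<-cmp x y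
  ... | tri≈ _ refl _ = ⊥-elim (Adj-irrefl G a)
  ... | tri< lt _ _ = let k , e = ∈⇒lookup (∈ₚ.∈-filter⁺ cut? ∈-pairs (lt , a , f)) in
        k , inj₁ (cong proj₁ e , cong proj₂ e)
  ... | tri> _ _ gt = let k , e = ∈⇒lookup (∈ₚ.∈-filter⁺ cut? ∈-pairs (gt , Adj-sym G a , F-sym f)) in
        k , inj₂ (cong proj₁ e , cong proj₂ e)

  R : X → X → Set
  R (inj₁ x) (inj₁ y) = Adj G x y × ¬ F x y
  R (inj₁ x) (inj₂ k) = low k ≡ x ⊎ high k ≡ x
  R (inj₂ k) (inj₁ x) = low k ≡ x ⊎ high k ≡ x
  R (inj₂ _) (inj₂ _) = ⊥

  R? : ∀ x y → Dec (R x y)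
  R? (inj₁ x) (inj₁ y) = Adj? G x y ×-dec ¬? (F? x y)
  R? (inj₁ x) (inj₂ k) = (low k Fin.≟ x) ⊎-dec (high k Fin.≟ x)
  R? (inj₂ k) (inj₁ x) = (low k Fin.≟ x) ⊎-dec (high k Fin.≟ x)
  R? (inj₂ _) (inj₂ _) = no λ ()

  R-sym : ∀ {x y} → R x y → R y x
  R-sym {inj₁ x} {inj₁ y} (a , ¬f) = Adj-sym G a , λ f → ¬f (F-sym f)
  R-sym {inj₁ x} {inj₂ k} r = r
  R-sym {inj₂ k} {inj₁ x} r = r

  R-irrefl : ∀ {x} → ¬ R x x
  R-irrefl {inj₁ x} (a , _) = Adj-irrefl G a

  code : X → Fin (n G + length cuts)
  code = Fin.join (n G) (length cuts)

  decode′ : Fin (n G + length cuts) → X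
  decode′ = Fin.splitAt (n G)

  module Sub = MkGraphOn code decode′ (Finₚ.splitAt-join (n G) (length cuts)) {R} R? (λ {x} {y} → R-sym {x} {y}) (λ {x} → R-irrefl {x})

  code-decode : ∀ a → code (decode′ a) ≡ a
  code-decode = Finₚ.join-splitAt (n G) (length cuts)

  -- Lengths and paths are defined for an arbitrary decision, so that matching on it makes the index
  -- type of the path compute.
  lenᵈ : ∀ {A : Set} → Dec A → ℕ
  lenᵈ (yes _) = 1
  lenᵈ (no _)  = 0

  pathᵈ : (e : Edge G) (d : Dec (F (src e) (tgt e))) → Fin (suc (suc (lenᵈ d))) → X
  pathᵈ e (yes f) zero             = inj₁ (src e)
  pathᵈ e (yes f) (suc zero)       = inj₂ (proj₁ (middle (isAdj e) f))
  pathᵈ e (yes f) (suc (suc zero)) = inj₁ (tgt e)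
  pathᵈ e (no _)  zero             = inj₁ (src e)
  pathᵈ e (no _)  (suc zero)       = inj₁ (tgt e)

  pathᵈ-inj : ∀ e d → Injective (pathᵈ e d)
  pathᵈ-inj e (yes f) zero zero _ = refl
  pathᵈ-inj e (yes f) zero (suc (suc zero)) q = ⊥-elim (src≢tgt e (Sumₚ.inj₁-injective q))
  pathᵈ-inj e (yes f) (suc zero) (suc zero) _ = refl
  pathᵈ-inj e (yes f) (suc zero) (suc (suc zero)) ()
  pathᵈ-inj e (yes f) (suc (suc zero)) zero q = ⊥-elim (src≢tgt e (≡-sym (Sumₚ.inj₁-injective q)))
  pathᵈ-inj e (yes f) (suc (suc zero)) (suc (suc zero)) _ = refl
  pathᵈ-inj e (no _) zero zero _ = refl
  pathᵈ-inj e (no _) zero (suc zero) q = ⊥-elim (src≢tgt e (Sumₚ.inj₁-injective q))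
  pathᵈ-inj e (no _) (suc zero) zero q = ⊥-elim (src≢tgt e (≡-sym (Sumₚ.inj₁-injective q)))
  pathᵈ-inj e (no _) (suc zero) (suc zero) _ = refl

  endsˡ : ∀ {k x y} → Ends k x y → low k ≡ x ⊎ high k ≡ x
  endsˡ (inj₁ (e , _)) = inj₁ e
  endsˡ (inj₂ (_ , e)) = inj₂ e

  endsʳ : ∀ {k x y} → Ends k x y → low k ≡ y ⊎ high k ≡ y
  endsʳ (inj₁ (_ , e)) = inj₂ e
  endsʳ (inj₂ (e , _)) = inj₁ e

  pathᵈ-adj : ∀ e d i → R (pathᵈ e d (inject₁ i)) (pathᵈ e d (suc i))
  pathᵈ-adj e (yes f) zero       = endsˡ (proj₂ (middle (isAdj e) f))
  pathᵈ-adj e (yes f) (suc zero) = endsʳ (proj₂ (middle (isAdj e) f))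
  pathᵈ-adj e (no ¬f) zero       = isAdj e , ¬f

  internalᵈ : ∀ e d j → ∃[ k ] (Ends k (src e) (tgt e) × pathᵈ e d (suc (inject₁ j)) ≡ inj₂ k)
  internalᵈ e (yes f) zero = let k , p = middle (isAdj e) f in k , p , refl

  startᵈ : ∀ e d → pathᵈ e d zero ≡ inj₁ (src e)
  startᵈ e (yes _) = refl
  startᵈ e (no _)  = refl

  endᵈ : ∀ e d → pathᵈ e d (fromℕ (suc (lenᵈ d))) ≡ inj₁ (tgt e)
  endᵈ e (yes _) = refl
  endᵈ e (no _)  = refl

  decision : ∀ (e : Edge G) → Dec (F (src e) (tgt e))
  decision e = F? (src e) (tgt e)

  model′ : TopModel G Sub.graph
  model′ = record
    { branch = λ x → code (inj₁ x)
    ; branch-inj = λ x y e → Sumₚ.inj₁-injective (Sub.to-injective {inj₁ x} {inj₁ y} e)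
    ; len = λ e → lenᵈ (decision e)
    ; path = λ e i → code (pathᵈ e (decision e) i)
    ; path-inj = λ e i j q → pathᵈ-inj e (decision e) i j (Sub.to-injective q)
    ; path-start = λ e → cong code (startᵈ e (decision e))
    ; path-end = λ e → cong code (endᵈ e (decision e))
    ; path-adj = λ e i → Sub.toAdj {pathᵈ e (decision e) (inject₁ i)} (pathᵈ-adj e (decision e) i)
    ; internal-disjoint = disjoint
    ; internal-not-branch = λ e j a q → let k , _ , p = internalᵈ e (decision e) j in
        new≢old (trans (≡-sym p) (Sub.to-injective {pathᵈ e (decision e) (suc (inject₁ j))} {inj₁ a} q))
    }
    where
    new≢old : ∀ {k v} → inj₂ k ≢ inj₁ v
    new≢old ()
    same-ends : ∀ {k} {e e′ : Edge G} → Ends k (src e) (tgt e) → Ends k (src e′) (tgt e′) → src e ≡ src e′ × tgt e ≡ tgt e′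
    same-ends (inj₁ (a , b)) (inj₁ (c , d)) = trans (≡-sym a) c , trans (≡-sym b) d
    same-ends (inj₂ (a , b)) (inj₂ (c , d)) = trans (≡-sym b) d , trans (≡-sym a) c
    same-ends {e = e} {e′} (inj₁ (refl , refl)) (inj₂ (c , d)) = ⊥-elim (ℕₚ.<-asym (src<tgt e) (subst₂ Fin._<_ (≡-sym d) (≡-sym c) (src<tgt e′)))
    same-ends {e = e} {e′} (inj₂ (refl , refl)) (inj₁ (c , d)) = ⊥-elim (ℕₚ.<-asym (src<tgt e) (subst₂ Fin._<_ (≡-sym c) (≡-sym d) (src<tgt e′)))
    disjoint : ∀ e e′ j j′ → code (pathᵈ e (decision e) (suc (inject₁ j))) ≡ code (pathᵈ e′ (decision e′) (suc (inject₁ j′))) → src e ≡ src e′ × tgt e ≡ tgt e′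
    disjoint e e′ j j′ q with internalᵈ e (decision e) j | internalᵈ e′ (decision e′) j′
    ... | k , p , r | k′ , p′ , r′ with trans (≡-sym r) (trans (Sub.to-injective {pathᵈ e (decision e) (suc (inject₁ j))} {pathᵈ e′ (decision e′) (suc (inject₁ j′))} q) r′)
    ... | refl = same-ends {e = e} {e′} p p′

  subdivides : IsSubdivision G Sub.graph
  subdivides = record { model = model′
    ; covers-vertices = λ a → covV a (decode′ a) (code-decode a)
    ; covers-edges = λ a b adj → covE a b (decode′ a) (decode′ b) (code-decode a) (code-decode b) (Sub.fromAdj adj) }
    where
    cutEdge : ∀ k → Edge G
    cutEdge k = edge (low k) (high k) (proj₁ (cut k)) (proj₁ (proj₂ (cut k)))
    internal : ∀ k d → ∃[ j ] pathᵈ (cutEdge k) d (suc (inject₁ j)) ≡ inj₂ k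
    internal k (yes f) = zero , cong inj₂ (ends-unique {_} {k} (proj₂ (middle (isAdj (cutEdge k)) f)) (inj₁ (refl , refl)))
    internal k (no ¬f) = ⊥-elim (¬f (proj₂ (proj₂ (cut k))))
    covV : ∀ a x → code x ≡ a → (∃[ v ] code (inj₁ v) ≡ a) ⊎
           (∃[ e ] ∃[ j ] code (pathᵈ e (decision e) (suc (inject₁ j))) ≡ a)
    covV a (inj₁ x) e = inj₁ (x , e)
    covV a (inj₂ k) e = inj₂ (cutEdge k , let j , p = internal k (decision (cutEdge k)) in j , trans (cong code p) e)
    firstᵈ : ∀ k d → ∃[ i ] (pathᵈ (cutEdge k) d (inject₁ i) ≡ inj₁ (low k) × pathᵈ (cutEdge k) d (suc i) ≡ inj₂ k)
    firstᵈ k d@(yes f) = zero , refl , proj₂ (internal k d)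
    firstᵈ k (no ¬f) = ⊥-elim (¬f (proj₂ (proj₂ (cut k))))
    secondᵈ : ∀ k d → ∃[ i ] (pathᵈ (cutEdge k) d (inject₁ i) ≡ inj₂ k × pathᵈ (cutEdge k) d (suc i) ≡ inj₁ (high k))
    secondᵈ k d@(yes f) = suc zero , proj₂ (internal k d) , refl
    secondᵈ k (no ¬f) = ⊥-elim (¬f (proj₂ (proj₂ (cut k))))
    keptᵈ : ∀ e d → ¬ F (src e) (tgt e) → ∃[ i ] (pathᵈ e d (inject₁ i) ≡ inj₁ (src e) × pathᵈ e d (suc i) ≡ inj₁ (tgt e))
    keptᵈ e (yes f) ¬f = ⊥-elim (¬f f)
    keptᵈ e (no _)  ¬f = zero , refl , refl
    covE : ∀ a b x y → code x ≡ a → code y ≡ b → R x y →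
      ∃[ e ] ∃[ i ] ((code (pathᵈ e (decision e) (inject₁ i)) ≡ a × code (pathᵈ e (decision e) (suc i)) ≡ b) ⊎
                     (code (pathᵈ e (decision e) (inject₁ i)) ≡ b × code (pathᵈ e (decision e) (suc i)) ≡ a))
    covE a b (inj₁ x) (inj₁ y) p q (adj , ¬f) with Finₚ.<-cmp x y
    ... | tri≈ _ refl _ = ⊥-elim (Adj-irrefl G adj)
    ... | tri< lt _ _ = let e = edge x y lt adj ; i , r , s = keptᵈ e (decision e) ¬f in
          e , i , inj₁ (trans (cong code r) p , trans (cong code s) q)
    ... | tri> _ _ gt = let e = edge y x gt (Adj-sym G adj) ; i , r , s = keptᵈ e (decision e) (λ f → ¬f (F-sym f)) in
          e , i , inj₂ (trans (cong code r) q , trans (cong code s) p)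
    covE a b (inj₁ x) (inj₂ k) p q (inj₁ refl) = let i , r , s = firstᵈ k (decision (cutEdge k)) in
          cutEdge k , i , inj₁ (trans (cong code r) p , trans (cong code s) q)
    covE a b (inj₁ x) (inj₂ k) p q (inj₂ refl) = let i , r , s = secondᵈ k (decision (cutEdge k)) in
          cutEdge k , i , inj₂ (trans (cong code r) q , trans (cong code s) p)
    covE a b (inj₂ k) (inj₁ x) p q (inj₁ refl) = let i , r , s = firstᵈ k (decision (cutEdge k)) in
          cutEdge k , i , inj₂ (trans (cong code r) q , trans (cong code s) p)
    covE a b (inj₂ k) (inj₁ x) p q (inj₂ refl) = let i , r , s = secondᵈ k (decision (cutEdge k)) in
          cutEdge k , i , inj₁ (trans (cong code r) p , trans (cong code s) q)

-- Subdividing the edges of G outside H leaves H as an induced subgraph.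
hereditary⇒monotone : ∀ {C} → Hereditary C → TopologicallyClosed C → Monotone C
hereditary⇒monotone hered closed G H G∈C (f , f-inj , f-adj) =
  hered Sub.graph H (closed G Sub.graph G∈C subdivides) ((λ x → code (inj₁ (f x))) ,
    (λ x y e → f-inj x y (Sumₚ.inj₁-injective (Sub.to-injective {inj₁ (f x)} {inj₁ (f y)} e))) , λ x y → bool-ext
      (λ a → Sub.toAdj {inj₁ (f x)} {inj₁ (f y)} (f-adj x y a , λ ¬h → ¬h (x , y , refl , refl , a)))
      λ a → let _ , ¬¬h = Sub.fromAdj-to {inj₁ (f x)} {inj₁ (f y)} a in back (decidable-stable (hit? (f x) (f y)) ¬¬h))
  where
  Hit : V G → V G → Set
  Hit u v = ∃[ x ] ∃[ y ] (f x ≡ u × f y ≡ v × Adj H x y)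
  hit? : ∀ u v → Dec (Hit u v)
  hit? u v = Finₚ.any? λ x → Finₚ.any? λ y → (f x Fin.≟ u) ×-dec (f y Fin.≟ v) ×-dec Adj? H x y
  back : ∀ {x y} → Hit (f x) (f y) → Adj H x y
  back (x′ , y′ , p , q , a) = subst₂ (Adj H) (f-inj _ _ p) (f-inj _ _ q) a
  open EdgeSubdivision G (λ u v → ¬ Hit u v) (λ u v → ¬? (hit? u v))
    (λ ¬h (x , y , p , q , a) → ¬h (y , x , q , p , Adj-sym H a))

-- Only the first edge of the path replacing each edge of G is subdivided.
module Lengthen {G S : Graph} (sub : IsSubdivision G S) where

  M : TopModel G S
  M = model sub

  first second : Edge G → V S
  first e  = path M e zero
  second e = path M e (suc zero)

  Starts : V S → V S → Edge G → Set
  Starts x y e = (first e ≡ x × second e ≡ y) ⊎ (first e ≡ y × second e ≡ x)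

  F : V S → V S → Set
  F x y = ∃ (Starts x y)

  F? : ∀ x y → Dec (F x y)
  F? x y = anyEdge? {G} λ e → ((first e Fin.≟ x) ×-dec (second e Fin.≟ y)) ⊎-dec ((first e Fin.≟ y) ×-dec (second e Fin.≟ x))

  F-sym : ∀ {x y} → F x y → F y x
  F-sym (e , inj₁ p) = e , inj₂ p
  F-sym (e , inj₂ p) = e , inj₁ p

  open EdgeSubdivision S F F? F-sym hiding (model′)

  inner : ∀ e → Fin (len M e) → V S
  inner e j = path M e (suc (inject₁ j))

  locate : ∀ e i → path M e (suc i) ≡ branch M (tgt e) ⊎ (∃[ j ] path M e (suc i) ≡ inner e j)
  locate e i with last? i
  ... | last  = inj₁ (path-end M e)
  ... | inj j = inj₂ (j , refl)

  order : ∀ {e e′ : Edge G} → tgt e ≡ src e′ → src e ≢ tgt e′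
  order {e} {e′} p q = ℕₚ.<-asym (src<tgt e) (subst₂ Fin._<_ (≡-sym p) (≡-sym q) (src<tgt e′))

  second-branch : ∀ e {a} → second e ≡ branch M a → tgt e ≡ a
  second-branch e q with locate e zero
  ... | inj₁ p       = branch-inj M _ _ (trans (≡-sym p) q)
  ... | inj₂ (j , p) = ⊥-elim (internal-not-branch M e j _ (trans (≡-sym p) q))

  -- Paths run from the smaller to the larger end. Two paths beginning with the same edge in
  -- opposite directions would each consist of that edge, with source and target exchanged.
  starts-unique : ∀ {x y e e′} → Starts x y e → Starts x y e′ → src e ≡ src e′ × tgt e ≡ tgt e′
  starts-unique {e = e} {e′} (inj₁ (refl , refl)) (inj₁ (p , q)) = parallel (≡-sym p) (≡-sym q)
    where
    parallel : first e ≡ first e′ → second e ≡ second e′ → _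
    parallel p q with locate e zero | locate e′ zero
    ... | inj₂ (j , r) | inj₂ (j′ , r′) = internal-disjoint M e e′ j j′ (trans (≡-sym r) (trans q r′))
    ... | inj₁ r | _ = branch-inj M _ _ (trans (≡-sym (path-start M e)) (trans p (path-start M e′))) ,
                       ≡-sym (second-branch e′ (trans (≡-sym q) r))
    ... | inj₂ _ | inj₁ r = branch-inj M _ _ (trans (≡-sym (path-start M e)) (trans p (path-start M e′))) ,
                            second-branch e (trans q r)
  starts-unique {e = e} {e′} (inj₂ (refl , refl)) (inj₂ (p , q)) = starts-unique {e = e} {e′} (inj₁ (refl , refl)) (inj₁ (p , q))
  starts-unique {e = e} {e′} (inj₁ (refl , refl)) (inj₂ (p , q)) = ⊥-elim (order {e} {e′}
    (second-branch e (trans (≡-sym p) (path-start M e′))) (≡-sym (second-branch e′ (trans q (path-start M e)))))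
  starts-unique {e = e} {e′} (inj₂ (refl , refl)) (inj₁ (p , q)) = ⊥-elim (order {e} {e′}
    (second-branch e (trans (≡-sym p) (path-start M e′))) (≡-sym (second-branch e′ (trans q (path-start M e)))))

  kink : ∀ e → ∃[ k ] Ends k (first e) (second e)
  kink e = middle (path-adj M e zero) (e , inj₁ (refl , refl))

  starts-kink : ∀ e {k} → k ≡ proj₁ (kink e) → Starts (low k) (high k) e
  starts-kink e refl with proj₂ (kink e)
  ... | inj₁ (p , q) = inj₁ (≡-sym p , ≡-sym q)
  ... | inj₂ (p , q) = inj₂ (≡-sym q , ≡-sym p)

  vertex : ∀ e → Fin (suc (suc (suc (len M e)))) → X
  vertex e zero          = inj₁ (first e)
  vertex e (suc zero)    = inj₂ (proj₁ (kink e))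
  vertex e (suc (suc i)) = inj₁ (path M e (suc i))

  vertex-inj : ∀ e → Injective (vertex e)
  vertex-inj e zero          zero          q = refl
  vertex-inj e zero          (suc (suc j)) q = case path-inj M e _ _ (Sumₚ.inj₁-injective q) of λ ()
  vertex-inj e (suc zero)    (suc zero)    q = refl
  vertex-inj e (suc (suc i)) zero          q = case path-inj M e _ _ (Sumₚ.inj₁-injective q) of λ ()
  vertex-inj e (suc (suc i)) (suc (suc j)) q = cong suc (path-inj M e _ _ (Sumₚ.inj₁-injective q))

  later-kept : ∀ e j → ¬ F (inner e j) (path M e (suc (suc j)))
  later-kept e j (e′ , inj₁ (p , q)) = internal-not-branch M e j _ (trans (≡-sym p) (path-start M e′))
  later-kept e j (e′ , inj₂ (p , q)) with locate e′ zero
  ... | inj₁ r = internal-not-branch M e j _ (trans (≡-sym q) r)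
  ... | inj₂ (j′ , r) with internal-disjoint M e′ e j′ j (trans (≡-sym r) q)
  ... | s≡ , t≡ with edge-≡ {G} {e′} {e} s≡ t≡
  ... | refl = case path-inj M e _ _ p of λ ()

  vertex-adj : ∀ e i → R (vertex e (inject₁ i)) (vertex e (suc i))
  vertex-adj e zero          = endsˡ (proj₂ (kink e))
  vertex-adj e (suc zero)    = endsʳ (proj₂ (kink e))
  vertex-adj e (suc (suc j)) = path-adj M e (suc j) , later-kept e j

  longer : TopModel G Sub.graph
  longer = record
    { branch = λ a → code (inj₁ (branch M a))
    ; branch-inj = λ a b q → branch-inj M a b (Sumₚ.inj₁-injective (Sub.to-injective {inj₁ (branch M a)} {inj₁ (branch M b)} q))
    ; len = λ e → suc (len M e)
    ; path = λ e i → code (vertex e i)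
    ; path-inj = λ e i j q → vertex-inj e i j (Sub.to-injective {vertex e i} {vertex e j} q)
    ; path-start = λ e → cong (code ∘ inj₁) (path-start M e)
    ; path-end = λ e → cong (code ∘ inj₁) (path-end M e)
    ; path-adj = λ e i → Sub.toAdj {vertex e (inject₁ i)} {vertex e (suc i)} (vertex-adj e i)
    ; internal-disjoint = λ e e′ j j′ q → disjoint e e′ j j′
        (Sub.to-injective {vertex e (suc (inject₁ j))} {vertex e′ (suc (inject₁ j′))} q)
    ; internal-not-branch = λ e j a q → not-branch e j a (Sub.to-injective {vertex e (suc (inject₁ j))} {inj₁ (branch M a)} q)
    }
    where
    disjoint : ∀ e e′ j j′ → vertex e (suc (inject₁ j)) ≡ vertex e′ (suc (inject₁ j′)) → src e ≡ src e′ × tgt e ≡ tgt e′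
    disjoint e e′ zero    zero     q = starts-unique {e = e} {e′} (starts-kink e refl) (starts-kink e′ (Sumₚ.inj₂-injective q))
    disjoint e e′ (suc j) (suc j′) q = internal-disjoint M e e′ j j′ (Sumₚ.inj₁-injective q)
    not-branch : ∀ e j a → vertex e (suc (inject₁ j)) ≢ inj₁ (branch M a)
    not-branch e zero    a ()
    not-branch e (suc j) a q = internal-not-branch M e j a (Sumₚ.inj₁-injective q)

  longer-subdivides : IsSubdivision G Sub.graph
  longer-subdivides = record { model = longer
    ; covers-vertices = λ a → covV a (decode′ a) (code-decode a)
    ; covers-edges = λ a b adj → covE a b (decode′ a) (decode′ b) (code-decode a) (code-decode b) (Sub.fromAdj adj) }
    where
    kink-of : ∀ k → ∃[ e ] (Starts (low k) (high k) e × proj₁ (kink e) ≡ k)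
    kink-of k with cut k
    ... | _ , _ , e , inj₁ (p , q) = e , inj₁ (p , q) , ends-unique (proj₂ (kink e)) (inj₁ (≡-sym p , ≡-sym q))
    ... | _ , _ , e , inj₂ (p , q) = e , inj₂ (p , q) , ends-unique (proj₂ (kink e)) (inj₂ (≡-sym q , ≡-sym p))
    covV : ∀ a x → code x ≡ a → (∃[ v ] code (inj₁ (branch M v)) ≡ a) ⊎
           (∃[ e ] ∃[ j ] code (vertex e (suc (inject₁ j))) ≡ a)
    covV a (inj₁ x) q with covers-vertices sub x
    ... | inj₁ (v , refl)     = inj₁ (v , q)
    ... | inj₂ (e , j , refl) = inj₂ (e , suc j , q)
    covV a (inj₂ k) q = let e , _ , r = kink-of k in inj₂ (e , zero , trans (cong (code ∘ inj₂) r) q)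
    Joined : Fin (n Sub.graph) → Fin (n Sub.graph) → Set
    Joined a b = ∃[ e ] ∃[ i ] ((code (vertex e (inject₁ i)) ≡ a × code (vertex e (suc i)) ≡ b) ⊎
                                (code (vertex e (inject₁ i)) ≡ b × code (vertex e (suc i)) ≡ a))
    swap : ∀ {a b} → Joined a b → Joined b a
    swap (e , i , inj₁ p) = e , i , inj₂ p
    swap (e , i , inj₂ p) = e , i , inj₁ p
    half : ∀ k x → low k ≡ x ⊎ high k ≡ x → Joined (code (inj₁ x)) (code (inj₂ k))
    half k x r with kink-of k
    half k x (inj₁ refl) | e , inj₁ (p , q) , eq = e , zero     , inj₁ (cong (code ∘ inj₁) p , cong (code ∘ inj₂) eq)
    half k x (inj₂ refl) | e , inj₁ (p , q) , eq = e , suc zero , inj₂ (cong (code ∘ inj₂) eq , cong (code ∘ inj₁) q)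
    half k x (inj₁ refl) | e , inj₂ (p , q) , eq = e , suc zero , inj₂ (cong (code ∘ inj₂) eq , cong (code ∘ inj₁) q)
    half k x (inj₂ refl) | e , inj₂ (p , q) , eq = e , zero     , inj₁ (cong (code ∘ inj₁) p , cong (code ∘ inj₂) eq)
    covE : ∀ a b x y → code x ≡ a → code y ≡ b → R x y → Joined a b
    covE a b (inj₁ x) (inj₂ k) refl refl r = half k x r
    covE a b (inj₂ k) (inj₁ x) refl refl r = swap (half k x r)
    covE a b (inj₁ x) (inj₁ y) refl refl (adj , ¬f) with covers-edges sub x y adj
    ... | e , zero  , inj₁ (refl , refl) = ⊥-elim (¬f (e , inj₁ (refl , refl)))
    ... | e , zero  , inj₂ (refl , refl) = ⊥-elim (¬f (e , inj₂ (refl , refl)))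
    ... | e , suc i , inj₁ (refl , refl) = e , suc (suc i) , inj₁ (refl , refl)
    ... | e , suc i , inj₂ (refl , refl) = e , suc (suc i) , inj₂ (refl , refl)

lengthen : ∀ {C} → TopologicallyClosed C → ∀ {p G S} → C S → IsExactSubdivision p G S →
           ∃[ S′ ] (C S′ × IsExactSubdivision (suc p) G S′)
lengthen closed {S = S} S∈C (sub , exact) = Sub.graph , closed S Sub.graph S∈C subdivides , longer-subdivides , λ e → cong suc (exact e)
  where
  open Lengthen sub
  open EdgeSubdivision S F F? F-sym using (subdivides; module Sub)

-- Maps out of subdivisions.

module MapOut {G S : Graph} (sub : IsSubdivision G S) {Y : Set} (onBranch : V G → Y)
  (onPath : ∀ e → Fin (suc (suc (len (model sub) e))) → Y)
  (start : ∀ e → onPath e zero ≡ onBranch (src e))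
  (end : ∀ e → onPath e (fromℕ (suc (len (model sub) e))) ≡ onBranch (tgt e)) where

  private
    M : TopModel G S
    M = model sub

    Cover : V S → Set
    Cover x = (∃[ a ] branch M a ≡ x) ⊎ (∃[ e ] ∃[ j ] path M e (suc (inject₁ {len M e} j)) ≡ x)

  value : ∀ {x} → Cover x → Y
  value (inj₁ (a , _))     = onBranch a
  value (inj₂ (e , j , _)) = onPath e (suc (inject₁ j))

  out : V S → Y
  out x = value (covers-vertices sub x)

  out-branch : ∀ a → out (branch M a) ≡ onBranch a
  out-branch a with covers-vertices sub (branch M a)
  ... | inj₁ (b , p)     = cong onBranch (branch-inj M b a p)
  ... | inj₂ (e , j , p) = ⊥-elim (internal-not-branch M e j a p)

  out-inner : ∀ e j → out (path M e (suc (inject₁ j))) ≡ onPath e (suc (inject₁ j))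
  out-inner e j with covers-vertices sub (path M e (suc (inject₁ j)))
  ... | inj₁ (b , p) = ⊥-elim (internal-not-branch M e j b (≡-sym p))
  ... | inj₂ (e′ , j′ , p) with internal-disjoint M e′ e j′ j p
  ... | s≡ , t≡ with edge-≡ {G} {e′} {e} s≡ t≡
  ... | refl = cong (onPath e) (path-inj M e _ _ p)

  -- The description of a vertex found by `covers-vertices` may come from anywhere; the disjointness
  -- conditions and agreement at the branch vertices make the value independent of it.
  out-path : ∀ e i → out (path M e i) ≡ onPath e i
  out-path e zero = trans (cong out (path-start M e)) (trans (out-branch (src e)) (≡-sym (start e)))
  out-path e (suc i) with last? i
  ... | last  = trans (cong out (path-end M e)) (trans (out-branch (tgt e)) (≡-sym (end e)))
  ... | inj j = out-inner e j

  out-adj : ∀ {R : Y → Y → Set} → (∀ {x y} → R x y → R y x) → (∀ e i → R (onPath e (inject₁ i)) (onPath e (suc i))) →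
            ∀ {x y} → Adj S x y → R (out x) (out y)
  out-adj {R} R-sym step {x} {y} a with covers-edges sub x y a
  ... | e , i , inj₁ (refl , refl) = subst₂ R (≡-sym (out-path e (inject₁ i))) (≡-sym (out-path e (suc i))) (step e i)
  ... | e , i , inj₂ (refl , refl) = R-sym (subst₂ R (≡-sym (out-path e (inject₁ i))) (≡-sym (out-path e (suc i))) (step e i))

even : ℕ → Bool
even zero    = true
even (suc l) = not (even l)

even-double : ∀ k → even (k + k) ≡ true
even-double zero = refl
even-double (suc k) rewrite ℕₚ.+-suc k k | even-double k = refl

-- Along a path of odd length, alternating the two ends is a homomorphism.
evenSubdivision⇒hom : ∀ {k G S} → IsExactSubdivision (k + k) G S → S ⟶ G
evenSubdivision⇒hom {k} {G} {S} (sub , exact) = out , λ x y → out-adj {Adj G} (Adj-sym G) step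
  where
  M = model sub
  side : Edge G → Bool → V G
  side e b = if b then src e else tgt e
  onPath : ∀ e → Fin (suc (suc (len M e))) → V G
  onPath e i = side e (even (toℕ i))
  end : ∀ e → onPath e (fromℕ (suc (len M e))) ≡ tgt e
  end e rewrite Finₚ.toℕ-fromℕ (len M e) | exact e | even-double k = refl
  step : ∀ e i → Adj G (onPath e (inject₁ i)) (onPath e (suc i))
  step e i rewrite Finₚ.toℕ-inject₁ i with even (toℕ i)
  ... | true  = isAdj e
  ... | false = Adj-sym G (isAdj e)
  open MapOut sub id onPath (λ _ → refl) end

-- The homomorphism is restricted to branch vertices. Equal images of adjacent vertices would turn
-- the path between them into a closed walk of length 2k + 1 in `H`.
evenSubdivision-colourable : ∀ {k G S H q} → IsExactSubdivision (k + k) G S → OddWalkFree H q → suc (k + k) ≤ q →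
                             S ⟶ H → Colorable G (n H)
evenSubdivision-colourable {k} {G} {S} {H} (sub , exact) owf le (h , h-adj) = f , proper
  where
  M = model sub
  f : V G → V H
  f a = h (branch M a)
  odd-walk : ∀ e → Walk (Adj H) (f (src e)) (f (tgt e)) (suc (k + k))
  odd-walk e = mapʷ h (h-adj _ _) (castʷ (cong suc (exact e)) (subst₂ (λ x y → Walk (Adj S) x y (suc (len M e)))
    (path-start M e) (path-end M e) (fromSteps _ (path M e) (path-adj M e))))
  apart : ∀ e → f (src e) ≢ f (tgt e)
  apart e q = owf k (f (src e)) le (subst (λ y → Walk (Adj H) (f (src e)) y (suc (k + k))) (≡-sym q) (odd-walk e))
  proper : ∀ x y → Adj G x y → f x ≢ f y
  proper x y a q with Finₚ.<-cmp x y
  ... | tri< lt _ _   = apart (edge x y lt a) q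
  ... | tri≈ _ refl _ = Adj-irrefl G a
  ... | tri> _ _ gt   = apart (edge y x gt (Adj-sym G a)) (≡-sym q)

-- Disjoint copies of a subdivision.

record Copies (M : ℕ) (S G : Graph) : Set where
  field
    place     : Fin M → V S → V G
    place-inj : ∀ {i j x y} → place i x ≡ place j y → i ≡ j × x ≡ y
    place-adj : ∀ i {x y} → Adj S x y → Adj G (place i x) (place i y)

ManyCopies : Class → Graph → Set
ManyCopies C S = ∀ M → ∃[ G ] (C G × Copies M S G)

addable⇒manyCopies : ∀ {C S} → Addable C → C S → ManyCopies C S
addable⇒manyCopies {S = S} add S∈C zero = S , S∈C , record { place = λ () ; place-inj = λ { {()} } ; place-adj = λ () }
addable⇒manyCopies {C} {S} add S∈C (suc M) with addable⇒manyCopies {C} {S} add S∈C M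
... | G , G∈C , c = S ⊎ᴳ G , add S G S∈C G∈C , record
  { place = place ; place-inj = λ {i} {j} {x} {y} → place-inj i j x y ; place-adj = λ i {x} {y} → place-adj i x y }
  where
  module c = Copies c
  place : Fin (suc M) → V S → V (S ⊎ᴳ G)
  place zero    x = x Fin.↑ˡ n G
  place (suc i) x = n S Fin.↑ʳ c.place i x
  differ : ∀ x y → x Fin.↑ˡ n G ≢ n S Fin.↑ʳ y
  differ x y q with trans (≡-sym (Finₚ.splitAt-↑ˡ (n S) x (n G))) (trans (cong (Fin.splitAt (n S)) q) (Finₚ.splitAt-↑ʳ (n S) (n G) y))
  ... | ()
  place-inj : ∀ i j x y → place i x ≡ place j y → i ≡ j × x ≡ y
  place-inj zero    zero    x y q = refl , Finₚ.↑ˡ-injective (n G) x y q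
  place-inj zero    (suc j) x y q = ⊥-elim (differ _ _ q)
  place-inj (suc i) zero    x y q = ⊥-elim (differ _ _ (≡-sym q))
  place-inj (suc i) (suc j) x y q = let i≡j , x≡y = c.place-inj (Finₚ.↑ʳ-injective (n S) _ _ q) in cong suc i≡j , x≡y
  place-adj : ∀ i x y → Adj S x y → Adj (S ⊎ᴳ G) (place i x) (place i y)
  place-adj zero    x y a rewrite Finₚ.splitAt-↑ˡ (n S) x (n G) | Finₚ.splitAt-↑ˡ (n S) y (n G) = a
  place-adj (suc i) x y a rewrite Finₚ.splitAt-↑ʳ (n S) (n G) (c.place i x) | Finₚ.splitAt-↑ʳ (n S) (n G) (c.place i y) = c.place-adj i a

-- Without addability, disjoint copies of `S` are obtained by subdividing a disjoint union of copies
-- of `G`.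
module Multiple (M : ℕ) (G : Graph) where

  Layered : Fin M × V G → Fin M × V G → Set
  Layered (i , x) (j , y) = i ≡ j × Adj G x y

  layered? : ∀ p q → Dec (Layered p q)
  layered? (i , x) (j , y) = (i Fin.≟ j) ×-dec Adj? G x y

  layered-sym : ∀ {p q} → Layered p q → Layered q p
  layered-sym (e , a) = ≡-sym e , Adj-sym G a

  layered-irrefl : ∀ {p} → ¬ Layered p p
  layered-irrefl (_ , a) = Adj-irrefl G a

  private
    module L = MkGraphOn (uncurry Fin.combine) (Fin.remQuot {M} (n G)) (uncurry Finₚ.remQuot-combine)
      {Layered} layered? layered-sym layered-irrefl
  open L public using () renaming (graph to multiple)

  -- `combine i` is increasing, so a copy of an edge keeps its direction and its path is traversed
  -- the same way.
  liftEdge : Fin M → Edge G → Edge multiple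
  liftEdge i e = edge (Fin.combine i (src e)) (Fin.combine i (tgt e))
    (subst₂ _<_ (≡-sym (Finₚ.toℕ-combine i (src e))) (≡-sym (Finₚ.toℕ-combine i (tgt e))) (ℕₚ.+-monoʳ-< (n G * toℕ i) (src<tgt e)))
    (L.toAdj {i , src e} {i , tgt e} (refl , isAdj e))

multiple⇒copies : ∀ {M p G S S′} → IsExactSubdivision p G S → IsExactSubdivision p (Multiple.multiple M G) S′ → Copies M S S′
multiple⇒copies {M} {p} {G} {S} {S′} (sub , exact) (sub′ , exact′) = record
  { place = place ; place-inj = λ {i} {j} {x} {y} → place-inj i j x y
  ; place-adj = λ i → MapOut.out-adj sub (onBranch i) (onPath i) (start i) (end i) {Adj S′} (Adj-sym S′) (step i) }
  where
  open Multiple M G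
  A = model sub
  B = model sub′
  same : ∀ i e → len A e ≡ len B (liftEdge i e)
  same i e = trans (exact e) (≡-sym (exact′ (liftEdge i e)))
  shift : ∀ i e → Fin (suc (suc (len A e))) → Fin (suc (suc (len B (liftEdge i e))))
  shift i e = Fin.cast (cong (λ l → suc (suc l)) (same i e))
  onBranch : Fin M → V G → V S′
  onBranch i a = branch B (Fin.combine i a)
  onPath : ∀ i e → Fin (suc (suc (len A e))) → V S′
  onPath i e t = path B (liftEdge i e) (shift i e t)
  start : ∀ i e → onPath i e zero ≡ onBranch i (src e)
  start i e = path-start B (liftEdge i e)
  end : ∀ i e → onPath i e (fromℕ (suc (len A e))) ≡ onBranch i (tgt e)
  end i e = trans (cong (path B (liftEdge i e)) (Finₚ.toℕ-injective (trans (Finₚ.toℕ-cast (cong (λ l → suc (suc l)) (same i e)) (fromℕ (suc (len A e))))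
      (trans (Finₚ.toℕ-fromℕ (suc (len A e))) (trans (cong suc (same i e)) (≡-sym (Finₚ.toℕ-fromℕ (suc (len B (liftEdge i e)))))))))) (path-end B (liftEdge i e))
  step : ∀ i e t → Adj S′ (onPath i e (inject₁ t)) (onPath i e (suc t))
  step i e t = subst (λ u → Adj S′ (path B (liftEdge i e) u) (onPath i e (suc t)))
    (Finₚ.toℕ-injective (trans (Finₚ.toℕ-inject₁ t′) (trans (Finₚ.toℕ-cast _ t) (trans (≡-sym (Finₚ.toℕ-inject₁ t)) (≡-sym (Finₚ.toℕ-cast _ (inject₁ t)))))))
    (path-adj B (liftEdge i e) t′)
    where t′ = Fin.cast (cong suc (same i e)) t
  inner : ∀ i e j → ∃[ j′ ] (toℕ j′ ≡ toℕ j × onPath i e (suc (inject₁ j)) ≡ path B (liftEdge i e) (suc (inject₁ j′)))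
  inner i e j = j′ , Finₚ.toℕ-cast _ j , cong (λ t → path B (liftEdge i e) (suc t))
    (Finₚ.toℕ-injective (trans (Finₚ.toℕ-cast _ (inject₁ j)) (trans (Finₚ.toℕ-inject₁ j) (≡-sym (trans (Finₚ.toℕ-inject₁ j′) (Finₚ.toℕ-cast _ j))))))
    where j′ = Fin.cast (same i e) j
  place : Fin M → V S → V S′
  place i = MapOut.out sub (onBranch i) (onPath i) (start i) (end i)
  place-inj : ∀ i j x y → place i x ≡ place j y → i ≡ j × x ≡ y
  place-inj i j x y q with covers-vertices sub x | covers-vertices sub y
  ... | inj₁ (a , refl) | inj₁ (b , refl) = let i≡j , a≡b = Finₚ.combine-injective i a j b (branch-inj B _ _ q) in i≡j , cong (branch A) a≡b
  ... | inj₁ (a , refl) | inj₂ (e , t , refl) = let t′ , _ , r = inner j e t in ⊥-elim (internal-not-branch B _ t′ _ (trans (≡-sym r) (≡-sym q)))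
  ... | inj₂ (e , t , refl) | inj₁ (b , refl) = let t′ , _ , r = inner i e t in ⊥-elim (internal-not-branch B _ t′ _ (trans (≡-sym r) q))
  ... | inj₂ (e , t , refl) | inj₂ (e′ , u , refl) with inner i e t | inner j e′ u
  ... | t′ , t≡ , r | u′ , u≡ , r′ with internal-disjoint B (liftEdge i e) (liftEdge j e′) t′ u′ (trans (≡-sym r) (trans q r′))
  ... | s≡ , g≡ with Finₚ.combine-injective i (src e) j (src e′) s≡ | Finₚ.combine-injective i (tgt e) j (tgt e′) g≡
  ... | refl , es | _ , et with edge-≡ {G} {e} {e′} es et
  ... | refl = refl , cong (λ t → path A e (suc (inject₁ t))) (Finₚ.toℕ-injective (trans (≡-sym t≡) (trans (cong toℕ t′≡u′) u≡)))
    where t′≡u′ = Finₚ.inject₁-injective (Finₚ.suc-injective (path-inj B (liftEdge i e) _ _ (trans (≡-sym r) (trans q r′))))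

-- Ehrenfeucht–Fraïssé games

quantifierRank : ∀ {k} → Formula k → ℕ
quantifierRank (adjF _ _) = 0
quantifierRank (eqF _ _)  = 0
quantifierRank ⊥F         = 0
quantifierRank (¬F φ)     = quantifierRank φ
quantifierRank (φ ∧F ψ)   = quantifierRank φ ℕ.⊔ quantifierRank ψ
quantifierRank (φ ∨F ψ)   = quantifierRank φ ℕ.⊔ quantifierRank ψ
quantifierRank (φ ⇒F ψ)   = quantifierRank φ ℕ.⊔ quantifierRank ψ
quantifierRank (∀F φ)     = suc (quantifierRank φ)
quantifierRank (∃F φ)     = suc (quantifierRank φ)

record BackForth (A B : Graph) : Set₁ where
  field
    Pos     : ∀ {k} → ℕ → (Fin k → V A) → (Fin k → V B) → Set
    pos-adj : ∀ {k m} {ρ : Fin k → V A} {σ} → Pos m ρ σ → ∀ i j → Adj A (ρ i) (ρ j) ↔ Adj B (σ i) (σ j)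
    pos-eq  : ∀ {k m} {ρ : Fin k → V A} {σ} → Pos m ρ σ → ∀ i j → (ρ i ≡ ρ j) ↔ (σ i ≡ σ j)
    forth   : ∀ {k m} {ρ : Fin k → V A} {σ} → Pos (suc m) ρ σ → ∀ x → ∃[ y ] Pos m (x VF.∷ ρ) (y VF.∷ σ)
    back    : ∀ {k m} {ρ : Fin k → V A} {σ} → Pos (suc m) ρ σ → ∀ y → ∃[ x ] Pos m (x VF.∷ ρ) (y VF.∷ σ)

  sat : ∀ {k} (φ : Formula k) {m ρ σ} → quantifierRank φ ≤ m → Pos m ρ σ → Sat A ρ φ ↔ Sat B σ φ
  sat (adjF i j) le p = pos-adj p i j
  sat (eqF i j)  le p = pos-eq p i j
  sat ⊥F         le p = id , id
  sat (¬F φ)     le p = let f , g = sat φ le p in (λ ¬s s → ¬s (g s)) , λ ¬s s → ¬s (f s)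
  sat (φ ∧F ψ)   le p =
    let f , g = sat φ (ℕₚ.m⊔n≤o⇒m≤o _ _ le) p ; f′ , g′ = sat ψ (ℕₚ.m⊔n≤o⇒n≤o (quantifierRank φ) _ le) p
    in (λ (a , b) → f a , f′ b) , λ (a , b) → g a , g′ b
  sat (φ ∨F ψ)   le p =
    let f , g = sat φ (ℕₚ.m⊔n≤o⇒m≤o _ _ le) p ; f′ , g′ = sat ψ (ℕₚ.m⊔n≤o⇒n≤o (quantifierRank φ) _ le) p
    in Sum.map f f′ , Sum.map g g′
  sat (φ ⇒F ψ)   le p =
    let f , g = sat φ (ℕₚ.m⊔n≤o⇒m≤o _ _ le) p ; f′ , g′ = sat ψ (ℕₚ.m⊔n≤o⇒n≤o (quantifierRank φ) _ le) p
    in (λ h a → f′ (h (g a))) , λ h a → g′ (h (f a))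
  sat (∀F φ) (s≤s le) p =
    (λ h y → let x , q = back p y in proj₁ (sat φ le q) (h x)) , λ h x → let y , q = forth p x in proj₂ (sat φ le q) (h y)
  sat (∃F φ) (s≤s le) p =
    (λ (x , s) → let y , q = forth p x in y , proj₁ (sat φ le q) s) , λ (y , s) → let x , q = back p y in x , proj₂ (sat φ le q) s

-- Every component keeps all vertices of `S` and only drops edges. In the game a pebble is therefore
-- answered by the same vertex of `S`, and only the component is to be chosen.
record Family (S : Graph) : Set₁ where
  field
    size  : ℕ
    E     : Fin size → V S → V S → Set
    E?    : ∀ i x y → Dec (E i x y)
    E-sym : ∀ {i x y} → E i x y → E i y x
    E⊆    : ∀ {i x y} → E i x y → Adj S x y

  Joined : Fin size × V S → Fin size × V S → Set
  Joined (i , x) (j , y) = i ≡ j × E i x y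

  joined? : ∀ p q → Dec (Joined p q)
  joined? (i , x) (j , y) = (i Fin.≟ j) ×-dec E? i x y

  joined-sym : ∀ {p q} → Joined p q → Joined q p
  joined-sym (refl , e) = refl , E-sym e

  joined-irrefl : ∀ {p} → ¬ Joined p p
  joined-irrefl (_ , e) = Adj-irrefl S (E⊆ e)

  private
    module U = MkGraphOn (uncurry Fin.combine) (Fin.remQuot {size} (n S)) (uncurry Finₚ.remQuot-combine)
      {Joined} joined? joined-sym joined-irrefl
  open U public using (toAdj; fromAdj; fromAdj-to; to-injective) renaming (graph to union)

  union⊆ : ∀ {G} → Copies size S G → Subgraph union G
  union⊆ {G} c = (λ a → place (proj₁ (code a)) (proj₂ (code a))) ,
    (λ a b q → let i≡ , x≡ = place-inj q in trans (≡-sym (Finₚ.combine-remQuot {size} (n S) a))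
       (trans (cong₂ Fin.combine i≡ x≡) (Finₚ.combine-remQuot {size} (n S) b))) ,
    λ a b e → adjacent (fromAdj e)
    where
    open Copies c
    code = Fin.remQuot {size} (n S)
    adjacent : ∀ {i j x y} → Joined (i , x) (j , y) → Adj G (place i x) (place j y)
    adjacent {i} (refl , e) = place-adj i (E⊆ e)

-- With m rounds left, pebbles within distance 2 to the power m matter; the radius halves each round
-- because a new pebble can link two old ones.
radius : ℕ → ℕ
radius zero    = 1
radius (suc m) = radius m + radius m

1≤radius : ∀ m → 1 ≤ radius m
1≤radius zero    = ℕₚ.≤-refl
1≤radius (suc m) = ℕₚ.≤-trans (1≤radius m) (ℕₚ.m≤m+n _ _)

radius-mono : ∀ {m m′} → m ≤ m′ → radius m ≤ radius m′
radius-mono {zero}  {m′}     z≤n      = 1≤radius m′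
radius-mono {suc m} {suc m′} (s≤s le) = ℕₚ.+-mono-≤ (radius-mono le) (radius-mono le)

module _ {X : Set} where

  -- the relations E and F have the same walks of length r from x
  Agree : (X → X → Set) → (X → X → Set) → ℕ → X → Set
  Agree E F zero    x = ⊤
  Agree E F (suc r) x = ∀ y → (E x y → F x y × Agree E F r y) × (F x y → E x y × Agree E F r y)

  agree-sym : ∀ {E F} r {x} → Agree E F r x → Agree F E r x
  agree-sym zero    _ = tt
  agree-sym (suc r) a y = let f , g = a y in
    (λ e → let e′ , a′ = g e in e′ , agree-sym r a′) , λ e → let e′ , a′ = f e in e′ , agree-sym r a′

  agree-mono : ∀ {E F r r′} → r ≤ r′ → ∀ {x} → Agree E F r′ x → Agree E F r x
  agree-mono z≤n      _ = tt
  agree-mono (s≤s le) a y = let f , g = a y in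
    (λ e → let e′ , a′ = f e in e′ , agree-mono le a′) , λ e → let e′ , a′ = g e in e′ , agree-mono le a′

  agree-same : ∀ {E F} → (∀ {x y} → E x y → F x y) → (∀ {x y} → F x y → E x y) → ∀ r {x} → Agree E F r x
  agree-same f g zero    = tt
  agree-same f g (suc r) y = (λ e → f e , agree-same f g r) , λ e → g e , agree-same f g r

  agree-walk : ∀ {E F} l {r x y} → Agree E F (l + r) x → Walk E x y l → Walk F x y l × Agree E F r y
  agree-walk zero    a nil = nil , a
  agree-walk (suc l) a (cons e w) = let e′ , a′ = proj₁ (a _) e ; w′ , b = agree-walk l a′ w in cons e′ w′ , b

module Position {S : Graph} (P P′ : Family S) (N : ℕ) where

  private
    module P = Family P
    module P′ = Family P′

  -- `close` compares components only for pebbles whose vertices are joined by a short walk; far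
  -- pebbles of one component may be answered in different ones. `rounds` keeps the number of used
  -- components below what `Fresh` can avoid.
  record Matched {k} (m : ℕ) (x : Fin k → V S) (i : Fin k → Fin P.size) (i′ : Fin k → Fin P′.size) : Set where
    field
      rounds : k + m ≤ N
      local  : ∀ s → Agree (P.E (i s)) (P′.E (i′ s)) (radius m) (x s)
      close  : ∀ s t {l} → l ≤ radius m → Walk (P.E (i s)) (x s) (x t) l → (i s ≡ i t) ↔ (i′ s ≡ i′ t)

  Fresh : Set
  Fresh = ∀ i x (used : List (Fin P′.size)) → length used < N → ∃[ i′ ] (i′ ∉ used × Agree (P.E i) (P′.E i′) (radius N) x)

  -- If the new vertex is near a pebble, it is answered in the component answering that pebble,
  -- otherwise in a fresh component.
  extend : Fresh → ∀ {k m x i i′} → Matched {k} (suc m) x i i′ → ∀ j y →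
           ∃[ j′ ] Matched m (y VF.∷ x) (j VF.∷ i) (j′ VF.∷ i′)
  extend fresh {k} {m} {x} {i} {i′} M j y = answer (Finₚ.any? near?)
    where
    open Matched M
    r = radius m
    Near : Fin k → Set
    Near s = i s ≡ j × ∃[ l ] Walk (P.E j) (x s) y (toℕ {suc r} l)
    near? : ∀ s → Dec (Near s)
    near? s = (i s Fin.≟ j) ×-dec Finₚ.any? λ l → walk? (P.E? j) (toℕ l) (x s) y
    rounds′ : suc k + m ≤ N
    rounds′ = subst (_≤ N) (ℕₚ.+-suc k m) rounds
    r≤ : r ≤ radius (suc m)
    r≤ = ℕₚ.m≤m+n r r
    local′ : ∀ {j′} → Agree (P.E j) (P′.E j′) r y → ∀ s →
             Agree (P.E ((j VF.∷ i) s)) (P′.E ((j′ VF.∷ i′) s)) r ((y VF.∷ x) s)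
    local′ a zero    = a
    local′ a (suc s) = agree-mono r≤ (local s)
    answer : Dec (∃ Near) → ∃[ j′ ] Matched m (y VF.∷ x) (j VF.∷ i) (j′ VF.∷ i′)
    answer (yes (s , refl , l , w)) = i′ s , record
      { rounds = rounds′
      ; local = local′ (proj₂ moved)
      ; close = close′ }
      where
      l≤ : toℕ l ≤ r
      l≤ = ℕₚ.≤-pred (Finₚ.toℕ<n l)
      moved : Walk (P′.E (i′ s)) (x s) y (toℕ l) × Agree (P.E (i s)) (P′.E (i′ s)) r y
      moved = agree-walk (toℕ l) (agree-mono (ℕₚ.+-monoˡ-≤ r l≤) (local s)) w
      close′ : ∀ a b {l} → l ≤ r → Walk (P.E ((i s VF.∷ i) a)) ((y VF.∷ x) a) ((y VF.∷ x) b) l →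
               ((i s VF.∷ i) a ≡ (i s VF.∷ i) b) ↔ ((i′ s VF.∷ i′) a ≡ (i′ s VF.∷ i′) b)
      close′ zero    zero    _  _ = (λ _ → refl) , λ _ → refl
      -- Through `y`, pebble s reaches t in at most 2r steps, which is the previous radius.
      close′ zero    (suc t) le v = close s t (ℕₚ.+-mono-≤ l≤ le) (w ⋆ v)
      close′ (suc a) (suc b) le v = close a b (ℕₚ.≤-trans le r≤) v
      close′ (suc t) zero {l′} le v =
        (λ q → ≡-sym (proj₁ (close s t (ℕₚ.+-mono-≤ l≤ le) (w ⋆ reverseʷ P.E-sym (subst (λ j → Walk (P.E j) (x t) y l′) q v))) (≡-sym q))) ,
        -- Only the answering components are known to be equal here: the walk from `x t` is carried
        -- over to `P′`, joined there with the walk from `x s`, and the result is carried back.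
        λ q → ≡-sym (proj₂ (close s t (ℕₚ.+-mono-≤ l≤ le) (proj₁ (agree-walk (toℕ l + l′)
          (agree-sym (toℕ l + l′ + 0) (agree-mono (subst (_≤ r + r) (≡-sym (ℕₚ.+-identityʳ _)) (ℕₚ.+-mono-≤ l≤ le)) (local s)))
          (proj₁ moved ⋆ reverseʷ P′.E-sym (subst (λ j → Walk (P′.E j) (x t) y l′) q
            (proj₁ (agree-walk l′ (agree-mono (subst (_≤ r + r) (≡-sym (ℕₚ.+-identityʳ l′)) (ℕₚ.≤-trans le r≤)) (local t)) v))))))) (≡-sym q))
    answer (no none) with fresh j y (tabulate i′)
      (subst (_< N) (≡-sym (Listₚ.length-tabulate i′)) (ℕₚ.≤-trans (ℕₚ.m≤m+n (suc k) m) rounds′))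
    ... | j′ , j′∉ , a = j′ , record
      { rounds = rounds′
      ; local = local′ (agree-mono (radius-mono (ℕₚ.≤-trans (ℕₚ.m≤n+m m (suc k)) rounds′)) a)
      ; close = close′ }
      where
      unused : ∀ {t} → j′ ≢ i′ t
      unused {t} q = j′∉ (subst (_∈ tabulate i′) (≡-sym q) (∈ₚ.∈-tabulate⁺ t))
      far : ∀ {t l} → l ≤ r → i t ≡ j → ¬ Walk (P.E j) (x t) y l
      far {t} le q v = none (t , q , fromℕ< (s≤s le) , castʷ (≡-sym (Finₚ.toℕ-fromℕ< (s≤s le))) v)
      close′ : ∀ a b {l} → l ≤ r → Walk (P.E ((j VF.∷ i) a)) ((y VF.∷ x) a) ((y VF.∷ x) b) l →
               ((j VF.∷ i) a ≡ (j VF.∷ i) b) ↔ ((j′ VF.∷ i′) a ≡ (j′ VF.∷ i′) b)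
      close′ zero    zero    _  _ = (λ _ → refl) , λ _ → refl
      close′ zero    (suc t) le v = (λ q → ⊥-elim (far le (≡-sym q) (reverseʷ P.E-sym v))) , λ q → ⊥-elim (unused q)
      close′ (suc t) zero {l′} le v = (λ q → ⊥-elim (far le q (subst (λ j → Walk (P.E j) (x t) y l′) q v))) , λ q → ⊥-elim (unused (≡-sym q))
      close′ (suc a) (suc b) le v = close a b (ℕₚ.≤-trans le r≤) v

swap-matched : ∀ {S P P′ N k m x i i′} → Position.Matched {S} P P′ N {k} m x i i′ → Position.Matched P′ P N m x i′ i
swap-matched {m = m} M = record
  { rounds = rounds ; local = λ s → agree-sym (radius m) (local s)
  ; close = λ s t {l} le w →
      let f , g = close s t le (proj₁ (agree-walk l (agree-mono (subst (_≤ radius m) (≡-sym (ℕₚ.+-identityʳ l)) le) (agree-sym (radius m) (local s))) w))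
      in g , f }
  where open Position.Matched M

module Game {S : Graph} (P P′ : Family S) (N : ℕ)
  (fresh : Position.Fresh P P′ N) (fresh′ : Position.Fresh P′ P N) where

  private
    module P = Family P
    module P′ = Family P′
  open Position P P′ N using (Matched; module Matched)

  record Pebbles {k} (m : ℕ) (ρ : Fin k → V P.union) (σ : Fin k → V P′.union) : Set where
    field
      x       : Fin k → V S
      i       : Fin k → Fin P.size
      i′      : Fin k → Fin P′.size
      ρ≡      : ∀ s → ρ s ≡ Fin.combine (i s) (x s)
      σ≡      : ∀ s → σ s ≡ Fin.combine (i′ s) (x s)
      matched : Matched m x i i′

  swap-adj : ∀ {k m} {ρ : Fin k → V P.union} {σ} → Pebbles m ρ σ → ∀ s t →
    Adj P.union (ρ s) (ρ t) ↔ Adj P′.union (σ s) (σ t)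
  swap-adj {m = m} p s t rewrite Pebbles.ρ≡ p s | Pebbles.ρ≡ p t | Pebbles.σ≡ p s | Pebbles.σ≡ p t =
    (λ a → let i≡ , e = P.fromAdj-to {i s , x s} {i t , x t} a in P′.toAdj {i′ s , x s} {i′ t , x t}
       (proj₁ (close s t (1≤radius m) (cons e nil)) i≡ , proj₁ (proj₁ (agree-mono (1≤radius m) (local s) (x t)) e))) ,
    (λ a → let i≡ , e = P′.fromAdj-to {i′ s , x s} {i′ t , x t} a
               e′ = proj₁ (proj₂ (agree-mono (1≤radius m) (local s) (x t)) e)
           in P.toAdj {i s , x s} {i t , x t} (proj₂ (close s t (1≤radius m) (cons e′ nil)) i≡ , e′))
    where
    open Pebbles p
    open Matched matched

  swap-eq : ∀ {k m} {ρ : Fin k → V P.union} {σ} → Pebbles m ρ σ → ∀ s t → (ρ s ≡ ρ t) ↔ (σ s ≡ σ t)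
  swap-eq p s t rewrite Pebbles.ρ≡ p s | Pebbles.ρ≡ p t | Pebbles.σ≡ p s | Pebbles.σ≡ p t =
    (λ q → let i≡ , x≡ = Finₚ.combine-injective (i s) (x s) (i t) (x t) q in
       cong₂ Fin.combine (proj₁ (close s t z≤n (subst (λ y → Walk (P.E (i s)) (x s) y 0) x≡ nil)) i≡) x≡) ,
    (λ q → let i≡ , x≡ = Finₚ.combine-injective (i′ s) (x s) (i′ t) (x t) q in
       cong₂ Fin.combine (proj₂ (close s t z≤n (subst (λ y → Walk (P.E (i s)) (x s) y 0) x≡ nil)) i≡) x≡)
    where
    open Pebbles p
    open Matched matched

  backForth : BackForth P.union P′.union
  backForth = record
    { Pos = Pebbles
    ; pos-adj = swap-adj
    ; pos-eq = swap-eq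
    ; forth = forth
    ; back = back
    }
    where
    forth : ∀ {k m} {ρ : Fin k → V P.union} {σ} → Pebbles (suc m) ρ σ → ∀ a → ∃[ b ] Pebbles m (a VF.∷ ρ) (b VF.∷ σ)
    forth p a =
      let j , y = Fin.remQuot {P.size} (n S) a
          j′ , M = Position.extend P P′ N fresh (Pebbles.matched p) j y
      in Fin.combine j′ y , record { x = y VF.∷ Pebbles.x p ; i = j VF.∷ Pebbles.i p ; i′ = j′ VF.∷ Pebbles.i′ p
           ; ρ≡ = λ { zero → ≡-sym (Finₚ.combine-remQuot {P.size} (n S) a) ; (suc s) → Pebbles.ρ≡ p s }
           ; σ≡ = λ { zero → refl ; (suc s) → Pebbles.σ≡ p s } ; matched = M }
    back : ∀ {k m} {ρ : Fin k → V P.union} {σ} → Pebbles (suc m) ρ σ → ∀ b → ∃[ a ] Pebbles m (a VF.∷ ρ) (b VF.∷ σ)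
    back p b =
      let j′ , y = Fin.remQuot {P′.size} (n S) b
          j , M = Position.extend P′ P N fresh′ (swap-matched (Pebbles.matched p)) j′ y
      in Fin.combine j y , record { x = y VF.∷ Pebbles.x p ; i = j VF.∷ Pebbles.i p ; i′ = j′ VF.∷ Pebbles.i′ p
           ; ρ≡ = λ { zero → refl ; (suc s) → Pebbles.ρ≡ p s }
           ; σ≡ = λ { zero → ≡-sym (Finₚ.combine-remQuot {P′.size} (n S) b) ; (suc s) → Pebbles.σ≡ p s } ; matched = swap-matched M }

  equivalent : ∀ (Φ : Sentence) → quantifierRank Φ ≤ N → (P.union ⊨ Φ) ↔ (P′.union ⊨ Φ)
  equivalent Φ le = BackForth.sat backForth Φ le record
    { x = λ () ; i = λ () ; i′ = λ () ; ρ≡ = λ () ; σ≡ = λ ()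
    ; matched = record { rounds = ℕₚ.≤-refl ; local = λ () ; close = λ () } }

-- Unions of balls, with and without the whole graph.

edgeOrBipartite : ∀ H → ¬ Bipartite H → ∃[ a ] ∃[ b ] Adj H a b
edgeOrBipartite H ¬bip with Finₚ.any? (λ a → Finₚ.any? (λ b → Adj? H a b))
... | yes e = e
... | no none = ⊥-elim (¬bip ((λ _ → zero) , λ x y a _ → none (x , y , a)))

module Balls (S : Graph) (r : ℕ) where

  Within : V S → V S → Set
  Within v x = ∃[ l ] Walk (Adj S) v x (toℕ {suc r} l)

  within : ∀ {v x l} → l ≤ r → Walk (Adj S) v x l → Within v x
  within le w = fromℕ< (s≤s le) , castʷ (≡-sym (Finₚ.toℕ-fromℕ< (s≤s le))) w

  within? : ∀ v x → Dec (Within v x)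
  within? v x = Finₚ.any? λ l → walk? (Adj? S) (toℕ l) v x

  Ball : V S → V S → V S → Set
  Ball v x y = Adj S x y × Within v x × Within v y

  ball? : ∀ v x y → Dec (Ball v x y)
  ball? v x y = Adj? S x y ×-dec within? v x ×-dec within? v y

  ball-sym : ∀ {v x y} → Ball v x y → Ball v y x
  ball-sym (a , p , q) = Adj-sym S a , q , p

  -- A walk of k steps from a vertex reached from the centre in d steps cannot leave the ball while
  -- d + k ≤ r.
  ball-agrees : ∀ d k → d + k ≤ r → ∀ {v x} → Walk (Adj S) v x d → Agree (Adj S) (Ball v) k x
  ball-agrees d zero    le w = tt
  ball-agrees d (suc k) le w y = (λ a → (a , within (ℕₚ.≤-trans (ℕₚ.m≤m+n d _) le) w , within (ℕₚ.≤-trans (ℕₚ.m≤m+n (suc d) k) le′) (snoc w a)) ,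
      ball-agrees (suc d) k le′ (snoc w a)) , λ (a , _) → a , ball-agrees (suc d) k le′ (snoc w a)
    where le′ = subst (_≤ r) (ℕₚ.+-suc d k) le

  centre : ∀ M → Fin (M * n S) → V S
  centre M i = proj₂ (Fin.remQuot {M} (n S) i)

  balls : ℕ → Family S
  balls M = record { size = M * n S ; E = λ i → Ball (centre M i) ; E? = λ i → ball? (centre M i) ; E-sym = ball-sym ; E⊆ = proj₁ }

  balls+ : ℕ → Family S
  balls+ M = record { size = suc (M * n S) ; E = E ; E? = E? ; E-sym = λ {i} → E-sym i ; E⊆ = λ {i} → E⊆ i }
    where
    E : Fin (suc (M * n S)) → V S → V S → Set
    E zero    = Adj S
    E (suc i) = Ball (centre M i)
    E? : ∀ i x y → Dec (E i x y)
    E? zero    = Adj? S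
    E? (suc i) = ball? (centre M i)
    E-sym : ∀ i {x y} → E i x y → E i y x
    E-sym zero    = Adj-sym S
    E-sym (suc i) = ball-sym
    E⊆ : ∀ i {x y} → E i x y → Adj S x y
    E⊆ zero    = id
    E⊆ (suc i) = proj₁

  module _ (M : ℕ) where
    private
      module P = Family (balls M)
      module P′ = Family (balls+ M)

    centre-combine : ∀ (j : Fin M) v → centre M (Fin.combine j v) ≡ v
    centre-combine j v = cong proj₂ (Finₚ.remQuot-combine j v)

    same-ball : ∀ {u v} → u ≡ v → ∀ k {x} → Agree (Ball u) (Ball v) k x
    same-ball refl k = agree-same id id k

    freshBall : ∀ {A : Set} → (∀ (x y : A) → Dec (x ≡ y)) → (f : Fin (M * n S) → A) → Injective f →
      ∀ v (used : List A) → length used < M → ∃[ i ] (f i ∉ used × centre M i ≡ v)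
    freshBall _≟_ f f-inj v used lt =
      let j , f∉ = fresh _≟_ (λ j → f (Fin.combine j v)) (λ j k e → proj₁ (Finₚ.combine-injective j v k v (f-inj _ _ e))) used lt
      in Fin.combine j v , f∉ , centre-combine j v

    fresh+ : radius M ≤ r → Position.Fresh (balls M) (balls+ M) M
    fresh+ le i x used lt =
      let i′ , f∉ , e = freshBall Fin._≟_ suc (λ _ _ → Finₚ.suc-injective) (centre M i) used lt
      in suc i′ , f∉ , same-ball (≡-sym e) (radius M)

    fresh- : radius M ≤ r → Position.Fresh (balls+ M) (balls M) M
    -- A pebble in the whole copy of `S` is answered in a ball centred at that very vertex, where
    -- `S` and the ball look alike up to the required radius.
    fresh- le zero x used lt =
      let i′ , f∉ , e = freshBall Fin._≟_ id (λ _ _ q → q) x used lt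
      in i′ , f∉ , subst (λ v → Agree (Adj S) (Ball v) (radius M) x) (≡-sym e) (ball-agrees 0 (radius M) le nil)
    fresh- le (suc i) x used lt =
      let i′ , f∉ , e = freshBall Fin._≟_ id (λ _ _ q → q) (centre M i) used lt
      in i′ , f∉ , same-ball (≡-sym e) (radius M)

    S⟶balls+ : S ⟶ P′.union
    S⟶balls+ = (λ x → Fin.combine {suc (M * n S)} zero x) , λ x y a → P′.toAdj {zero , x} {zero , y} (refl , a)

    module _ (odd : OddWalkFree S (suc (r + r))) where

      -- The colour of a vertex of the ball is the existence of an even walk of length at most r
      -- from the centre. An edge inside one colour class would close two walks of equal parity to
      -- an odd one of length at most 2r + 1.
      EvenFrom : V S → V S → Set
      EvenFrom v x = ∃[ k ] (toℕ {suc r} k + toℕ k ≤ r × Walk (Adj S) v x (toℕ k + toℕ k))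

      evenFrom? : ∀ v x → Dec (EvenFrom v x)
      evenFrom? v x = Finₚ.any? λ k → (toℕ k + toℕ k ℕ.≤? r) ×-dec walk? (Adj? S) (toℕ k + toℕ k) v x

      even-even : ∀ {v x y} → Adj S x y → EvenFrom v x → EvenFrom v y → ⊥
      even-even {v} a (k , k≤ , w) (l , l≤ , u) = odd (toℕ k + toℕ l) v
        (ℕₚ.≤-trans (ℕₚ.≤-reflexive (≡-sym (lengths (toℕ k) (toℕ l)))) (subst (_≤ suc (r + r)) (≡-sym (ℕₚ.+-suc _ _)) (s≤s (ℕₚ.+-mono-≤ k≤ l≤))))
        (castʷ (lengths (toℕ k) (toℕ l)) (w ⋆ cons a (reverseʷ (Adj-sym S) u)))
        where
        lengths : ∀ k l → k + k + suc (l + l) ≡ suc (k + l + (k + l))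
        lengths = solve 2 (λ k l → k :+ k :+ (con 1 :+ (l :+ l)) := con 1 :+ (k :+ l :+ (k :+ l))) refl

      oddFrom : ∀ {v x} → Within v x → ¬ EvenFrom v x → ∃[ k ] (suc (k + k) ≤ r × Walk (Adj S) v x (suc (k + k)))
      oddFrom {v} {x} (l , w) ¬even with odd? (toℕ l)
      ... | inj₂ (k , e) = k , subst (_≤ r) e (ℕₚ.≤-pred (Finₚ.toℕ<n l)) , castʷ e w
      ... | inj₁ (k , e) = ⊥-elim (¬even (fromℕ< k< , subst (λ k → k + k ≤ r) (≡-sym t) (subst (_≤ r) e (ℕₚ.≤-pred (Finₚ.toℕ<n l))) ,
              castʷ (trans e (cong (λ k → k + k) (≡-sym t))) w))
        where
        k< : k < suc r
        k< = s≤s (ℕₚ.≤-trans (ℕₚ.m≤m+n k k) (subst (_≤ r) e (ℕₚ.≤-pred (Finₚ.toℕ<n l))))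
        t = Finₚ.toℕ-fromℕ< k<

      odd-odd : ∀ {v x y} → Ball v x y → ¬ EvenFrom v x → ¬ EvenFrom v y → ⊥
      odd-odd {v} (a , p , q) ¬x ¬y with oddFrom p ¬x | oddFrom q ¬y
      ... | k , k≤ , w | l , l≤ , u = odd (suc (k + l)) v
        (ℕₚ.≤-trans (ℕₚ.≤-reflexive (≡-sym (lengths k l))) (subst (_≤ suc (r + r)) (≡-sym (ℕₚ.+-suc (suc (k + k)) (suc (l + l)))) (s≤s (ℕₚ.+-mono-≤ k≤ l≤))))
        (castʷ (lengths k l) (w ⋆ cons a (reverseʷ (Adj-sym S) u)))
        where
        lengths : ∀ k l → suc (k + k) + suc (suc (l + l)) ≡ suc (suc (k + l) + suc (k + l))
        lengths = solve 2 (λ k l → (con 1 :+ (k :+ k)) :+ (con 2 :+ (l :+ l)) := con 1 :+ ((con 1 :+ (k :+ l)) :+ (con 1 :+ (k :+ l)))) refl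

      balls⟶ : ∀ {H a b} → Adj H a b → P.union ⟶ H
      balls⟶ {H} {a} {b} ab = (λ c → f (Fin.remQuot {M * n S} (n S) c)) , λ c d e → f-adj _ _ (P.fromAdj e)
        where
        side : ∀ {A : Set} → Dec A → V H
        side d = if does d then a else b
        f : Fin (M * n S) × V S → V H
        f (i , x) = side (evenFrom? (centre M i) x)
        sides : ∀ {v x y} → Ball v x y → (d : Dec (EvenFrom v x)) (e : Dec (EvenFrom v y)) → Adj H (side d) (side e)
        sides e (yes p) (yes q) = ⊥-elim (even-even (proj₁ e) p q)
        sides e (yes _) (no _)  = ab
        sides e (no _)  (yes _) = Adj-sym H ab
        sides e (no p)  (no q)  = ⊥-elim (odd-odd e p q)
        f-adj : ∀ p q → P.Joined p q → Adj H (f p) (f q)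
        f-adj (i , x) (j , y) (refl , e) = sides e (evenFrom? (centre M i) x) (evenFrom? (centre M i) y)

-- The disjoint union of copies of the balls of S is bipartite, and adding S as a further component
-- does not change the truth of Φ.
highOddGirth⇒colourable : ∀ {C H S} → Monotone C → ¬ Bipartite H → (Φ : Sentence) → (∀ G → C G → (G ⊨ Φ) ↔ (G ⟶ H)) →
  ManyCopies C S → OddWalkFree S (suc (radius (quantifierRank Φ) + radius (quantifierRank Φ))) → S ⟶ H
highOddGirth⇒colourable {C} {H} {S} mono ¬bip Φ defines copies odd =
  ⟶-trans {S} {P′.union} {H} (S⟶balls+ M) (proj₁ (defines P′.union (member (balls+ M)))
    (proj₁ (Game.equivalent (balls M) (balls+ M) M (fresh+ M ℕₚ.≤-refl) (fresh- M ℕₚ.≤-refl) Φ ℕₚ.≤-refl)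
      (proj₂ (defines P.union (member (balls M))) (balls⟶ M odd {H} (proj₂ (proj₂ (edgeOrBipartite H ¬bip)))))))
  where
  M = quantifierRank Φ
  open Balls S (radius M)
  module P = Family (balls M)
  module P′ = Family (balls+ M)
  member : ∀ F → C (Family.union F)
  member F = let G , G∈C , c = copies (Family.size F) in mono G (Family.union F) G∈C (Family.union⊆ F c)

-- Excluding dense classes, and the equivalence.

evenSubdivision-absurd : ∀ {C H G S k} → Monotone C → ¬ Bipartite H → OddWalkFree H (suc (k + k)) →
  (Φ : Sentence) → (∀ G → C G → (G ⊨ Φ) ↔ (G ⟶ H)) →
  IsExactSubdivision (k + k) G S → ManyCopies C S → ChromaticGt G (n H) →
  ¬ OddWalkFree G (suc (radius (quantifierRank Φ) + radius (quantifierRank Φ)))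
evenSubdivision-absurd {C} {H} {G} {S} {k} mono ¬bip owf Φ defines sub copies χ odd =
  χ (evenSubdivision-colourable {k} {G} {S} {H} sub owf ℕₚ.≤-refl
      (highOddGirth⇒colourable {C} {H} {S} mono ¬bip Φ defines copies
        (OddWalkFree-⟶ {S} {G} _ (evenSubdivision⇒hom {k} sub) odd)))

half-up : ℕ → ℕ
half-up p with odd? p
... | inj₁ (k , _) = k
... | inj₂ (k , _) = suc k

-- The given p may have either parity; if it is odd, one more vertex on every path makes the number
-- of internal vertices even.
evenSubdivision : ∀ {C} → TopologicallyClosed C → ∀ {p G S} → C S → IsExactSubdivision p G S →
  ∃[ S′ ] (C S′ × IsExactSubdivision (half-up p + half-up p) G S′)
evenSubdivision {C} closed {p} {G} {S} S∈C sub with odd? p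
... | inj₁ (k , refl) = S , S∈C , sub
... | inj₂ (k , refl) = let S′ , S′∈C , sub′ = lengthen {C} closed S∈C sub in
      S′ , S′∈C , subst (λ q → IsExactSubdivision q G S′) (cong suc (≡-sym (ℕₚ.+-suc k k))) sub′

condition-owf : ∀ {H p} → OddGirthGt H (2 * p + 1) → OddWalkFree H (suc (p + p))
condition-owf {H} {p} og = OddGirthGt⇒OddWalkFree {H} (subst (OddGirthGt H)
  (trans (ℕₚ.+-comm (2 * p) 1) (cong (λ q → suc (p + q)) (ℕₚ.+-identityʳ p))) og)

condition1⇒nowhereDense : ∀ {C} → Hereditary C → TopologicallyClosed C → Condition1 C → NowhereDense C
condition1⇒nowhereDense {C} hered closed cond (p , dense) with cond (half-up p)
... | H , ¬bip , og , Φ , defines with oddGirth-chromatic (radius (quantifierRank Φ)) (n H)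
... | D , odd , χ with subdivision (underlying D)
  where
  subdivision : ∀ G → ∃[ S ] (C S × IsExactSubdivision (half-up p + half-up p) G S)
  subdivision G = let G′ , G′∈C , S , sub , S⊆ = dense G in
    evenSubdivision {C} closed (hereditary⇒monotone {C} hered closed G′ S G′∈C S⊆) sub
... | S , S∈C , sub = evenSubdivision-absurd {C} {H} {underlying D} {S} {half-up p} (hereditary⇒monotone {C} hered closed) ¬bip
      (condition-owf {H} {half-up p} og) Φ defines sub copies χ odd
  where
  copies : ManyCopies C S
  copies M = let G′ , G′∈C , S₀ , sub₀ , S⊆ = dense (Multiple.multiple M (underlying D))
                 S′ , S′∈C , sub′ = evenSubdivision {C} closed (hereditary⇒monotone {C} hered closed G′ S₀ G′∈C S⊆) sub₀
             in S′ , S′∈C , multiple⇒copies sub sub′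

condition1⇒¬¬boundedExpansion : StarHypothesis → ∀ {C} → Hereditary C → Addable C → TopologicallyClosed C →
  Condition1 C → ¬ ¬ BoundedExpansion C
condition1⇒¬¬boundedExpansion star {C} hered add closed cond ¬be
  with star C (hereditary⇒monotone {C} hered closed) (condition1⇒nowhereDense {C} hered closed cond) ¬be
... | p , rich with cond (half-up p)
... | H , ¬bip , og , Φ , defines with rich (n H) (suc (radius (quantifierRank Φ) + radius (quantifierRank Φ)))
... | G , χ , girth , S₀ , sub₀ , S₀∈C with evenSubdivision {C} closed S₀∈C sub₀
... | S , S∈C , sub = evenSubdivision-absurd {C} {H} {G} {S} {half-up p} (hereditary⇒monotone {C} hered closed) ¬bip
      (condition-owf {H} {half-up p} og) Φ defines sub (addable⇒manyCopies {C} {S} add S∈C) χ (GirthGt⇒OddWalkFree {G} girth)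

theorem5 : (∀ (C : Class) → Hereditary C → TopologicallyClosed C →
    (SomewhereDense C ⊎ BoundedExpansion C) →
    (Condition1 C ↔ BoundedExpansion C))
    ×
    (StarHypothesis →
    ∀ (C : Class) → Hereditary C → Addable C → TopologicallyClosed C →
    (Condition1 C ↔ BoundedExpansion C))
theorem5 =
  (λ C hered closed alternative →
    (λ cond → case alternative of λ
      { (inj₁ dense) → ⊥-elim (condition1⇒nowhereDense {C} hered closed cond dense)
      ; (inj₂ be) → be }) ,
    BoundedExpansion⇒Condition1 C) ,
  λ star C hered add closed →
    (λ cond → case star⇒lem star (BoundedExpansion C) of λ
      { (inj₁ be) → be
      ; (inj₂ ¬be) → ⊥-elim (condition1⇒¬¬boundedExpansion star {C} hered add closed cond ¬be) }) ,
    BoundedExpansion⇒Condition1 C
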